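{- Let $k,l$ be fixed integers and let $n\to\infty$. (1) If $l\ge 3$ and $k\ge 2$, then $ex(n,C_{2l},C_{2k})\le (1+o(1))\frac{2^{l-2}(k-1)^l}{2l}n^l$. (2) If $k>l\ge 2$, then $ex(n,C_{2l},C_{2k})\ge (1+o(1))\frac{(k-1)_l}{2l}n^l$. (3) If $l>k\ge 3$, then $ex(n,C_{2l},C_{2k})\ge (1+o(1))\frac{1}{l^l}n^l$.
   Context: $C_k$ denotes the cycle with $k$ vertices. For a graph $H$ and a family of graphs $\mathcal F$ (or a single graph $F$), $ex(n,H,\mathcal F)$ is the maximum number of (not necessarily induced) subgraphs isomorphic to $H$ in an $n$-vertex graph containing no member of $\mathcal F$ as a subgraph. For positive integers $n,l$, $(n)_l=n(n-1)\cdots(n-l+1)$. -}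

module Defs where

open import Data.Bool.Base using (true)
open import Data.Fin.Base using (Fin; toℕ)
import Data.Fin.Properties as Fin
open import Data.Fin.Subset using (Subset; inside; outside; _∈_)
open import Data.Fin.Subset.Properties using (_∈?_)
open import Data.Integer.Base using (+_)
open import Data.List.Base using (List; []; _∷_; length; map; filter; mapMaybe; cartesianProduct; cartesianProductWith)
open import Data.List.Extrema.Nat using (max)
open import Data.Maybe.Base using (Maybe; just; nothing)
open import Data.Nat.Base as ℕ using (ℕ; zero; suc; NonZero; _∸_; _^_)
open import Data.Nat.Combinatorics.Base using (_P′_)
import Data.Nat.Properties as ℕ
open import Data.Product.Base using (∃; ∃-syntax; _×_; _,_)
open import Data.Rational.Base using (ℚ; 0ℚ; 1ℚ; _/_; _+_; _*_; _≤_; _<_; ∣_∣)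
open import Data.Sum.Base using (_⊎_; swap)
open import Data.Vec.Base as Vec using (Vec; []; _∷_; lookup; tabulate)
open import Data.Vec.Properties using (lookup∘tabulate; []=⇒lookup; lookup⇒[]=)
open import Function.Base using (_∘_)
open import Function.Bundles using (_⇔_; mk⇔; module Equivalence)
open import Relation.Binary.Definitions using (Decidable)
open import Relation.Binary.PropositionalEquality using (_≡_; _≢_; refl; sym; trans)
open import Relation.Nullary using (Dec; yes; no; ¬_; does; ¬?; _×-dec_; _⊎-dec_; _→-dec_)
open import Relation.Nullary.Decidable using (map′; dec-true)
import Relation.Unary as U

------------------------------------------------------------------------
-- Finite simple graphs

IsSimple : ∀ {n} → Vec (Subset n) n → Set
IsSimple N = (∀ i → ¬ i ∈ lookup N i) × (∀ i j → j ∈ lookup N i → i ∈ lookup N j)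

-- The vertex set is all of Fin n; lookup nbrs i is the neighbourhood of i.
-- Since the proof is irrelevant, distinct elements of Graph n have distinct
-- edge sets.
record Graph (n : ℕ) : Set where
  constructor graph
  field
    nbrs      : Vec (Subset n) n
    .isSimple : IsSimple nbrs

Adj : ∀ {n} → Graph n → Fin n → Fin n → Set
Adj G i j = j ∈ lookup (Graph.nbrs G) i

Adj? : ∀ {n} (G : Graph n) → Decidable (Adj G)
Adj? G i j = j ∈? lookup (Graph.nbrs G) i

module _ {n} {R : Fin n → Fin n → Set} (R? : Decidable R) where

  nbrsOf : Vec (Subset n) n
  nbrsOf = tabulate λ i → tabulate λ j → does (R? i j)

  private
    entry : ∀ i j → lookup (lookup nbrsOf i) j ≡ does (R? i j)
    entry i j rewrite lookup∘tabulate (λ i → tabulate λ j → does (R? i j)) i =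
      lookup∘tabulate (λ j → does (R? i j)) j

    fromDoes : ∀ {A : Set} (A? : Dec A) → does A? ≡ true → A
    fromDoes (yes a) _ = a

  ∈-nbrsOf : ∀ i j → j ∈ lookup nbrsOf i ⇔ R i j
  ∈-nbrsOf i j = mk⇔
    (λ j∈ → fromDoes (R? i j) (trans (sym (entry i j)) ([]=⇒lookup j∈)))
    (λ r → lookup⇒[]= j (lookup nbrsOf i) (trans (entry i j) (dec-true (R? i j) r)))

  fromRelation : (∀ i → ¬ R i i) → (∀ i j → R i j → R j i) → Graph n
  fromRelation irr sm = graph nbrsOf
    ( (λ i → irr i ∘ Equivalence.to (∈-nbrsOf i i))
    , (λ i j → Equivalence.from (∈-nbrsOf j i) ∘ sm i j ∘ Equivalence.to (∈-nbrsOf i j)) )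

------------------------------------------------------------------------
-- Cycles

-- j is the cyclic successor of i, i.e. j ≡ i + 1 modulo k.
Next : ∀ {k} → Fin k → Fin k → Set
Next {k} i j = suc (toℕ i) ≡ toℕ j ⊎ (suc (toℕ i) ≡ k × toℕ j ≡ 0)

next? : ∀ {k} → Decidable (Next {k})
next? {k} i j = (suc (toℕ i) ℕ.≟ toℕ j) ⊎-dec ((suc (toℕ i) ℕ.≟ k) ×-dec (toℕ j ℕ.≟ 0))

-- The condition i ≢ j only matters for k = 1, where it removes a loop.
CycleAdj : ∀ {k} → Fin k → Fin k → Set
CycleAdj i j = i ≢ j × (Next i j ⊎ Next j i)

cycleAdj? : ∀ {k} → Decidable (CycleAdj {k})
cycleAdj? i j = ¬? (i Fin.≟ j) ×-dec (next? i j ⊎-dec next? j i)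

-- The cycle with k vertices, for k ≥ 3.
Cycle : ∀ k → Graph k
Cycle k = fromRelation cycleAdj?
  (λ i (i≢i , _) → i≢i refl)
  (λ i j (i≢j , adj) → i≢j ∘ sym , swap adj)

------------------------------------------------------------------------
-- Containment and copies

Injective : ∀ {h n} → Vec (Fin n) h → Set
Injective φ = ∀ i j → lookup φ i ≡ lookup φ j → i ≡ j

-- G contains F as a (not necessarily induced) subgraph.
Contains : ∀ {n f} → Graph n → Graph f → Set
Contains {n} {f} G F = ∃[ φ ] Injective {f} {n} φ ×
  (∀ i j → Adj F i j → Adj G (lookup φ i) (lookup φ j))

-- A candidate subgraph of an n-vertex graph: its vertex set and its edges.
PartialGraph : ℕ → Set
PartialGraph n = Subset n × Graph n

IsSubgraph : ∀ {n} → PartialGraph n → Graph n → Set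
IsSubgraph (V , E) G = ∀ i j → Adj E i j → (i ∈ V × j ∈ V) × Adj G i j

-- φ is an isomorphism from H onto the graph with vertex set V and edges E.
_≅_ : ∀ {n h} → PartialGraph n → Graph h → Set
_≅_ {n} {h} (V , E) H = ∃[ φ ] Injective {h} {n} φ ×
  (∀ v → (v ∈ V → ∃[ i ] lookup φ i ≡ v) × (∃[ i ] lookup φ i ≡ v → v ∈ V)) ×
  (∀ i j → (Adj H i j → Adj E (lookup φ i) (lookup φ j)) ×
           (Adj E (lookup φ i) (lookup φ j) → Adj H i j))

IsCopy : ∀ {n h} → Graph n → Graph h → PartialGraph n → Set
IsCopy G H S = IsSubgraph S G × S ≅ H

anyVec? : ∀ {n} m {P : Vec (Fin n) m → Set} → U.Decidable P → Dec (∃ P)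
anyVec? zero    P? = map′ ([] ,_) (λ { ([] , p) → p }) (P? [])
anyVec? (suc m) P? = map′ (λ (x , xs , p) → x ∷ xs , p) (λ { (x ∷ xs , p) → x , xs , p })
  (Fin.any? λ x → anyVec? m (P? ∘ (x ∷_)))

injective? : ∀ {h n} → U.Decidable (Injective {h} {n})
injective? φ = Fin.all? λ i → Fin.all? λ j → (lookup φ i Fin.≟ lookup φ j) →-dec (i Fin.≟ j)

isSimple? : ∀ {n} → U.Decidable (IsSimple {n})
isSimple? N = Fin.all? (λ i → ¬? (i ∈? lookup N i)) ×-dec
  Fin.all? (λ i → Fin.all? λ j → (j ∈? lookup N i) →-dec (i ∈? lookup N j))

contains? : ∀ {n f} (G : Graph n) (F : Graph f) → Dec (Contains G F)
contains? {f = f} G F = anyVec? f λ φ → injective? φ ×-dec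
  Fin.all? λ i → Fin.all? λ j → Adj? F i j →-dec Adj? G (lookup φ i) (lookup φ j)

isSubgraph? : ∀ {n} (S : PartialGraph n) (G : Graph n) → Dec (IsSubgraph S G)
isSubgraph? (V , E) G = Fin.all? λ i → Fin.all? λ j →
  Adj? E i j →-dec (((i ∈? V) ×-dec (j ∈? V)) ×-dec Adj? G i j)

_≅?_ : ∀ {n h} (S : PartialGraph n) (H : Graph h) → Dec (S ≅ H)
_≅?_ {h = h} (V , E) H = anyVec? h λ φ → injective? φ ×-dec
  (Fin.all? λ v → let hit = Fin.any? λ i → lookup φ i Fin.≟ v in
    ((v ∈? V) →-dec hit) ×-dec (hit →-dec (v ∈? V))) ×-dec
  (Fin.all? λ i → Fin.all? λ j →
    let e = Adj? E (lookup φ i) (lookup φ j) in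
    (Adj? H i j →-dec e) ×-dec (e →-dec Adj? H i j))

isCopy? : ∀ {n h} (G : Graph n) (H : Graph h) → U.Decidable (IsCopy G H)
isCopy? G H S = isSubgraph? S G ×-dec (S ≅? H)

------------------------------------------------------------------------
-- Generalized Turán numbers

allVecs : ∀ {A : Set} → List A → ∀ n → List (Vec A n)
allVecs xs zero    = [] ∷ []
allVecs xs (suc n) = cartesianProductWith _∷_ xs (allVecs xs n)

allSubsets : ∀ n → List (Subset n)
allSubsets = allVecs (outside ∷ inside ∷ [])

allGraphs : ∀ n → List (Graph n)
allGraphs n = mapMaybe toGraph (allVecs (allSubsets n) n)
  where
  toGraph : Vec (Subset n) n → Maybe (Graph n)
  toGraph N with isSimple? N
  ... | yes s = just (graph N s)
  ... | no  _ = nothing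

-- The number of subgraphs of G isomorphic to H.
copies : ∀ {n h} → Graph n → Graph h → ℕ
copies {n} G H = length (filter (isCopy? G H) (cartesianProduct (allSubsets n) (allGraphs n)))

-- The value is 0 if every graph on n vertices contains F, which does not
-- happen when F has an edge.
ex : ∀ {h f} → ℕ → Graph h → Graph f → ℕ
ex n H F = max 0 (map (λ G → copies G H) (filter (λ G → ¬? (contains? G F)) (allGraphs n)))

------------------------------------------------------------------------
-- Asymptotics as n → ∞

Eventually : (ℕ → Set) → Set
Eventually P = ∃[ N ] ∀ n → N ℕ.≤ n → P n

IsO1 : (ℕ → ℚ) → Set
IsO1 e = ∀ ε → 0ℚ < ε → Eventually λ n → ∣ e n ∣ < ε

infix 4 _≤[1+o1]_ _≥[1+o1]_

_≤[1+o1]_ : (ℕ → ℚ) → (ℕ → ℚ) → Set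
f ≤[1+o1] g = ∃[ e ] IsO1 e × Eventually λ n → f n ≤ (1ℚ + e n) * g n

_≥[1+o1]_ : (ℕ → ℚ) → (ℕ → ℚ) → Set
f ≥[1+o1] g = ∃[ e ] IsO1 e × Eventually λ n → (1ℚ + e n) * g n ≤ f n

fromℕ : ℕ → ℚ
fromℕ m = + m / 1

_÷_ : ℕ → (b : ℕ) → .{{NonZero b}} → ℚ
a ÷ b = + a / b

exCycles : (k l n : ℕ) → ℚ
exCycles k l n = fromℕ (ex n (Cycle (2 ℕ.* l)) (Cycle (2 ℕ.* k)))

-- m P′ l is the product m (m - 1) ⋯ (m - l + 1).
module _ (k l : ℕ) .{{_ : NonZero l}} where

  private instance
    2l≢0 : NonZero (2 ℕ.* l)
    2l≢0 = ℕ.m*n≢0 2 l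

    l^l≢0 : NonZero (l ^ l)
    l^l≢0 = ℕ.m^n≢0 l l

  bound₁ bound₂ bound₃ : ℕ → ℚ
  bound₁ n = ((2 ^ (l ∸ 2) ℕ.* (k ∸ 1) ^ l) ÷ (2 ℕ.* l)) * fromℕ (n ^ l)
  bound₂ n = (((k ∸ 1) P′ l) ÷ (2 ℕ.* l)) * fromℕ (n ^ l)
  bound₃ n = (1 ÷ (l ^ l)) * fromℕ (n ^ l)

module Submission where

-- (1) Let G be C₂ₖ-free, r = k − 1, and let f(u,v) be the number of common neighbours of u and v.
-- The edges between N(u) and any set outside it contain no path with 2k − 1 vertices whose ends
-- lie in N(u), so a degeneracy argument gives Σᵥ f(u,v) ≤ r n + O(d(u)), and the "fat" pairs, those
-- with f(u,v) > r, contribute only O(d(u)) to this sum. Hence Σ d² = O(n²) and Σ d = o(n²).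
-- A cycle a₁b₁a₂b₂⋯ of length 2l lies over the closed walk a₁a₂⋯aₗ, which is weighted by the
-- product of the f(aᵢ,aᵢ₊₁). If all pairs of one colour class are thin, the l rotations of the
-- cycle are among (1 + o(1)) rˡnˡ labelled ones; reflections are not used, as 2ˡ⁻² ≥ 2 leaves a
-- factor 2 to spare. Otherwise the cycle has a thin pair followed by a fat one, or two consecutive
-- fat pairs around a vertex of degree below n/q, or only vertices of degree at least n/q; there
-- are O(q²) such vertices, and each of the three kinds is rare.
-- (2) Count the cycles of length 2l in K_{k−1,n−k+1}.
-- (3) Replace every second vertex of a cycle of length 2l by about n/l copies.

open import Defs
open import Data.Bool.Base using (Bool; true; false; T; _∧_; _∨_; not)
import Data.Bool.Properties as Bool
open import Data.Empty using (⊥; ⊥-elim)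
open import Data.Empty.Irrelevant using () renaming (⊥-elim to ⊥-elim-irr)
open import Data.Fin.Base as Fin using (Fin; toℕ; fromℕ<; zero; suc; _↑ˡ_; _↑ʳ_; splitAt)
import Data.Fin.Properties as Fin
open import Data.Fin.Subset as Subset using (Subset; inside; outside)
import Data.Fin.Subset.Properties as Subset
import Data.Integer.Base as ℤ
import Data.Integer.Properties as ℤ
open import Data.List.Base as List using (List; []; _∷_; _++_; length; mapMaybe; filter; cartesianProduct; cartesianProductWith; concatMap; allFin; upTo)
open import Data.List.Extrema.Nat using (max≤v⁺; xs≤max)
open import Data.List.Membership.Propositional using (_∈_; _∉_)
open import Data.List.Membership.Propositional.Properties using (∈-map⁺; ∈-map⁻; ∈-∃++; ∈-++⁻; ∈-++⁺ˡ; ∈-++⁺ʳ; ∈-filter⁺; ∈-filter⁻; ∈-cartesianProduct⁺; ∈-cartesianProductWith⁺; ∈-allFin; ∈-upTo⁺)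
import Data.List.Properties as List
open import Data.List.Relation.Unary.All as All using (All; []; _∷_)
import Data.List.Relation.Unary.All.Properties as All
open import Data.List.Relation.Unary.AllPairs using ([]; _∷_)
open import Data.List.Relation.Unary.Any using (here; there)
open import Data.List.Relation.Unary.Unique.Propositional using (Unique)
import Data.List.Relation.Unary.Unique.Propositional.Properties as Unique
open import Data.Maybe.Base using (Maybe; just; nothing)
open import Data.Nat.Base using (ℕ; zero; suc; NonZero; _≤_; _<_; _+_; _*_; _∸_; _^_; _⊔_; z≤n; s≤s; z<s; s<s; pred; s≤s⁻¹; s<s⁻¹; _≤ᵇ_; >-nonZero)
open import Data.Nat.Combinatorics.Base using (_P′_)
open import Data.Nat.DivMod using (_%_; _/_; m%n<n; m%n%n≡m%n; m<n⇒m%n≡m; %-distribˡ-+; m≡m%n+[m/n]*n; n%n≡0; [m+n]%n≡m%n; [m+kn]%n≡m%n; m*n/n≡m; m/n*n≤m; /-monoˡ-≤)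
import Data.Nat.ListAction as ListAction
import Data.Nat.ListAction.Properties as ListAction
open import Data.Nat.Properties as ℕ using (≤-refl; ≤-trans; module ≤-Reasoning)
open import Data.Nat.Tactic.RingSolver using (solve-∀)
open import Data.Product.Base using (∃; ∃-syntax; Σ; _×_; _,_; proj₁; proj₂)
open import Data.Rational.Base as ℚ using (ℚ)
import Data.Rational.Properties as ℚ
open import Data.Rational.Unnormalised.Base as ℚᵘ using (mkℚᵘ)
import Data.Rational.Unnormalised.Properties as ℚᵘ
open import Data.Sum.Base as Sum using (_⊎_; inj₁; inj₂; [_,_]′)
open import Data.Vec.Base as Vec using (Vec; []; _∷_; lookup; tabulate)
open import Data.Vec.Properties as Vec using (lookup∘tabulate; tabulate∘lookup; tabulate-cong; lookup⇒[]=; []=⇒lookup)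
open import Function.Base using (_∘_; id; case_of_; _$_; it)
open import Function.Bundles using (module Equivalence)
open import Relation.Binary.Definitions using (tri<; tri≈; tri>)
open import Relation.Binary.PropositionalEquality using (_≡_; _≢_; refl; sym; trans; cong; cong₂; subst; subst₂; _≗_; module ≡-Reasoning)
open import Relation.Nullary using (Dec; yes; no; ¬_; does; contradiction)
open import Relation.Nullary.Decidable using (recompute; dec-true; dec-false; _×-dec_; _⊎-dec_; ¬?)

-- The obstacle in (1) is that the main term needs the exact base `r`, whereas everything else may
-- be lost up to constants. Only the row sums of codegrees have the leading constant `r`, and their
-- error is proportional to the degree of the row's vertex; hence the interest in the first two
-- moments of the degrees. No limits are taken before the very end. Errors are carried by an integer
-- `q`: each bound reads `q * X ≤ c * n ^ l`, with `c` independent of `q`, plus `q` times the main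
-- term where there is one, for all `n` beyond a threshold depending on `q`. A suitable multiple of
-- the total error constant is then put for `q`. The three rare kinds are exhaustive: if no thin
-- pair is followed by a fat one, each colour class is entirely thin or entirely fat. When both are
-- fat, every vertex lies between two consecutive fat pairs, so either a small vertex gives the
-- second kind or all vertices are big. Instead of dividing by symmetries, every copy is charged a
-- total weight of at least `l`.

private variable
  n m : ℕ

-- Finite sums

𝟙 : Bool → ℕ
𝟙 true  = 1
𝟙 false = 0

𝟙≤1 : ∀ b → 𝟙 b ≤ 1
𝟙≤1 true  = ≤-refl
𝟙≤1 false = z≤n

𝟙-∧ : ∀ a b → 𝟙 (a ∧ b) ≡ 𝟙 a * 𝟙 b
𝟙-∧ true  b = sym (ℕ.+-identityʳ (𝟙 b))
𝟙-∧ false b = refl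

𝟙*≤ : ∀ b x → 𝟙 b * x ≤ x
𝟙*≤ true  x = ℕ.≤-reflexive (ℕ.+-identityʳ x)
𝟙*≤ false x = z≤n

opaque
  sum : (Fin n → ℕ) → ℕ
  sum {zero}  f = 0
  sum {suc n} f = f zero + sum (f ∘ suc)

  sum-suc : (f : Fin (suc n) → ℕ) → sum f ≡ f zero + sum (f ∘ suc)
  sum-suc f = refl

  sum-cong-≗ : {f g : Fin n → ℕ} → f ≗ g → sum f ≡ sum g
  sum-cong-≗ {zero}  f≗g = refl
  sum-cong-≗ {suc n} f≗g = cong₂ _+_ (f≗g zero) (sum-cong-≗ (f≗g ∘ suc))

  sum-mono : {f g : Fin n → ℕ} → (∀ i → f i ≤ g i) → sum f ≤ sum g
  sum-mono {zero}  f≤g = z≤n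
  sum-mono {suc n} f≤g = ℕ.+-mono-≤ (f≤g zero) (sum-mono (f≤g ∘ suc))

  sum-const : ∀ n c → sum {n} (λ _ → c) ≡ n * c
  sum-const zero    c = refl
  sum-const (suc n) c = cong (c +_) (sum-const n c)

  sum-positive : {f : Fin n → ℕ} → 0 < sum f → ∃ λ i → 0 < f i
  sum-positive {suc n} {f} 0<∑ with f zero in eq
  ... | suc _ = zero , subst (0 <_) (sym eq) z<s
  ... | zero with i , 0<f ← sum-positive {f = f ∘ suc} 0<∑ = suc i , 0<f

  sum-*ˡ : ∀ c (f : Fin n → ℕ) → sum (λ i → c * f i) ≡ c * sum f
  sum-*ˡ {zero}  c f = sym (ℕ.*-zeroʳ c)
  sum-*ˡ {suc n} c f = trans (cong (c * f zero +_) (sum-*ˡ c (f ∘ suc)))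
    (sym (ℕ.*-distribˡ-+ c (f zero) (sum (f ∘ suc))))

  sum-+ : ∀ (f g : Fin n → ℕ) → sum (λ i → f i + g i) ≡ sum f + sum g
  sum-+ {zero}  f g = refl
  sum-+ {suc n} f g = trans (cong (f zero + g zero +_) (sum-+ (f ∘ suc) (g ∘ suc)))
    (exchange (f zero) (g zero) (sum (f ∘ suc)) (sum (g ∘ suc)))
    where
    exchange : ∀ a b c d → a + b + (c + d) ≡ a + c + (b + d)
    exchange = solve-∀

  term≤sum : ∀ (f : Fin n → ℕ) i → f i ≤ sum f
  term≤sum f zero    = ℕ.m≤m+n _ _
  term≤sum f (suc i) = ≤-trans (term≤sum (f ∘ suc) i) (ℕ.m≤n+m _ _)

sum-zero : {f : Fin n → ℕ} → (∀ i → f i ≡ 0) → sum f ≡ 0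
sum-zero {n} f≡0 = trans (sum-cong-≗ f≡0) (trans (sum-const n 0) (ℕ.*-zeroʳ n))

sum-bound : {f : Fin n → ℕ} {c : ℕ} → (∀ i → f i ≤ c) → sum f ≤ n * c
sum-bound {n} {c = c} f≤c = ≤-trans (sum-mono f≤c) (ℕ.≤-reflexive (sum-const n c))

sum-*ʳ : ∀ c (f : Fin n → ℕ) → sum (λ i → f i * c) ≡ sum f * c
sum-*ʳ c f = trans (sum-cong-≗ λ i → ℕ.*-comm (f i) c) (trans (sum-*ˡ c f) (ℕ.*-comm c (sum f)))

opaque
  unfolding sum

  sum-comm : (f : Fin m → Fin n → ℕ) → sum (λ i → sum λ j → f i j) ≡ sum (λ j → sum λ i → f i j)
  sum-comm {zero} {n} f = sym (sum-zero {n} {λ _ → 0} λ j → refl)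
  sum-comm {suc m} f = trans (cong (sum (f zero) +_) (sum-comm (f ∘ suc))) (sym (sum-+ (f zero) _))

_≟ᵇ_ : Fin n → Fin n → Bool
u ≟ᵇ v = does (u Fin.≟ v)

≟ᵇ-refl : (v : Fin n) → (v ≟ᵇ v) ≡ true
≟ᵇ-refl v with v Fin.≟ v
... | yes _  = refl
... | no v≢v = contradiction refl v≢v

≟ᵇ-false : {u v : Fin n} → u ≢ v → (u ≟ᵇ v) ≡ false
≟ᵇ-false {u = u} {v} u≢v with u Fin.≟ v
... | yes u≡v = contradiction u≡v u≢v
... | no _    = refl

sum-δ : ∀ (v : Fin n) (f : Fin n → ℕ) → sum (λ u → 𝟙 (v ≟ᵇ u) * f u) ≡ f v
sum-δ zero    f = trans (sum-suc _) (trans (cong₂ _+_ (ℕ.+-identityʳ (f zero)) (sum-zero λ _ → refl)) (ℕ.+-identityʳ (f zero)))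
sum-δ (suc v) f = trans (sum-suc _) (trans (sum-cong-≗ λ u → cong (λ b → 𝟙 b * f (suc u)) (step v u)) (sum-δ v (f ∘ suc)))
  where
  step : ∀ {n} (v u : Fin n) → (suc v ≟ᵇ suc u) ≡ (v ≟ᵇ u)
  step v u with v Fin.≟ u
  ... | yes refl = refl
  ... | no _     = refl

_∖_ : (Fin n → Bool) → Fin n → Fin n → Bool
(s ∖ v) u = s u ∧ not (v ≟ᵇ u)

sum-∖ : ∀ (s : Fin n → Bool) v → s v ≡ true → ∀ (f : Fin n → ℕ) →
  sum (λ u → 𝟙 (s u) * f u) ≡ sum (λ u → 𝟙 ((s ∖ v) u) * f u) + f v
sum-∖ s v sv f = begin
  sum (λ u → 𝟙 (s u) * f u)                                ≡⟨ sum-cong-≗ split ⟩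
  sum (λ u → 𝟙 ((s ∖ v) u) * f u + 𝟙 (v ≟ᵇ u) * f u)       ≡⟨ sum-+ _ _ ⟩
  sum (λ u → 𝟙 ((s ∖ v) u) * f u) + sum (λ u → 𝟙 (v ≟ᵇ u) * f u)
                                                           ≡⟨ cong (sum (λ u → 𝟙 ((s ∖ v) u) * f u) +_) (sum-δ v f) ⟩
  sum (λ u → 𝟙 ((s ∖ v) u) * f u) + f v                    ∎
  where
  open ≡-Reasoning
  split : ∀ u → 𝟙 (s u) * f u ≡ 𝟙 ((s ∖ v) u) * f u + 𝟙 (v ≟ᵇ u) * f u
  split u with v Fin.≟ u
  ... | yes refl rewrite sv = refl
  ... | no _ rewrite Bool.∧-identityʳ (s u) = sym (ℕ.+-identityʳ _)

T⇒true : ∀ {b} → T b → b ≡ true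
T⇒true {true} _ = refl

true-dec : ∀ b → (b ≡ true) ⊎ (b ≡ false)
true-dec true  = inj₁ refl
true-dec false = inj₂ refl

∧-true : ∀ {a b} → a ∧ b ≡ true → a ≡ true × b ≡ true
∧-true {true} {true} _ = refl , refl

count : (Fin n → Bool) → ℕ
count s = sum λ u → 𝟙 (s u)

deg : (Fin n → Fin n → Bool) → (Fin n → Bool) → Fin n → ℕ
deg h s u = sum λ w → 𝟙 (s w) * 𝟙 (h u w)

-- Each vertex is charged for the edges it still has when it is deleted.
degeneracy : ∀ (h : Fin n → Fin n → Bool) (p : Fin n → ℕ) → (∀ u v → h u v ≡ h v u) →
  (∀ s v → s v ≡ true → ∃ λ w → s w ≡ true × deg h s w ≤ p w) →
  sum (λ u → sum λ v → 𝟙 (h u v)) ≤ 2 * sum p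
degeneracy {n} h p h-sym low = subst₂ _≤_
  (sum-cong-≗ λ u → trans (ℕ.+-identityʳ _) (sum-cong-≗ λ v → ℕ.+-identityʳ _))
  (cong (2 *_) (sum-cong-≗ λ u → ℕ.+-identityʳ (p u)))
  (go _ (λ _ → true) ≤-refl)
  where
  go : ∀ m s → count s ≤ m → sum (λ u → 𝟙 (s u) * deg h s u) ≤ 2 * sum (λ u → 𝟙 (s u) * p u)
  go m s size with Fin.any? (λ v → s v Bool.≟ true)
  ... | no empty = ℕ.≤-trans (ℕ.≤-reflexive (sum-zero zeros)) z≤n
    where
    zeros : ∀ u → 𝟙 (s u) * deg h s u ≡ 0
    zeros u with s u in eq
    ... | true  = contradiction (u , eq) empty
    ... | false = refl
  ... | yes (v , sv) with low s v sv
  ... | w , sw , dw≤p with m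
  ... | zero  = contradiction (≤-trans (subst (λ b → 𝟙 b ≤ count s) sw (term≤sum _ w)) size) λ ()
  ... | suc m = begin
    sum (λ u → 𝟙 (s u) * deg h s u)
      ≡⟨ sum-cong-≗ (λ u → trans (cong (𝟙 (s u) *_) (sum-∖ s w sw (λ x → 𝟙 (h u x)))) (ℕ.*-distribˡ-+ (𝟙 (s u)) _ _)) ⟩
    sum (λ u → 𝟙 (s u) * deg h s′ u + 𝟙 (s u) * 𝟙 (h u w))
      ≡⟨ sum-+ _ _ ⟩
    sum (λ u → 𝟙 (s u) * deg h s′ u) + sum (λ u → 𝟙 (s u) * 𝟙 (h u w))
      -- Deleting `w` removes its row and its column. By symmetry the column is `deg h s w`; the row
      -- is only `deg h s′ w`, which `deg-mono` compares with it.
      ≡⟨ cong₂ _+_ (sum-∖ s w sw _) (sum-cong-≗ λ u → cong (λ b → 𝟙 (s u) * 𝟙 b) (h-sym u w)) ⟩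
    (sum (λ u → 𝟙 (s′ u) * deg h s′ u) + deg h s′ w) + deg h s w
      ≤⟨ ℕ.+-mono-≤ (ℕ.+-mono-≤ (go m s′ size′) (≤-trans deg-mono dw≤p)) dw≤p ⟩
    (2 * sum (λ u → 𝟙 (s′ u) * p u) + p w) + p w
      ≡⟨ double (sum (λ u → 𝟙 (s′ u) * p u)) (p w) ⟩
    2 * (sum (λ u → 𝟙 (s′ u) * p u) + p w)
      ≡⟨ cong (2 *_) (sum-∖ s w sw p) ⟨
    2 * sum (λ u → 𝟙 (s u) * p u) ∎
    where
    open ≤-Reasoning
    s′ = s ∖ w
    double : ∀ a b → (2 * a + b) + b ≡ 2 * (a + b)
    double = solve-∀
    deg-mono : deg h s′ w ≤ deg h s w
    deg-mono = ≤-trans (ℕ.m≤m+n _ _) (ℕ.≤-reflexive (sym (sum-∖ s w sw (λ x → 𝟙 (h w x)))))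
    count-∖ : count s ≡ count s′ + 1
    count-∖ = trans (sum-cong-≗ λ u → sym (ℕ.*-identityʳ _))
      (trans (sum-∖ s w sw (λ _ → 1)) (cong (_+ 1) (sum-cong-≗ λ u → ℕ.*-identityʳ _)))
    size′ : count s′ ≤ m
    size′ = s≤s⁻¹ (≤-trans (ℕ.≤-reflexive (trans (ℕ.+-comm 1 _) (sym count-∖))) size)

-- Paths and codegrees in C₂ₖ-free graphs

-- Each entry of `L` accounts for at most one unit of the sum, so striking out the entries one by
-- one leaves a positive remainder.
fresh : ∀ (f : Fin n → ℕ) → (∀ v → f v ≤ 1) → ∀ L → length L < sum f → ∃ λ v → 0 < f v × v ∉ L
fresh f f≤1 []      0<∑ with v , 0<f ← sum-positive 0<∑ = v , 0<f , λ ()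
fresh f f≤1 (y ∷ L) L<∑ = case fresh g g≤1 L L<∑g of λ where
    (v , 0<g , v∉L) → v , ≤-trans 0<g (𝟙*≤ (not (y ≟ᵇ v)) (f v)) ,
      λ { (here refl) → contradiction 0<g (λ 0<g → ℕ.<⇒≢ 0<g (sym (cong (λ b → 𝟙 (not b) * f v) (≟ᵇ-refl v))))
        ; (there v∈L) → v∉L v∈L }
  where
  g : Fin _ → ℕ
  g v = 𝟙 (not (y ≟ᵇ v)) * f v
  g≤1 : ∀ v → g v ≤ 1
  g≤1 v = ≤-trans (𝟙*≤ (not (y ≟ᵇ v)) (f v)) (f≤1 v)
  split : ∀ v → f v ≡ 𝟙 (y ≟ᵇ v) * f v + g v
  split v with y ≟ᵇ v
  ... | true  = trans (sym (ℕ.+-identityʳ _)) (sym (ℕ.+-identityʳ _))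
  ... | false = sym (ℕ.+-identityʳ _)
  ∑f : sum f ≡ f y + sum g
  ∑f = trans (sum-cong-≗ split) (trans (sum-+ _ g) (cong (_+ sum g) (sum-δ y f)))
  L<∑g : length L < sum g
  L<∑g = s<s⁻¹ (≤-trans L<∑ (≤-trans (ℕ.≤-reflexive ∑f) (ℕ.+-monoˡ-≤ (sum g) (f≤1 y))))

-- A path from a to y with m steps; its vertices are listed from y back to a.
data Path {n : ℕ} (R : Fin n → Fin n → Set) (a : Fin n) : Fin n → List (Fin n) → ℕ → Set where
  start : Path R a a (a ∷ []) 0
  step  : ∀ {x xs m} → Path R a x xs m → ∀ {y} → R x y → y ∉ xs → Path R a y (y ∷ xs) (suc m)

module _ {n : ℕ} {R : Fin n → Fin n → Set} {a : Fin n} where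

  -- The greedy path. The codegree bounds apply it in subgraphs whose minimum degree exceeds the
  -- number of path vertices that a next vertex could hit.
  grow : ∀ M → (∀ {y xs m} → Path R a y xs m → m < M → ∃ λ v → R y v × v ∉ xs) →
         ∀ m → m ≤ M → ∃[ y ] ∃[ xs ] Path R a y xs m
  grow M ext zero    _   = a , a ∷ [] , start
  grow M ext (suc m) m<M with y , xs , p ← grow M ext m (ℕ.<⇒≤ m<M)
    with v , r , v∉ ← ext p m<M =
    v , v ∷ xs , step p r v∉

  path-length : ∀ {y xs m} → Path R a y xs m → length xs ≡ suc m
  path-length start        = refl
  path-length (step p _ _) = cong suc (path-length p)

  path-all : ∀ {P : Fin n → Set} → P a → (∀ {x y} → R x y → P y) →
             ∀ {y xs m} → Path R a y xs m → ∀ {z} → z ∈ xs → P z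
  path-all pa _  start        (here refl) = pa
  path-all _  pr (step _ r _) (here refl) = pr r
  path-all pa pr (step p _ _) (there z∈)  = path-all pa pr p z∈

  path-head : ∀ {y xs m} → Path R a y xs m → y ∈ xs
  path-head start        = here refl
  path-head (step _ _ _) = here refl

path-map : ∀ {R S : Fin n → Fin n → Set} → (∀ {x y} → R x y → S x y) →
           ∀ {a y xs m} → Path R a y xs m → Path S a y xs m
path-map f start         = start
path-map f (step p r y∉) = step (path-map f p) (f r) y∉

odds evens : {A : Set} → List A → List A
odds  []       = []
odds  (x ∷ xs) = evens xs
evens []       = []
evens (x ∷ xs) = x ∷ odds xs

length-odds  : {A : Set} (xs : List A) → 2 * length (odds xs) ≤ length xs
length-evens : {A : Set} (xs : List A) → 2 * length (evens xs) ≤ suc (length xs)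
length-odds  []       = z≤n
length-odds  (x ∷ xs) = length-evens xs
length-evens []       = z≤n
length-evens (x ∷ xs) = ≤-trans (ℕ.≤-reflexive (cong suc (ℕ.+-suc _ _))) (s≤s (s≤s (length-odds xs)))

module _ {n : ℕ} {R : Fin n → Fin n → Set} (c : Fin n → Bool)
         (alternating : ∀ {x y} → R x y → c y ≡ not (c x)) {a : Fin n} where

  -- A next vertex has the colour opposite to the end `y`, and that colour occurs only at odd
  -- positions of the list. It therefore has to avoid just half of the path, which is why minimum
  -- degree above `r` is enough in the bipartite case where the general case asks for `2 * r`.
  colours : ∀ {y xs m} → Path R a y xs m → ∀ {z} → z ∈ xs →
            (z ∈ odds xs × c z ≡ not (c y)) ⊎ (z ∈ evens xs × c z ≡ c y)
  colours start        (here refl) = inj₂ (here refl , refl)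
  colours (step _ _ _) (here refl) = inj₂ (here refl , refl)
  colours (step p r _) (there z∈)  with colours p z∈
  ... | inj₁ (z∈o , eq) = inj₂ (there z∈o , trans eq (sym (alternating r)))
  ... | inj₂ (z∈e , eq) = inj₁ (z∈e , trans eq (trans (sym (Bool.not-involutive _)) (cong not (sym (alternating r)))))

  even-path : ∀ j {y xs} → Path R a y xs (j + j) → c y ≡ c a
  even-path zero    start = refl
  even-path (suc j) p rewrite ℕ.+-suc j j with step (step p r _) r′ _ ← p =
    trans (alternating r′) (trans (cong not (alternating r)) (trans (Bool.not-involutive _) (even-path j p)))

Adj-sym : (G : Graph n) → ∀ {u v} → Adj G u v → Adj G v u
Adj-sym G@(graph _ simple) {u} {v} uv = recompute (Adj? G v u) (proj₂ simple u v uv)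

Adj-irrefl : (G : Graph n) → ∀ {u} → ¬ Adj G u u
Adj-irrefl G@(graph _ simple) {u} uu = recompute (¬? (Adj? G u u)) (proj₁ simple u) uu

module _ {n : ℕ} (G : Graph n) where

  adj : Fin n → Fin n → Bool
  adj u v = does (Adj? G u v)

  adj⇒Adj : ∀ {u v} → adj u v ≡ true → Adj G u v
  adj⇒Adj {u} {v} eq with Adj? G u v
  ... | yes uv = uv

  Adj⇒adj : ∀ {u v} → Adj G u v → adj u v ≡ true
  Adj⇒adj {u} {v} = dec-true (Adj? G u v)

  adj-sym : ∀ u v → adj u v ≡ adj v u
  adj-sym u v with Adj? G u v | Adj? G v u
  ... | yes _  | yes _  = refl
  ... | no _   | no _   = refl
  ... | yes uv | no ¬vu = contradiction (Adj-sym G uv) ¬vu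
  ... | no ¬uv | yes vu = contradiction (Adj-sym G vu) ¬uv

  adj-irrefl : ∀ u → adj u u ≡ false
  adj-irrefl u = dec-false (Adj? G u u) (Adj-irrefl G)

  degree : Fin n → ℕ
  degree u = sum λ v → 𝟙 (adj u v)

  codegree : Fin n → Fin n → ℕ
  codegree u v = sum λ x → 𝟙 (adj u x) * 𝟙 (adj x v)

  private
    look : (xs : List (Fin n)) → Fin (length xs) → Fin n
    look xs = lookup (Vec.fromList xs)

    look-∈ : ∀ xs i → look xs i ∈ xs
    look-∈ (x ∷ xs) zero    = here refl
    look-∈ (x ∷ xs) (suc i) = there (look-∈ xs i)

    look-injective : ∀ {a y xs m} → Path (Adj G) a y xs m → ∀ i j → look xs i ≡ look xs j → i ≡ j
    look-injective start         zero    zero    _  = refl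
    look-injective (step p _ y∉) zero    zero    _  = refl
    look-injective (step p _ y∉) zero    (suc j) eq = contradiction (subst (_∈ _) (sym eq) (look-∈ _ j)) y∉
    look-injective (step p _ y∉) (suc i) zero    eq = contradiction (subst (_∈ _) eq (look-∈ _ i)) y∉
    look-injective (step p _ y∉) (suc i) (suc j) eq = cong suc (look-injective p i j eq)

    look-first : ∀ {a y xs m} → Path (Adj G) a y xs m → ∀ i → toℕ i ≡ 0 → look xs i ≡ y
    look-first start        zero _ = refl
    look-first (step _ _ _) zero _ = refl

    look-last : ∀ {a y xs m} → Path (Adj G) a y xs m → ∀ i → suc (toℕ i) ≡ length xs → look xs i ≡ a
    look-last start                       zero    _  = refl
    look-last (step (step p _ _) _ _)     zero    ()
    look-last (step p _ _) (suc i) eq = look-last p i (ℕ.suc-injective eq)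

    look-adj : ∀ {a y xs m} → Path (Adj G) a y xs m → ∀ i j → suc (toℕ i) ≡ toℕ j →
               Adj G (look xs i) (look xs j)
    look-adj start zero zero ()
    look-adj (step p r _) zero    (suc j) eq =
      subst (Adj G _) (sym (look-first p j (ℕ.suc-injective (sym eq)))) (Adj-sym G r)
    look-adj (step p _ _) (suc i) (suc j) eq = look-adj p i j (ℕ.suc-injective eq)

  closed-path⇒cycle : ∀ {a y xs m N} → Path (Adj G) a y xs m → Adj G y a → length xs ≡ N →
                      Contains G (Cycle N)
  closed-path⇒cycle {a} {y} {xs} p ya refl = Vec.fromList xs , look-injective p , edges
    where
    next : ∀ i j → Next i j → Adj G (look xs i) (look xs j)
    next i j (inj₁ eq)         = look-adj p i j eq
    next i j (inj₂ (eq , eq₀)) = subst₂ (Adj G) (sym (look-last p i eq)) (sym (look-first p j eq₀)) (Adj-sym G ya)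
    edges : ∀ i j → Adj (Cycle (length xs)) i j → Adj G (look xs i) (look xs j)
    edges i j ij with proj₂ (Equivalence.to (∈-nbrsOf cycleAdj? i j) ij)
    ... | inj₁ nx = next i j nx
    ... | inj₂ nx = Adj-sym G (next j i nx)

  module _ (r : ℕ) (free : ¬ Contains G (Cycle (2 * suc r))) (u : Fin n) where

    private
      -- The one place where freeness is contradicted: two neighbours of `u` joined by a path with
      -- `2 * r` edges close up through `u` to a cycle on `2 * suc r` vertices.
      no-return : ∀ {R a y xs} → Path R a y xs (r + r) → (∀ {x y} → R x y → Adj G x y) →
                  Adj G u a → Adj G u y → u ∉ xs → ⊥
      no-return p R⇒Adj ua uy u∉ = free (closed-path⇒cycle
        (step (path-map R⇒Adj p) (Adj-sym G uy) u∉) ua (trans (cong suc (path-length p)) (len r)))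
        where
        len : ∀ r → 2 + (r + r) ≡ 2 * suc r
        len = solve-∀

      nonempty-degree : ∀ (h : Fin n → Fin n → Bool) s w {c} → c < deg h s w → ∀ L → length L ≤ c →
        ∃ λ v → (h w v ≡ true × s v ≡ true) × v ∉ L
      nonempty-degree h s w c<d L L≤c with fresh (λ v → 𝟙 (s v) * 𝟙 (h w v))
          (λ v → ≤-trans (𝟙*≤ (s v) _) (𝟙≤1 _)) L (ℕ.≤-<-trans L≤c c<d)
      ... | v , pos , v∉ with s v in sv | h w v in hwv
      ... | true | true = v , (hwv , sv) , v∉

      low-vertex : ∀ (h : Fin n → Fin n → Bool) (p : Fin n → ℕ) s v → s v ≡ true →
        (∀ w → s w ≡ true → p w < deg h s w) ⊎ ∃ (λ w → s w ≡ true × deg h s w ≤ p w)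
      low-vertex h p s v sv with Fin.any? (λ w → (s w Bool.≟ true) ×-dec (deg h s w ℕ.≤? p w))
      ... | yes found = inj₂ found
      ... | no  none  = inj₁ λ w sw → ℕ.≰⇒> λ d≤p → none (w , sw , d≤p)

    -- The left side counts the ordered pairs of adjacent vertices in the neighbourhood of `u`. A
    -- subgraph there of minimum degree above `2 * r` would contain a path with `2 * r` edges, whose
    -- ends are automatically neighbours of `u`.
    codegree-inside : sum (λ v → 𝟙 (adj u v) * codegree u v) ≤ 4 * r * degree u
    codegree-inside = begin
      sum (λ v → 𝟙 (adj u v) * codegree u v)         ≡⟨ sum-cong-≗ (λ v → sum-*ˡ (𝟙 (adj u v)) _) ⟨
      sum (λ v → sum λ x → 𝟙 (adj u v) * (𝟙 (adj u x) * 𝟙 (adj x v)))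
        ≡⟨ sum-cong-≗ (λ v → sum-cong-≗ λ x → pointwise v x) ⟩
      sum (λ v → sum λ x → 𝟙 (h v x))                 ≤⟨ degeneracy h p h-sym low ⟩
      2 * sum p                                       ≡⟨ cong (2 *_) (sum-*ˡ (2 * r) _) ⟩
      2 * (2 * r * degree u)                          ≡⟨ assoc r (degree u) ⟩
      4 * r * degree u                                ∎
      where
      open ≤-Reasoning
      a = adj u
      h : Fin n → Fin n → Bool
      h x y = (a x ∧ a y) ∧ adj x y
      p : Fin n → ℕ
      p w = 2 * r * 𝟙 (a w)
      assoc : ∀ r d → 2 * (2 * r * d) ≡ 4 * r * d
      assoc = solve-∀
      pointwise : ∀ v x → 𝟙 (a v) * (𝟙 (a x) * 𝟙 (adj x v)) ≡ 𝟙 (h v x)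
      pointwise v x rewrite adj-sym x v | 𝟙-∧ (a v ∧ a x) (adj v x) | 𝟙-∧ (a v) (a x) =
        sym (ℕ.*-assoc (𝟙 (a v)) _ _)
      h-sym : ∀ x y → h x y ≡ h y x
      h-sym x y = cong₂ _∧_ (Bool.∧-comm (a x) (a y)) (adj-sym x y)
      low : ∀ s v → s v ≡ true → ∃ λ w → s w ≡ true × deg h s w ≤ p w
      low s v sv with low-vertex h p s v sv
      ... | inj₂ found = found
      ... | inj₁ high  = ⊥-elim (no-return path (λ {x} {y} (hxy , _) → adj⇒Adj (proj₂ (∧-true {a x ∧ a y} hxy)))
              (adj⇒Adj (in-A v sv)) (adj⇒Adj (all-A (path-head path)))
              λ u∈ → case trans (sym (adj-irrefl u)) (all-A u∈) of λ ())
        where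
        R : Fin n → Fin n → Set
        R x y = h x y ≡ true × s y ≡ true
        in-A : ∀ w → s w ≡ true → a w ≡ true
        in-A w sw with nonempty-degree h s w (high w sw) [] z≤n
        ... | x , (hwx , _) , _ = proj₁ (∧-true (proj₁ (∧-true {a w ∧ a x} hwx)))
        high′ : ∀ w → s w ≡ true → 2 * r < deg h s w
        high′ w sw = subst (_< deg h s w) (trans (cong (λ b → 2 * r * 𝟙 b) (in-A w sw)) (ℕ.*-identityʳ _)) (high w sw)
        in-s : ∀ {y xs m} → Path R v y xs m → s y ≡ true
        in-s q = path-all {P = λ z → s z ≡ true} sv proj₂ q (path-head q)
        extend : ∀ {y xs m} → Path R v y xs m → m < r + r → ∃ λ z → R y z × z ∉ xs
        extend {y} {xs} q m< = nonempty-degree h s y (high′ y (in-s q)) xs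
          (≤-trans (ℕ.≤-reflexive (path-length q)) (≤-trans m< (ℕ.≤-reflexive (cong (r +_) (sym (ℕ.+-identityʳ r))))))
        path = proj₂ (proj₂ (grow (r + r) extend (r + r) ≤-refl))
        all-A : ∀ {z} → z ∈ _ → a z ≡ true
        all-A = path-all {P = λ z → a z ≡ true} (in-A v sv) (λ {_} {y} (_ , sy) → in-A y sy) path

    -- The left side counts the edges between the neighbourhood of `u` and `b`. They form a
    -- bipartite graph, so minimum degree above `r` already yields a path with `2 * r` edges from a
    -- neighbour of `u`, and its even length brings it back to a neighbour of `u`.
    codegree-outside : ∀ (b : Fin n → Bool) → b u ≡ false → (∀ v → b v ≡ true → adj u v ≡ false) →
      sum (λ v → 𝟙 (b v) * codegree u v) ≤ r * (degree u + count b)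
    codegree-outside b bu disjoint = ℕ.*-cancelˡ-≤ 2 (begin
      2 * sum (λ v → 𝟙 (b v) * codegree u v)
        ≡⟨ cong (sum (λ v → 𝟙 (b v) * codegree u v) +_) (ℕ.+-identityʳ _) ⟩
      sum (λ v → 𝟙 (b v) * codegree u v) + sum (λ v → 𝟙 (b v) * codegree u v)
        ≡⟨ cong₂ _+_ expand (trans expand (sum-comm _)) ⟩
      sum (λ v → sum λ x → e v x) + sum (λ v → sum λ x → e x v)
        ≡⟨ trans (sum-cong-≗ λ v → sum-+ (e v) (λ x → e x v)) (sum-+ _ _) ⟨
      sum (λ v → sum λ x → e v x + e x v)
        ≤⟨ sum-mono (λ v → sum-mono λ x → pointwise v x) ⟩
      sum (λ v → sum λ x → 𝟙 (h v x))                  ≤⟨ degeneracy h p h-sym low ⟩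
      2 * sum p                                        ≡⟨ cong (2 *_) (sum-*ˡ r _) ⟩
      2 * (r * sum (λ w → 𝟙 (a w ∨ b w)))              ≤⟨ ℕ.*-monoʳ-≤ 2 (ℕ.*-monoʳ-≤ r ∨-bound) ⟩
      2 * (r * (degree u + count b))                   ∎)
      where
      open ≤-Reasoning
      a = adj u
      e : Fin n → Fin n → ℕ
      e v x = 𝟙 (b v) * (𝟙 (a x) * 𝟙 (adj x v))
      expand : sum (λ v → 𝟙 (b v) * codegree u v) ≡ sum (λ v → sum λ x → e v x)
      expand = sum-cong-≗ λ v → sym (sum-*ˡ (𝟙 (b v)) _)
      h : Fin n → Fin n → Bool
      h x y = ((a x ∧ b y) ∨ (b x ∧ a y)) ∧ adj x y
      p : Fin n → ℕ
      p w = r * 𝟙 (a w ∨ b w)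
      ∨-bound : sum (λ w → 𝟙 (a w ∨ b w)) ≤ degree u + count b
      ∨-bound = ≤-trans (sum-mono λ w → case w) (ℕ.≤-reflexive (sum-+ _ _))
        where
        case : ∀ w → 𝟙 (a w ∨ b w) ≤ 𝟙 (a w) + 𝟙 (b w)
        case w with a w
        ... | true  = s≤s z≤n
        ... | false = ≤-refl
      pointwise : ∀ v x → e v x + e x v ≤ 𝟙 (h v x)
      pointwise v x rewrite adj-sym x v with b v in bv | b x in bx
      ... | false | false = z≤n
      ... | true  | false rewrite disjoint v bv | ℕ.+-identityʳ (𝟙 (a x) * 𝟙 (adj v x))
                                | ℕ.+-identityʳ (𝟙 (a x) * 𝟙 (adj v x)) = ℕ.≤-reflexive (sym (𝟙-∧ (a x) (adj v x)))
      ... | false | true  rewrite Bool.∧-identityʳ (a v) | Bool.∨-identityʳ (a v)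
                                | ℕ.+-identityʳ (𝟙 (a v) * 𝟙 (adj v x)) = ℕ.≤-reflexive (sym (𝟙-∧ (a v) (adj v x)))
      ... | true  | true  rewrite disjoint v bv | disjoint x bx = z≤n
      h-sym : ∀ x y → h x y ≡ h y x
      h-sym x y = cong₂ _∧_ (trans (Bool.∨-comm (a x ∧ b y) _) (cong₂ _∨_ (Bool.∧-comm (b x) (a y)) (Bool.∧-comm (a x) (b y)))) (adj-sym x y)
      h-adj : ∀ x y → h x y ≡ true → Adj G x y
      h-adj x y eq = adj⇒Adj (proj₂ (∧-true {(a x ∧ b y) ∨ (b x ∧ a y)} eq))
      h-cases : ∀ {x y} → h x y ≡ true → (a x ≡ true × b y ≡ true) ⊎ (b x ≡ true × a y ≡ true)
      h-cases {x} {y} eq with a x | b x | a y | b y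
      ... | true  | _     | _     | true  = inj₁ (refl , refl)
      ... | _     | true  | true  | false = inj₂ (refl , refl)
      ... | false | true  | true  | true  = inj₂ (refl , refl)
      h-cases {x} {y} () | true  | true  | false | false
      h-cases {x} {y} () | true  | false | _ | false
      h-cases {x} {y} () | false | true  | false | _
      h-cases {x} {y} () | false | false | _ | _
      alternating : ∀ x y → h x y ≡ true → a y ≡ not (a x)
      alternating x y hxy with h-cases {x} {y} hxy
      ... | inj₁ (ax , by) rewrite ax = disjoint y by
      ... | inj₂ (bx , ay) rewrite disjoint x bx = ay
      a∨b : ∀ x y → h x y ≡ true → a x ∨ b x ≡ true × a y ∨ b y ≡ true
      a∨b x y hxy with h-cases {x} {y} hxy
      ... | inj₁ (ax , by) rewrite ax | by = refl , Bool.∨-zeroʳ (a y)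
      ... | inj₂ (bx , ay) rewrite bx | ay = Bool.∨-zeroʳ (a x) , refl
      low : ∀ s v → s v ≡ true → ∃ λ w → s w ≡ true × deg h s w ≤ p w
      low s v sv with low-vertex h p s v sv
      ... | inj₂ found = found
      ... | inj₁ high  = ⊥-elim (from-A start-A)
        where
        R : Fin n → Fin n → Set
        R x y = h x y ≡ true × s y ≡ true
        in-A∪B : ∀ w → s w ≡ true → a w ∨ b w ≡ true
        in-A∪B w sw with nonempty-degree h s w (high w sw) [] z≤n
        ... | x , (hwx , _) , _ = proj₁ (a∨b w x hwx)
        high′ : ∀ w → s w ≡ true → r < deg h s w
        high′ w sw = subst (_< deg h s w) (trans (cong (λ b → r * 𝟙 b) (in-A∪B w sw)) (ℕ.*-identityʳ _)) (high w sw)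
        start-A : ∃ λ w → a w ≡ true × s w ≡ true
        start-A with nonempty-degree h s v (high v sv) [] z≤n
        ... | x , (hvx , sx) , _ with h-cases {v} {x} hvx
        ... | inj₁ (av , _) = v , av , sv
        ... | inj₂ (_ , ax) = x , ax , sx
        from-A : (∃ λ w → a w ≡ true × s w ≡ true) → ⊥
        from-A (w , aw , sw) = no-return path (λ {x} {y} (hxy , _) → h-adj x y hxy) (adj⇒Adj aw)
          (adj⇒Adj (trans (even-path a (λ {x} {y} → alternating x y ∘ proj₁) r path) aw))
          λ u∈ → case trans (sym (cong₂ _∨_ (adj-irrefl u) bu)) (all-A∪B u∈) of λ ()
          where
          in-s : ∀ {y xs m} → Path R w y xs m → s y ≡ true
          in-s q = path-all {P = λ z → s z ≡ true} sw proj₂ q (path-head q)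
          extend : ∀ {y xs m} → Path R w y xs m → m < r + r → ∃ λ z → R y z × z ∉ xs
          -- The list has `suc m ≤ r + r` entries, hence at most `r` at odd positions.
          extend {y} {xs} q m< with nonempty-degree h s y (high′ y (in-s q)) (odds xs)
              (ℕ.*-cancelˡ-≤ 2 (≤-trans (length-odds xs) (≤-trans (ℕ.≤-reflexive (path-length q))
                (≤-trans m< (ℕ.≤-reflexive (cong (r +_) (sym (ℕ.+-identityʳ r))))))))
          ... | z , Ryz , z∉ = z , Ryz , λ z∈ → case colours a (λ {x} {y} → alternating x y ∘ proj₁) q z∈ of λ where
                (inj₁ (z∈o , _)) → z∉ z∈o
                (inj₂ (_ , eq))  → Bool.not-¬ eq (alternating y z (proj₁ Ryz))
          path = proj₂ (proj₂ (grow (r + r) extend (r + r) ≤-refl))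
          all-A∪B : ∀ {z} → z ∈ _ → a z ∨ b z ≡ true
          all-A∪B = path-all {P = λ z → a z ∨ b z ≡ true} (in-A∪B w sw) (λ {_} {y} (_ , sy) → in-A∪B y sy) path

-- Thin and fat pairs

2ab≤a²+b² : ∀ a b → 2 * (a * b) ≤ a * a + b * b
2ab≤a²+b² a b with ℕ.≤-total a b
... | inj₁ a≤b with c , refl ← ℕ.m≤n⇒∃[o]m+o≡n a≤b = ≤-trans (ℕ.m≤m+n _ (c * c)) (ℕ.≤-reflexive (square a c))
  where
  square : ∀ a c → 2 * (a * (a + c)) + c * c ≡ a * a + (a + c) * (a + c)
  square = solve-∀
... | inj₂ b≤a with c , refl ← ℕ.m≤n⇒∃[o]m+o≡n b≤a = ≤-trans (ℕ.m≤m+n _ (c * c)) (ℕ.≤-reflexive (square b c))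
  where
  square : ∀ b c → 2 * ((b + c) * b) + c * c ≡ (b + c) * (b + c) + b * b
  square = solve-∀

Kernel : ℕ → Set
Kernel n = Fin n → Fin n → Bool

distinct : Kernel n
distinct u v = not (u ≟ᵇ v)

module _ {n : ℕ} (G : Graph n) where

  weight : Kernel n → Fin n → Fin n → ℕ
  weight κ u v = 𝟙 (κ u v) * codegree G u v

  thin fat : ℕ → Kernel n
  thin r u v = distinct u v ∧ (codegree G u v ≤ᵇ r)
  fat  r u v = distinct u v ∧ not (codegree G u v ≤ᵇ r)

  codegree≤degree : ∀ u v → codegree G u v ≤ degree G u
  codegree≤degree u v = sum-mono λ x → ≤-trans (ℕ.*-monoʳ-≤ (𝟙 (adj G u x)) (𝟙≤1 _)) (ℕ.≤-reflexive (ℕ.*-identityʳ _))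

  degree≤n : ∀ u → degree G u ≤ n
  degree≤n u = ≤-trans (sum-bound λ v → 𝟙≤1 (adj G u v)) (ℕ.≤-reflexive (ℕ.*-identityʳ n))

  codegree-sym : ∀ u v → codegree G u v ≡ codegree G v u
  codegree-sym u v = sum-cong-≗ λ x → trans (ℕ.*-comm (𝟙 (adj G u x)) _)
    (cong₂ (λ b c → 𝟙 b * 𝟙 c) (adj-sym G x v) (adj-sym G u x))

  -- Walks with two edges, counted by their ends and by their middle vertex.
  codegree-total : sum (λ u → sum λ v → codegree G u v) ≡ sum (λ x → degree G x * degree G x)
  codegree-total = begin
    sum (λ u → sum λ v → sum λ x → 𝟙 (adj G u x) * 𝟙 (adj G x v))
      ≡⟨ sum-cong-≗ (λ u → sum-comm _) ⟩
    sum (λ u → sum λ x → sum λ v → 𝟙 (adj G u x) * 𝟙 (adj G x v))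
      ≡⟨ sum-cong-≗ (λ u → sum-cong-≗ λ x → sum-*ˡ (𝟙 (adj G u x)) (λ v → 𝟙 (adj G x v))) ⟩
    sum (λ u → sum λ x → 𝟙 (adj G u x) * degree G x)
      ≡⟨ sum-comm _ ⟩
    sum (λ x → sum λ u → 𝟙 (adj G u x) * degree G x)
      ≡⟨ sum-cong-≗ (λ x → trans (sum-*ʳ (degree G x) _)
           (cong (_* degree G x) (sum-cong-≗ λ u → cong 𝟙 (adj-sym G u x)))) ⟩
    sum (λ x → degree G x * degree G x) ∎
    where open ≡-Reasoning

opaque
  -- `fatConst` is the fat row sum per unit of degree: `r * suc r` from outside the neighbourhood
  -- and `4 * r` from inside. `rowConst` is the full row sum per vertex of the graph: `5 * r` from
  -- pairs of distinct vertices and 1 from the diagonal.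
  fatConst rowConst : ℕ → ℕ
  fatConst r = r * suc r + 4 * r
  rowConst r = suc (5 * r)

  fatConst-def : ∀ r → fatConst r ≡ r * suc r + 4 * r
  fatConst-def r = refl

  rowConst-def : ∀ r → rowConst r ≡ suc (5 * r)
  rowConst-def r = refl

module _ {n : ℕ} (G : Graph n) (r : ℕ) (free : ¬ Contains G (Cycle (2 * suc r))) where

  private
    d = degree G

    outside-nbrs : Fin n → Kernel n → Fin n → Bool
    outside-nbrs u κ v = (distinct u v ∧ not (adj G u v)) ∧ κ u v

    outside-bound : ∀ u κ → sum (λ v → 𝟙 (outside-nbrs u κ v) * codegree G u v) ≤ r * (d u + count (outside-nbrs u κ))
    outside-bound u κ = codegree-outside G r free u (outside-nbrs u κ)
      (cong (λ b → (not b ∧ not (adj G u u)) ∧ κ u u) (≟ᵇ-refl u))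
      λ v bv → not-true (proj₂ (∧-true {distinct u v} (proj₁ (∧-true bv))))
      where
      not-true : ∀ {b} → not b ≡ true → b ≡ false
      not-true {false} _ = refl

    split-row : ∀ u κ → sum (weight G (λ x y → distinct x y ∧ κ x y) u) ≤
      sum (λ v → 𝟙 (outside-nbrs u κ v) * codegree G u v) + 4 * r * d u
    split-row u κ = ≤-trans (sum-mono pointwise)
      (≤-trans (ℕ.≤-reflexive (sum-+ _ _)) (ℕ.+-monoʳ-≤ _ (codegree-inside G r free u)))
      where
      pointwise : ∀ v → weight G (λ x y → distinct x y ∧ κ x y) u v ≤
        𝟙 (outside-nbrs u κ v) * codegree G u v + 𝟙 (adj G u v) * codegree G u v
      pointwise v with distinct u v | adj G u v | κ u v
      ... | false | _     | _     = z≤n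
      ... | true  | true  | c     = ≤-trans (𝟙*≤ c _) (ℕ.≤-reflexive (sym (ℕ.+-identityʳ _)))
      ... | true  | false | c     = ℕ.m≤m+n _ _

  -- Neighbours of `u` cost `4 * r * d u`. The `t` other vertices cost `r * (d u + t)`, and
  -- `d u + t ≤ n` as the two sets are disjoint. The coefficient `r` of `n` obtained here is the
  -- base of the main term.
  row-sum : ∀ u → sum (weight G distinct u) ≤ r * n + 4 * r * d u
  row-sum u = begin
    sum (weight G distinct u)
      ≡⟨ sum-cong-≗ (λ v → cong (λ b → 𝟙 b * codegree G u v) (sym (Bool.∧-identityʳ (distinct u v)))) ⟩
    sum (weight G (λ x y → distinct x y ∧ true) u)
      ≤⟨ split-row u (λ _ _ → true) ⟩
    sum (λ v → 𝟙 (outside-nbrs u (λ _ _ → true) v) * codegree G u v) + 4 * r * d u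
      ≤⟨ ℕ.+-monoˡ-≤ _ (≤-trans (outside-bound u (λ _ _ → true)) (ℕ.*-monoʳ-≤ r size)) ⟩
    r * n + 4 * r * d u ∎
    where
    open ≤-Reasoning
    size : d u + count (outside-nbrs u (λ _ _ → true)) ≤ n
    size = ≤-trans (ℕ.≤-reflexive (sym (sum-+ _ _)))
      (≤-trans (sum-bound pointwise) (ℕ.≤-reflexive (ℕ.*-identityʳ n)))
      where
      pointwise : ∀ v → 𝟙 (adj G u v) + 𝟙 (outside-nbrs u (λ _ _ → true) v) ≤ 1
      pointwise v with adj G u v | distinct u v
      ... | true  | true  = ≤-refl
      ... | true  | false = ≤-refl
      ... | false | true  = ≤-refl
      ... | false | false = z≤n

  -- Fatness of t outside vertices means at least (r + 1) t edges, whereas C₂ₖ-freeness allows at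
  -- most r (d u + t); hence t ≤ r d u.
  fat-row-sum : ∀ u → sum (weight G (fat G r) u) ≤ fatConst r * d u
  fat-row-sum u = begin
    sum (weight G (fat G r) u)                   ≤⟨ split-row u κ ⟩
    E + 4 * r * d u                              ≤⟨ ℕ.+-monoˡ-≤ _ E≤ ⟩
    r * (d u + t) + 4 * r * d u                  ≤⟨ ℕ.+-monoˡ-≤ _ (ℕ.*-monoʳ-≤ r (ℕ.+-monoʳ-≤ (d u) t≤)) ⟩
    r * (d u + r * d u) + 4 * r * d u            ≡⟨ trans (regroup r (d u)) (cong (_* d u) (sym (fatConst-def r))) ⟩
    fatConst r * d u                               ∎
    where
    open ≤-Reasoning
    κ : Kernel n
    κ x y = not (codegree G x y ≤ᵇ r)
    t = count (outside-nbrs u κ)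
    E = sum (λ v → 𝟙 (outside-nbrs u κ v) * codegree G u v)
    E≤ : E ≤ r * (d u + t)
    E≤ = outside-bound u κ
    regroup : ∀ r d → r * (d + r * d) + 4 * r * d ≡ (r * suc r + 4 * r) * d
    regroup = solve-∀
    fat⇒ : ∀ v → κ u v ≡ true → suc r ≤ codegree G u v
    fat⇒ v κuv = ℕ.≰⇒> λ c≤r → case trans (sym κuv) (cong not (T⇒true (ℕ.≤⇒≤ᵇ c≤r))) of λ ()
    many : t * suc r ≤ E
    many = ≤-trans (ℕ.≤-reflexive (sym (sum-*ʳ (suc r) _))) (sum-mono pointwise)
      where
      pointwise : ∀ v → 𝟙 (outside-nbrs u κ v) * suc r ≤ 𝟙 (outside-nbrs u κ v) * codegree G u v
      pointwise v with outside-nbrs u κ v in b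
      ... | false = z≤n
      ... | true  = ℕ.*-monoʳ-≤ 1 (fat⇒ v (proj₂ (∧-true {distinct u v ∧ not (adj G u v)} b)))
    t≤ : t ≤ r * d u
    t≤ = ℕ.+-cancelˡ-≤ (r * t) t (r * d u) (begin
      r * t + t           ≡⟨ ℕ.+-comm (r * t) t ⟩
      t + r * t           ≡⟨ cong (t +_) (ℕ.*-comm r t) ⟩
      t + t * r           ≡⟨ ℕ.*-suc t r ⟨
      t * suc r           ≤⟨ ≤-trans many E≤ ⟩
      r * (d u + t)       ≡⟨ ℕ.*-distribˡ-+ r (d u) t ⟩
      r * d u + r * t     ≡⟨ ℕ.+-comm (r * d u) (r * t) ⟩
      r * t + r * d u     ∎)

  codegree-row : ∀ u → sum (codegree G u) ≤ rowConst r * n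
  codegree-row u = begin
    sum (codegree G u)                            ≤⟨ sum-mono pointwise ⟩
    sum (λ v → weight G distinct u v + 𝟙 (u ≟ᵇ v) * d u)
      ≡⟨ trans (sum-+ _ _) (cong (sum (weight G distinct u) +_) (sum-δ u (λ _ → d u))) ⟩
    sum (weight G distinct u) + d u               ≤⟨ ℕ.+-monoˡ-≤ (d u) (row-sum u) ⟩
    (r * n + 4 * r * d u) + d u                   ≤⟨ ℕ.+-mono-≤ (ℕ.+-monoʳ-≤ _ (ℕ.*-monoʳ-≤ (4 * r) (degree≤n G u))) (degree≤n G u) ⟩
    (r * n + 4 * r * n) + n                       ≡⟨ trans (regroup r n) (cong (_* n) (sym (rowConst-def r))) ⟩
    rowConst r * n                                  ∎
    where
    open ≤-Reasoning
    regroup : ∀ r n → (r * n + 4 * r * n) + n ≡ suc (5 * r) * n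
    regroup = solve-∀
    pointwise : ∀ v → codegree G u v ≤ weight G distinct u v + 𝟙 (u ≟ᵇ v) * d u
    pointwise v with u ≟ᵇ v
    ... | true  = ≤-trans (codegree≤degree G u v) (ℕ.≤-reflexive (sym (ℕ.+-identityʳ _)))
    ... | false = ≤-trans (ℕ.≤-reflexive (sym (ℕ.+-identityʳ _))) (ℕ.m≤m+n _ _)

  weight-row : ∀ κ u → sum (weight G κ u) ≤ rowConst r * n
  weight-row κ u = ≤-trans (sum-mono λ v → 𝟙*≤ (κ u v) _) (codegree-row u)

  degree-squares : sum (λ u → d u * d u) ≤ rowConst r * (n * n)
  degree-squares = begin
    sum (λ u → d u * d u)                     ≡⟨ codegree-total G ⟨
    sum (λ u → sum (codegree G u))            ≤⟨ sum-bound codegree-row ⟩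
    n * (rowConst r * n)                        ≡⟨ regroup (rowConst r) n ⟩
    rowConst r * (n * n)                        ∎
    where
    open ≤-Reasoning
    regroup : ∀ c n → n * (c * n) ≡ c * (n * n)
    regroup = solve-∀

  -- Cauchy-Schwarz in the form `2 * (n * (q * d u)) ≤ n * n + q * d u * (q * d
  -- u)`. Summed over `u`, each term on the right is at most `n * (n *
  -- n)`, the second one by `degree-squares` and the assumption on `n`.
  degree-sum : ∀ q → .{{NonZero n}} → q * q * rowConst r ≤ n → q * sum d ≤ n * n
  degree-sum q large = ℕ.*-cancelˡ-≤ 2 (ℕ.*-cancelˡ-≤ n (begin
    n * (2 * (q * sum d))                     ≡⟨ regroup₁ n q (sum d) ⟩
    2 * n * q * sum d                         ≡⟨ sum-*ˡ (2 * n * q) d ⟨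
    sum (λ u → 2 * n * q * d u)               ≤⟨ sum-mono (λ u → ≤-trans (ℕ.≤-reflexive (regroup₂ n q (d u))) (2ab≤a²+b² n (q * d u))) ⟩
    sum (λ u → n * n + q * d u * (q * d u))   ≡⟨ trans (sum-+ _ _) (cong₂ _+_ (sum-const n (n * n)) (trans (sum-cong-≗ λ u → regroup₃ q (d u)) (sum-*ˡ (q * q) _))) ⟩
    n * (n * n) + q * q * sum (λ u → d u * d u)
                                              ≤⟨ ℕ.+-monoʳ-≤ _ (ℕ.*-monoʳ-≤ (q * q) degree-squares) ⟩
    n * (n * n) + q * q * (rowConst r * (n * n)) ≡⟨ cong (n * (n * n) +_) (ℕ.*-assoc (q * q) (rowConst r) (n * n)) ⟨
    n * (n * n) + q * q * rowConst r * (n * n)  ≤⟨ ℕ.+-monoʳ-≤ _ (ℕ.*-monoˡ-≤ (n * n) large) ⟩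
    n * (n * n) + n * (n * n)                 ≡⟨ regroup₄ n ⟩
    n * (2 * (n * n))                         ∎))
    where
    open ≤-Reasoning
    regroup₁ : ∀ n q s → n * (2 * (q * s)) ≡ 2 * n * q * s
    regroup₁ = solve-∀
    regroup₂ : ∀ n q d → 2 * n * q * d ≡ 2 * (n * (q * d))
    regroup₂ = solve-∀
    regroup₃ : ∀ q d → q * d * (q * d) ≡ q * q * (d * d)
    regroup₃ = solve-∀
    regroup₄ : ∀ n → n * (n * n) + n * (n * n) ≡ n * (2 * (n * n))
    regroup₄ = solve-∀

  big : ℕ → Fin n → Bool
  big q u = n ≤ᵇ q * d u

  -- Markov's inequality for the squared degrees. That the bound is free of `n` is the point.
  big-count : ∀ q → .{{NonZero n}} → count (big q) ≤ q * q * rowConst r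
  big-count q = ℕ.*-cancelʳ-≤ _ _ (n * n) {{ℕ.m*n≢0 n n}} (begin
    count (big q) * (n * n)                   ≡⟨ sum-*ʳ (n * n) _ ⟨
    sum (λ u → 𝟙 (big q u) * (n * n))         ≤⟨ sum-mono pointwise ⟩
    sum (λ u → q * q * (d u * d u))           ≡⟨ sum-*ˡ (q * q) _ ⟩
    q * q * sum (λ u → d u * d u)             ≤⟨ ℕ.*-monoʳ-≤ (q * q) degree-squares ⟩
    q * q * (rowConst r * (n * n))              ≡⟨ ℕ.*-assoc (q * q) (rowConst r) (n * n) ⟨
    q * q * rowConst r * (n * n)                ∎)
    where
    open ≤-Reasoning
    regroup : ∀ q d → q * d * (q * d) ≡ q * q * (d * d)
    regroup = solve-∀
    pointwise : ∀ u → 𝟙 (big q u) * (n * n) ≤ q * q * (d u * d u)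
    pointwise u with big q u in b
    ... | false = z≤n
    ... | true  = ≤-trans (ℕ.≤-reflexive (ℕ.+-identityʳ _)) (≤-trans (ℕ.*-mono-≤ n≤ n≤) (ℕ.≤-reflexive (regroup q (d u))))
      where
      n≤ : n ≤ q * d u
      n≤ = ℕ.≤ᵇ⇒≤ n (q * d u) (subst T (sym b) _)

-- Closed walks weighted by codegrees

^-distribʳ-* : ∀ s a b → (a * b) ^ s ≡ a ^ s * b ^ s
^-distribʳ-* zero    a b = refl
^-distribʳ-* (suc s) a b = trans (cong (a * b *_) (^-distribʳ-* s a b)) (regroup a b (a ^ s) (b ^ s))
  where
  regroup : ∀ a b c d → a * b * (c * d) ≡ a * c * (b * d)
  regroup = solve-∀

opaque
  sumV : ∀ m → (Vec (Fin n) m → ℕ) → ℕ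
  sumV zero    w = w []
  sumV (suc m) w = sum λ x → sumV m (λ xs → w (x ∷ xs))

  sumV-cong : ∀ m {w w′ : Vec (Fin n) m → ℕ} → w ≗ w′ → sumV m w ≡ sumV m w′
  sumV-cong zero    w≗w′ = w≗w′ []
  sumV-cong (suc m) w≗w′ = sum-cong-≗ λ x → sumV-cong m λ xs → w≗w′ (x ∷ xs)

  sumV-+ : ∀ m (w w′ : Vec (Fin n) m → ℕ) → sumV m (λ v → w v + w′ v) ≡ sumV m w + sumV m w′
  sumV-+ zero    w w′ = refl
  sumV-+ (suc m) w w′ = trans (sum-cong-≗ λ x → sumV-+ m _ _) (sum-+ _ _)

  sumV-*ˡ : ∀ m c (w : Vec (Fin n) m → ℕ) → sumV m (λ v → c * w v) ≡ c * sumV m w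
  sumV-*ˡ zero    c w = refl
  sumV-*ˡ (suc m) c w = trans (sum-cong-≗ λ x → sumV-*ˡ m c _) (sum-*ˡ c _)

_≡ᵛ_ : Vec (Fin n) m → Vec (Fin n) m → Bool
[]       ≡ᵛ []       = true
(x ∷ xs) ≡ᵛ (y ∷ ys) = (x ≟ᵇ y) ∧ (xs ≡ᵛ ys)

≡ᵛ⇒≡ : ∀ (xs ys : Vec (Fin n) m) → (xs ≡ᵛ ys) ≡ true → xs ≡ ys
≡ᵛ⇒≡ []       []       _  = refl
≡ᵛ⇒≡ (x ∷ xs) (y ∷ ys) eq with x Fin.≟ y
... | yes refl = cong (x ∷_) (≡ᵛ⇒≡ xs ys eq)

opaque
  unfolding sumV

  sumV-δ : ∀ m v (w : Vec (Fin n) m → ℕ) → sumV m (λ u → 𝟙 (v ≡ᵛ u) * w u) ≡ w v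
  sumV-δ zero    []       w = ℕ.+-identityʳ (w [])
  sumV-δ (suc m) (x ∷ xs) w = begin
    sum (λ y → sumV m λ ys → 𝟙 ((x ≟ᵇ y) ∧ (xs ≡ᵛ ys)) * w (y ∷ ys))
      ≡⟨ sum-cong-≗ (λ y → trans (sumV-cong m λ ys → trans (cong (_* w (y ∷ ys)) (𝟙-∧ (x ≟ᵇ y) (xs ≡ᵛ ys))) (ℕ.*-assoc (𝟙 (x ≟ᵇ y)) _ _)) (sumV-*ˡ m (𝟙 (x ≟ᵇ y)) _)) ⟩
    sum (λ y → 𝟙 (x ≟ᵇ y) * sumV m λ ys → 𝟙 (xs ≡ᵛ ys) * w (y ∷ ys))
      ≡⟨ sum-δ x (λ y → sumV m λ ys → 𝟙 (xs ≡ᵛ ys) * w (y ∷ ys)) ⟩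
    sumV m (λ ys → 𝟙 (xs ≡ᵛ ys) * w (x ∷ ys))
      ≡⟨ sumV-δ m xs (λ ys → w (x ∷ ys)) ⟩
    w (x ∷ xs) ∎
    where open ≡-Reasoning

unique-sum≤sumV : ∀ m (w : Vec (Fin n) m → ℕ) vs → Unique vs → ListAction.sum (List.map w vs) ≤ sumV m w
unique-sum≤sumV m w []       _         = z≤n
unique-sum≤sumV m w (v ∷ vs) (v∉ ∷ un) = begin
  w v + ListAction.sum (List.map w vs)          ≡⟨ cong (w v +_) (map-w vs v∉) ⟩
  w v + ListAction.sum (List.map w′ vs)         ≤⟨ ℕ.+-monoʳ-≤ (w v) (unique-sum≤sumV m w′ vs un) ⟩
  w v + sumV m w′                         ≡⟨ cong (_+ sumV m w′) (sumV-δ m v w) ⟨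
  sumV m (λ u → 𝟙 (v ≡ᵛ u) * w u) + sumV m w′ ≡⟨ sumV-+ m (λ u → 𝟙 (v ≡ᵛ u) * w u) w′ ⟨
  sumV m (λ u → 𝟙 (v ≡ᵛ u) * w u + w′ u)  ≡⟨ sumV-cong m split ⟩
  sumV m w                                ∎
  where
  open ≤-Reasoning
  w′ : Vec (Fin _) m → ℕ
  w′ u = 𝟙 (not (v ≡ᵛ u)) * w u
  split : ∀ u → 𝟙 (v ≡ᵛ u) * w u + w′ u ≡ w u
  split u with v ≡ᵛ u
  ... | true  = trans (ℕ.+-identityʳ _) (ℕ.+-identityʳ _)
  ... | false = ℕ.+-identityʳ _
  map-w : ∀ vs → All (v ≢_) vs → ListAction.sum (List.map w vs) ≡ ListAction.sum (List.map w′ vs)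
  map-w []       []         = refl
  map-w (u ∷ us) (v≢u ∷ v∉) = cong₂ _+_ same (map-w us v∉)
    where
    same : w u ≡ w′ u
    same with v ≡ᵛ u in eq
    ... | true  = contradiction (≡ᵛ⇒≡ v u eq) v≢u
    ... | false = sym (ℕ.+-identityʳ _)

allBig : (Fin n → Bool) → ∀ m → Vec (Fin n) m → ℕ
allBig b zero    []       = 1
allBig b (suc m) (x ∷ xs) = 𝟙 (b x) * allBig b m xs

opaque
  unfolding sumV

  sumV-allBig : ∀ (b : Fin n → Bool) m → sumV m (allBig b m) ≡ count b ^ m
  sumV-allBig b zero    = refl
  sumV-allBig b (suc m) = trans (sum-cong-≗ λ x → trans (sumV-*ˡ m (𝟙 (b x)) _) (cong (𝟙 (b x) *_) (sumV-allBig b m)))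
    (sum-*ʳ (count b ^ m) _)

module _ {n : ℕ} (G : Graph n) where

  link : Kernel n → Fin n → Fin n → Fin n → ℕ
  link κ x b y = 𝟙 (κ x y) * (𝟙 (adj G x b) * 𝟙 (adj G b y))

  sum-link : ∀ κ x y → sum (λ b → link κ x b y) ≡ weight G κ x y
  sum-link κ x y = sum-*ˡ (𝟙 (κ x y)) _

  -- chain κs χ x z (b₀ ∷ y₁ ∷ b₁ ∷ ⋯ ∷ yₛ ∷ bₛ ∷ []) indicates that x b₀ y₁ b₁ ⋯ yₛ bₛ z is a walk
  -- whose pairs (x , y₁), (y₁ , y₂), … lie in κs and whose last pair (yₛ , z) lies in χ.
  chain : ∀ {s} → Vec (Kernel n) s → Kernel n → Fin n → Fin n → Vec (Fin n) (suc (s * 2)) → ℕ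
  chain []       χ x z (b ∷ [])    = link χ x b z
  chain (κ ∷ κs) χ x z (b ∷ y ∷ v) = link κ x b y * chain κs χ y z v

  walks : ∀ {s} → Vec (Kernel n) s → Kernel n → Fin n → Fin n → ℕ
  walks []       χ x z = weight G χ x z
  walks (κ ∷ κs) χ x z = sum λ y → weight G κ x y * walks κs χ y z

  opaque
    unfolding sumV

    -- Summing out the vertices `b` turns each `link` into the codegree of its ends; only the walk
    -- over one colour class remains.
    sumV-chain : ∀ {s} (κs : Vec (Kernel n) s) χ x z → sumV (suc (s * 2)) (chain κs χ x z) ≡ walks κs χ x z
    sumV-chain []       χ x z = sum-link χ x z
    sumV-chain {suc s} (κ ∷ κs) χ x z = begin
      sum (λ b → sum λ y → sumV (suc (s * 2)) λ v → link κ x b y * chain κs χ y z v)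
        ≡⟨ sum-cong-≗ (λ b → sum-cong-≗ λ y → trans (sumV-*ˡ (suc (s * 2)) (link κ x b y) (chain κs χ y z))
             (cong (link κ x b y *_) (sumV-chain κs χ y z))) ⟩
      sum (λ b → sum λ y → link κ x b y * walks κs χ y z)
        ≡⟨ sum-comm _ ⟩
      sum (λ y → sum λ b → link κ x b y * walks κs χ y z)
        ≡⟨ sum-cong-≗ (λ y → trans (sum-*ʳ (walks κs χ y z) _) (cong (_* walks κs χ y z) (sum-link κ x y))) ⟩
      sum (λ y → weight G κ x y * walks κs χ y z) ∎
      where open ≡-Reasoning

  closedChain : ∀ {s} → Vec (Kernel n) s → Kernel n → Vec (Fin n) (suc s * 2) → ℕ
  closedChain κs χ (x ∷ v) = chain κs χ x x v

  closedWalks : ∀ {s} → Vec (Kernel n) s → Kernel n → ℕ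
  closedWalks κs χ = sum λ x → walks κs χ x x

  opaque
    unfolding sumV

    sumV-closedChain : ∀ {s} (κs : Vec (Kernel n) s) χ → sumV (suc s * 2) (closedChain κs χ) ≡ closedWalks κs χ
    sumV-closedChain κs χ = sum-cong-≗ λ x → sumV-chain κs χ x x

  openWalks : ℕ → Kernel n → Fin n → ℕ
  openWalks zero    κ x = 1
  openWalks (suc s) κ x = sum λ y → weight G κ x y * openWalks s κ y

  -- The fixed end `z` enters only through the closing weight. Once this is bounded by `D`, the walk
  -- is free and its steps can be summed row by row.
  walks≤openWalks : ∀ D κ χ z → (∀ x → weight G χ x z ≤ D) → ∀ s x →
                    walks (Vec.replicate s κ) χ x z ≤ D * openWalks s κ x
  walks≤openWalks D κ χ z χ≤D zero    x = ≤-trans (χ≤D x) (ℕ.≤-reflexive (sym (ℕ.*-identityʳ D)))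
  walks≤openWalks D κ χ z χ≤D (suc s) x = begin
    sum (λ y → weight G κ x y * walks (Vec.replicate s κ) χ y z)
      ≤⟨ sum-mono (λ y → ≤-trans (ℕ.*-monoʳ-≤ (weight G κ x y) (walks≤openWalks D κ χ z χ≤D s y))
           (ℕ.≤-reflexive (swap (weight G κ x y) D (openWalks s κ y)))) ⟩
    sum (λ y → D * (weight G κ x y * openWalks s κ y))
      ≡⟨ sum-*ˡ D _ ⟩
    D * openWalks (suc s) κ x ∎
    where
    open ≤-Reasoning
    swap : ∀ a b c → a * (b * c) ≡ b * (a * c)
    swap = solve-∀

  openWalks-mono : ∀ {κ κ′} → (∀ x y → weight G κ x y ≤ weight G κ′ x y) → ∀ s x → openWalks s κ x ≤ openWalks s κ′ x
  openWalks-mono κ≤κ′ zero    x = ≤-refl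
  openWalks-mono κ≤κ′ (suc s) x = sum-mono λ y → ℕ.*-mono-≤ (κ≤κ′ x y) (openWalks-mono κ≤κ′ s y)

  weight-thin : ∀ r x y → weight G (thin G r) x y ≤ r
  weight-thin r x y with distinct x y | codegree G x y ≤ᵇ r in eq
  ... | false | _     = z≤n
  ... | true  | false = z≤n
  ... | true  | true  = ≤-trans (ℕ.≤-reflexive (ℕ.+-identityʳ _)) (ℕ.≤ᵇ⇒≤ _ r (subst T (sym eq) _))

opaque
  -- The error coefficient of `openWalks-total`: each further step multiplies the old error by `r`,
  -- and the part `4 * r * d y` of the row sum adds `4 * r * rowConst r ^ s`.
  errConst : ℕ → ℕ → ℕ
  errConst r zero    = 0
  errConst r (suc s) = r * errConst r s + 4 * r * rowConst r ^ s

  errConst-zero : ∀ r → errConst r 0 ≡ 0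
  errConst-zero r = refl

  errConst-suc : ∀ r s → errConst r (suc s) ≡ r * errConst r s + 4 * r * rowConst r ^ s
  errConst-suc r s = refl

module _ {n : ℕ} (G : Graph n) (r : ℕ) (free : ¬ Contains G (Cycle (2 * suc r))) where

  private
    d = degree G
    K = rowConst r
    C = fatConst r

  openWalks-bound : ∀ κ s x → openWalks G s κ x ≤ (K * n) ^ s
  openWalks-bound κ zero    x = ≤-refl
  openWalks-bound κ (suc s) x = begin
    sum (λ y → weight G κ x y * openWalks G s κ y)
      ≤⟨ sum-mono (λ y → ℕ.*-monoʳ-≤ (weight G κ x y) (openWalks-bound κ s y)) ⟩
    sum (λ y → weight G κ x y * (K * n) ^ s)   ≡⟨ sum-*ʳ ((K * n) ^ s) _ ⟩
    sum (weight G κ x) * (K * n) ^ s           ≤⟨ ℕ.*-monoˡ-≤ _ (weight-row G r free κ x) ⟩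
    (K * n) ^ suc s                            ∎
    where open ≤-Reasoning

  -- The weights being symmetric, the first vertex can be summed out before the rest of the walk,
  -- which puts `row-sum` at `y`. In the part with `d y` the rest of the walk may be bounded
  -- crudely, since the sum of the degrees is small already.
  openWalks-step : ∀ s → sum (openWalks G (suc s) distinct) ≤
    r * n * sum (openWalks G s distinct) + 4 * r * (K * n) ^ s * sum d
  openWalks-step s = begin
    sum (λ x → sum λ y → weight G distinct x y * W y)  ≡⟨ sum-comm _ ⟩
    sum (λ y → sum λ x → weight G distinct x y * W y)
      ≡⟨ sum-cong-≗ (λ y → trans (sum-*ʳ (W y) _) (cong (_* W y) (sum-cong-≗ λ x → w-sym x y))) ⟩
    sum (λ y → sum (weight G distinct y) * W y)
      ≤⟨ sum-mono (λ y → ≤-trans (ℕ.*-monoˡ-≤ (W y) (row-sum G r free y)) (pointwise y)) ⟩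
    sum (λ y → r * n * W y + 4 * r * (K * n) ^ s * d y)
      ≡⟨ trans (sum-+ _ _) (cong₂ _+_ (sum-*ˡ (r * n) W) (sum-*ˡ (4 * r * (K * n) ^ s) d)) ⟩
    r * n * sum W + 4 * r * (K * n) ^ s * sum d ∎
    where
    open ≤-Reasoning
    W = openWalks G s distinct
    distinct-sym : ∀ (x y : Fin n) → distinct x y ≡ distinct y x
    distinct-sym x y with x Fin.≟ y
    ... | yes refl = sym (cong not (≟ᵇ-refl x))
    ... | no x≢y   = sym (cong not (≟ᵇ-false (x≢y ∘ sym)))
    w-sym : ∀ x y → weight G distinct x y ≡ weight G distinct y x
    w-sym x y = cong₂ (λ b c → 𝟙 b * c) (distinct-sym x y) (codegree-sym G x y)
    pointwise : ∀ y → (r * n + 4 * r * d y) * W y ≤ r * n * W y + 4 * r * (K * n) ^ s * d y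
    pointwise y = ≤-trans (ℕ.≤-reflexive (ℕ.*-distribʳ-+ (W y) (r * n) _)) (ℕ.+-monoʳ-≤ (r * n * W y)
      (≤-trans (ℕ.*-monoʳ-≤ (4 * r * d y) (openWalks-bound distinct s y)) (ℕ.≤-reflexive (regroup r (d y) _))))
      where
      regroup : ∀ r d w → 4 * r * d * w ≡ 4 * r * w * d
      regroup = solve-∀

  module _ (q : ℕ) .{{_ : NonZero n}} (large : q * q * K ≤ n) where

    -- The factor `q` clears the denominator of the bound `n * n / q` for the sum of the degrees, so
    -- that the error coefficient does not involve `q`.
    openWalks-total : ∀ s → q * sum (openWalks G s distinct) ≤ (q * r ^ s + errConst r s) * n ^ suc s
    openWalks-total zero    = ℕ.≤-reflexive (trans (cong (q *_) (sum-const n 1)) (trans (regroup q n) (cong (λ e → (q * 1 + e) * (n * 1)) (sym (errConst-zero r)))))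
      where
      regroup : ∀ q n → q * (n * 1) ≡ (q * 1 + 0) * (n * 1)
      regroup = solve-∀
    openWalks-total (suc s) = begin
      q * sum (openWalks G (suc s) distinct)
        ≤⟨ ℕ.*-monoʳ-≤ q (openWalks-step s) ⟩
      q * (r * n * X + 4 * r * (K * n) ^ s * sum d)
        ≡⟨ regroup₁ q r n X ((K * n) ^ s) (sum d) ⟩
      r * n * (q * X) + 4 * r * (K * n) ^ s * (q * sum d)
        ≤⟨ ℕ.+-mono-≤ (ℕ.*-monoʳ-≤ (r * n) (openWalks-total s)) (ℕ.*-monoʳ-≤ (4 * r * (K * n) ^ s) (degree-sum G r free q large)) ⟩
      r * n * ((q * r ^ s + errConst r s) * n ^ suc s) + 4 * r * (K * n) ^ s * (n * n)
        ≡⟨ cong (λ p → r * n * ((q * r ^ s + errConst r s) * n ^ suc s) + 4 * r * p * (n * n)) (^-distribʳ-* s K n) ⟩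
      r * n * ((q * r ^ s + errConst r s) * n ^ suc s) + 4 * r * (K ^ s * n ^ s) * (n * n)
        ≡⟨ trans (regroup₂ q r n (r ^ s) (errConst r s) (K ^ s) (n ^ s)) (cong (λ e → (q * r ^ suc s + e) * n ^ suc (suc s)) (sym (errConst-suc r s))) ⟩
      (q * r ^ suc s + errConst r (suc s)) * n ^ suc (suc s) ∎
      where
      open ≤-Reasoning
      X = sum (openWalks G s distinct)
      regroup₁ : ∀ q r n x p d → q * (r * n * x + 4 * r * p * d) ≡ r * n * (q * x) + 4 * r * p * (q * d)
      regroup₁ = solve-∀
      regroup₂ : ∀ q r n rs e ks ns → r * n * ((q * rs + e) * (n * ns)) + 4 * r * (ks * ns) * (n * n) ≡
        (q * (r * rs) + (r * e + 4 * r * ks)) * (n * (n * ns))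
      regroup₂ = solve-∀

    -- The closing pair weighs at most `r`. The other `s` pairs can be relaxed from thin to
    -- distinct, because `row-sum` has the sharp constant for all distinct pairs.
    closed-thin : ∀ s → q * closedWalks G (Vec.replicate s (thin G r)) (thin G r) ≤
      (q * r ^ suc s + r * errConst r s) * n ^ suc s
    closed-thin s = begin
      q * closedWalks G (Vec.replicate s (thin G r)) (thin G r)
        ≤⟨ ℕ.*-monoʳ-≤ q (sum-mono λ x → ≤-trans (walks≤openWalks G r _ _ x (λ y → weight-thin G r y x) s x)
             (ℕ.*-monoʳ-≤ r (openWalks-mono G thin≤distinct s x))) ⟩
      q * sum (λ x → r * openWalks G s distinct x)      ≡⟨ cong (q *_) (sum-*ˡ r _) ⟩
      q * (r * sum (openWalks G s distinct))            ≡⟨ swap q r _ ⟩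
      r * (q * sum (openWalks G s distinct))            ≤⟨ ℕ.*-monoʳ-≤ r (openWalks-total s) ⟩
      r * ((q * r ^ s + errConst r s) * n ^ suc s)        ≡⟨ regroup r q (r ^ s) (errConst r s) (n ^ suc s) ⟩
      (q * r ^ suc s + r * errConst r s) * n ^ suc s      ∎
      where
      open ≤-Reasoning
      thin≤distinct : ∀ x y → weight G (thin G r) x y ≤ weight G distinct x y
      thin≤distinct x y with distinct x y
      ... | true  = ≤-trans (𝟙*≤ (codegree G x y ≤ᵇ r) _) (ℕ.≤-reflexive (sym (ℕ.+-identityʳ _)))
      ... | false = z≤n
      swap : ∀ a b c → a * (b * c) ≡ b * (a * c)
      swap = solve-∀
      regroup : ∀ r q rs e p → r * ((q * rs + e) * p) ≡ (q * (r * rs) + r * e) * p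
      regroup = solve-∀

    -- Closing by a thin pair costs only `r`, the fat row at `x` gives `C * d x`, and each of the
    -- other `s` steps gives `K * n`; `degree-sum` then gains the factor `q`.
    closed-fat-thin : ∀ s → q * closedWalks G (fat G r ∷ Vec.replicate s distinct) (thin G r) ≤
      C * r * K ^ s * n ^ suc (suc s)
    closed-fat-thin s = begin
      q * closedWalks G (fat G r ∷ Vec.replicate s distinct) (thin G r)
        ≤⟨ ℕ.*-monoʳ-≤ q (sum-mono λ x → row x) ⟩
      q * sum (λ x → C * r * (K * n) ^ s * d x)   ≡⟨ cong (q *_) (sum-*ˡ (C * r * (K * n) ^ s) d) ⟩
      q * (C * r * (K * n) ^ s * sum d)           ≡⟨ swap q (C * r * (K * n) ^ s) (sum d) ⟩
      C * r * (K * n) ^ s * (q * sum d)           ≤⟨ ℕ.*-monoʳ-≤ (C * r * (K * n) ^ s) (degree-sum G r free q large) ⟩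
      C * r * (K * n) ^ s * (n * n)               ≡⟨ cong (λ p → C * r * p * (n * n)) (^-distribʳ-* s K n) ⟩
      C * r * (K ^ s * n ^ s) * (n * n)           ≡⟨ regroup (C * r) (K ^ s) (n ^ s) n ⟩
      C * r * K ^ s * n ^ suc (suc s)             ∎
      where
      open ≤-Reasoning
      swap : ∀ a b c → a * (b * c) ≡ b * (a * c)
      swap = solve-∀
      regroup : ∀ c k p n → c * (k * p) * (n * n) ≡ c * k * (n * (n * p))
      regroup = solve-∀
      regroup′ : ∀ c d r p → c * d * (r * p) ≡ c * r * p * d
      regroup′ = solve-∀
      row : ∀ x → sum (λ y → weight G (fat G r) x y * walks G (Vec.replicate s distinct) (thin G r) y x) ≤
        C * r * (K * n) ^ s * d x
      row x = begin
        sum (λ y → weight G (fat G r) x y * walks G (Vec.replicate s distinct) (thin G r) y x)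
          ≤⟨ sum-mono (λ y → ℕ.*-monoʳ-≤ (weight G (fat G r) x y) (≤-trans
               (walks≤openWalks G r distinct _ x (λ y → weight-thin G r y x) s y)
               (ℕ.*-monoʳ-≤ r (openWalks-bound distinct s y)))) ⟩
        sum (λ y → weight G (fat G r) x y * (r * (K * n) ^ s))  ≡⟨ sum-*ʳ (r * (K * n) ^ s) _ ⟩
        sum (weight G (fat G r) x) * (r * (K * n) ^ s)          ≤⟨ ℕ.*-monoˡ-≤ _ (fat-row-sum G r free x) ⟩
        C * d x * (r * (K * n) ^ s)                             ≡⟨ regroup′ C (d x) r _ ⟩
        C * r * (K * n) ^ s * d x                               ∎

    fatSmall : Kernel n
    fatSmall x y = fat G r x y ∧ not (big G r free q y)

    -- The closing codegree is at most d x, which pairs with the fat row sum C d x of the first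
    -- vertex; the small second vertex y contributes C d y ≤ C n / q.
    closed-fat-fat : ∀ s → q * closedWalks G (fatSmall ∷ fat G r ∷ Vec.replicate s distinct) distinct ≤
      C * C * K ^ suc s * n ^ suc (suc (suc s))
    closed-fat-fat s = begin
      q * closedWalks G (fatSmall ∷ fat G r ∷ Vec.replicate s distinct) distinct
        ≡⟨ sum-*ˡ q _ ⟨
      sum (λ x → q * walks G (fatSmall ∷ fat G r ∷ Vec.replicate s distinct) distinct x x)
        ≤⟨ sum-mono row ⟩
      sum (λ x → C * C * n * P * (d x * d x))     ≡⟨ sum-*ˡ (C * C * n * P) _ ⟩
      C * C * n * P * sum (λ x → d x * d x)       ≤⟨ ℕ.*-monoʳ-≤ (C * C * n * P) (degree-squares G r free) ⟩
      C * C * n * P * (K * (n * n))               ≡⟨ cong (λ p → C * C * n * p * (K * (n * n))) (^-distribʳ-* s K n) ⟩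
      C * C * n * (K ^ s * n ^ s) * (K * (n * n)) ≡⟨ regroup (C * C) K n (K ^ s) (n ^ s) ⟩
      C * C * K ^ suc s * n ^ suc (suc (suc s))   ∎
      where
      open ≤-Reasoning
      P = (K * n) ^ s
      regroup : ∀ c k n ks p → c * n * (ks * p) * (k * (n * n)) ≡ c * (k * ks) * (n * (n * (n * p)))
      regroup = solve-∀
      second : ∀ x y → sum (λ z → weight G (fat G r) y z * walks G (Vec.replicate s distinct) distinct z x) ≤
        C * d y * (d x * P)
      second x y = begin
        sum (λ z → weight G (fat G r) y z * walks G (Vec.replicate s distinct) distinct z x)
          ≤⟨ sum-mono (λ z → ℕ.*-monoʳ-≤ (weight G (fat G r) y z) (≤-trans
               (walks≤openWalks G (d x) distinct _ x closing s z)
               (ℕ.*-monoʳ-≤ (d x) (openWalks-bound distinct s z)))) ⟩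
        sum (λ z → weight G (fat G r) y z * (d x * P))  ≡⟨ sum-*ʳ (d x * P) _ ⟩
        sum (weight G (fat G r) y) * (d x * P)          ≤⟨ ℕ.*-monoˡ-≤ _ (fat-row-sum G r free y) ⟩
        C * d y * (d x * P)                             ∎
        where
        closing : ∀ z → weight G distinct z x ≤ d x
        closing z = ≤-trans (𝟙*≤ (distinct z x) _) (≤-trans (ℕ.≤-reflexive (codegree-sym G z x)) (codegree≤degree G x z))
      small : ∀ x y → q * (weight G fatSmall x y * d y) ≤ weight G (fat G r) x y * n
      small x y with fat G r x y | big G r free q y in eq
      ... | false | _     = ℕ.≤-reflexive (ℕ.*-zeroʳ q)
      ... | true  | true  = ≤-trans (ℕ.≤-reflexive (ℕ.*-zeroʳ q)) z≤n
      ... | true  | false = ≤-trans (ℕ.≤-reflexive (swap q (codegree G x y + 0) (d y)))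
              (ℕ.*-monoʳ-≤ (codegree G x y + 0) (ℕ.<⇒≤ (ℕ.≰⇒> λ n≤ → case trans (sym (T⇒true (ℕ.≤⇒≤ᵇ n≤))) eq of λ ())))
        where
        swap : ∀ a b c → a * (b * c) ≡ b * (a * c)
        swap = solve-∀
      row : ∀ x → q * walks G (fatSmall ∷ fat G r ∷ Vec.replicate s distinct) distinct x x ≤ C * C * n * P * (d x * d x)
      row x = begin
        q * sum (λ y → weight G fatSmall x y * sum (λ z → weight G (fat G r) y z * walks G (Vec.replicate s distinct) distinct z x))
          ≤⟨ ℕ.*-monoʳ-≤ q (sum-mono λ y → ℕ.*-monoʳ-≤ (weight G fatSmall x y) (second x y)) ⟩
        q * sum (λ y → weight G fatSmall x y * (C * d y * (d x * P)))
          ≡⟨ sum-*ˡ q _ ⟨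
        sum (λ y → q * (weight G fatSmall x y * (C * d y * (d x * P))))
          ≡⟨ sum-cong-≗ (λ y → regroup₁ q (weight G fatSmall x y) C (d y) (d x * P)) ⟩
        sum (λ y → C * (d x * P) * (q * (weight G fatSmall x y * d y)))
          ≤⟨ sum-mono (λ y → ℕ.*-monoʳ-≤ (C * (d x * P)) (small x y)) ⟩
        sum (λ y → C * (d x * P) * (weight G (fat G r) x y * n))
          ≡⟨ trans (sum-*ˡ (C * (d x * P)) _) (cong (C * (d x * P) *_) (sum-*ʳ n _)) ⟩
        C * (d x * P) * (sum (weight G (fat G r) x) * n)
          ≤⟨ ℕ.*-monoʳ-≤ (C * (d x * P)) (ℕ.*-monoˡ-≤ n (fat-row-sum G r free x)) ⟩
        C * (d x * P) * (C * d x * n)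
          ≡⟨ regroup₂ C (d x) P n ⟩
        C * C * n * P * (d x * d x) ∎
        where
        regroup₁ : ∀ q w c d p → q * (w * (c * d * p)) ≡ c * p * (q * (w * d))
        regroup₁ = solve-∀
        regroup₂ : ∀ c d p n → c * (d * p) * (c * d * n) ≡ c * c * n * p * (d * d)
        regroup₂ = solve-∀

    -- The number of sequences of big vertices is bounded independently of `n`, so a single factor
    -- `n` exceeds it, even `q` times.
    all-big : ∀ l → q * (q * q * K) ^ (suc l * 2) ≤ n →
              q * sumV (suc l * 2) (allBig (big G r free q) (suc l * 2)) ≤ n ^ suc l
    all-big l huge = begin
      q * sumV (suc l * 2) (allBig (big G r free q) (suc l * 2))
        ≡⟨ cong (q *_) (sumV-allBig (big G r free q) (suc l * 2)) ⟩
      q * count (big G r free q) ^ (suc l * 2)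
        ≤⟨ ℕ.*-monoʳ-≤ q (ℕ.^-monoˡ-≤ (suc l * 2) (big-count G r free q)) ⟩
      q * (q * q * K) ^ (suc l * 2)   ≤⟨ huge ⟩
      n                               ≡⟨ ℕ.*-identityʳ n ⟨
      n * 1                           ≤⟨ ℕ.*-monoʳ-≤ n (ℕ.m^n>0 n l) ⟩
      n ^ suc l                       ∎
      where open ≤-Reasoning

-- Copies of cycles as periodic sequences

unique⊆⇒length≤ : {A : Set} {xs ys : List A} → Unique xs → (∀ {x} → x ∈ xs → x ∈ ys) → length xs ≤ length ys
unique⊆⇒length≤ {xs = []}     _         _     = z≤n
unique⊆⇒length≤ {xs = x ∷ xs} (x∉ ∷ un) xs⊆ys with as , bs , refl ← ∈-∃++ (xs⊆ys (here refl)) = begin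
  suc (length xs)               ≤⟨ s≤s (unique⊆⇒length≤ un xs⊆) ⟩
  suc (length (as ++ bs))       ≡⟨ cong suc (List.length-++ as) ⟩
  suc (length as + length bs)   ≡⟨ ℕ.+-suc (length as) (length bs) ⟨
  length as + length (x ∷ bs)   ≡⟨ List.length-++ as ⟨
  length (as ++ x ∷ bs)         ∎
  where
  open ≤-Reasoning
  xs⊆ : ∀ {z} → z ∈ xs → z ∈ as ++ bs
  xs⊆ z∈ with ∈-++⁻ as (xs⊆ys (there z∈))
  ... | inj₁ z∈as         = ∈-++⁺ˡ z∈as
  ... | inj₂ (here refl)  = contradiction refl (All.lookup x∉ z∈)
  ... | inj₂ (there z∈bs) = ∈-++⁺ʳ as z∈bs

∈-allVecs : {A : Set} {xs : List A} (v : Vec A n) → (∀ i → lookup v i ∈ xs) → v ∈ allVecs xs n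
∈-allVecs []      _  = here refl
∈-allVecs (x ∷ v) v∈ = ∈-cartesianProductWith⁺ _∷_ (v∈ zero) (∈-allVecs v (v∈ ∘ suc))

allVecs-unique : {A : Set} {xs : List A} → Unique xs → ∀ n → Unique (allVecs xs n)
allVecs-unique un zero    = [] ∷ []
allVecs-unique un (suc n) = Unique.cartesianProductWith⁺ _∷_ (λ { refl → refl , refl }) un (allVecs-unique un n)

∈-allSubsets : (V : Subset n) → V ∈ allSubsets n
∈-allSubsets V = ∈-allVecs V λ i → side (lookup V i)
  where
  side : ∀ b → b ∈ outside ∷ inside ∷ []
  side true  = there (here refl)
  side false = here refl

allSubsets-unique : ∀ n → Unique (allSubsets n)
allSubsets-unique = allVecs-unique (((λ ()) ∷ []) ∷ [] ∷ [])

∈-mapMaybe⁺ : {A B : Set} (f : A → Maybe B) {x : A} {y : B} {xs : List A} → x ∈ xs → f x ≡ just y → y ∈ mapMaybe f xs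
∈-mapMaybe⁺ f {xs = x ∷ xs} (here refl) eq with just _ ← f x | refl ← eq = here refl
∈-mapMaybe⁺ f {xs = x ∷ xs} (there x∈)  eq with f x
... | just _  = there (∈-mapMaybe⁺ f x∈ eq)
... | nothing = ∈-mapMaybe⁺ f x∈ eq

mapMaybe-unique : {A B : Set} (f : A → Maybe B) (g : B → A) → (∀ x {y} → f x ≡ just y → g y ≡ x) →
                  ∀ {xs} → Unique xs → Unique (mapMaybe f xs)
mapMaybe-unique f g inv {[]}     []        = []
mapMaybe-unique f g inv {x ∷ xs} (x∉ ∷ un) with f x in eq
... | nothing = mapMaybe-unique f g inv un
... | just y  = away xs x∉ ∷ mapMaybe-unique f g inv un
  where
  away : ∀ xs → All (x ≢_) xs → All (y ≢_) (mapMaybe f xs)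
  away []        []         = []
  away (x′ ∷ xs) (x≢ ∷ x∉) with f x′ in eq′
  ... | nothing = away xs x∉
  ... | just y′ = (λ { refl → x≢ (trans (sym (inv x eq)) (inv x′ eq′)) }) ∷ away xs x∉

private
  -- The function mapped in allGraphs is local there, so it is recovered by unification.
  toGraph : ∀ n → Σ (Vec (Subset n) n → Maybe (Graph n)) λ f → allGraphs n ≡ mapMaybe f (allVecs (allSubsets n) n)
  toGraph n = _ , refl

  toGraph-just : ∀ (N : Vec (Subset n) n) .(s : IsSimple N) → proj₁ (toGraph n) N ≡ just (graph N s)
  toGraph-just N s with isSimple? N
  ... | yes _  = refl
  ... | no ¬s = ⊥-elim (recompute (no λ ()) (¬s s))

  toGraph-nbrs : ∀ (N : Vec (Subset n) n) {G} → proj₁ (toGraph n) N ≡ just G → Graph.nbrs G ≡ N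
  toGraph-nbrs N eq with isSimple? N
  toGraph-nbrs N refl | yes _ = refl

∈-allGraphs : (G : Graph n) → G ∈ allGraphs n
∈-allGraphs (graph N s) = ∈-mapMaybe⁺ (proj₁ (toGraph _)) (∈-allVecs N λ i → ∈-allSubsets (lookup N i)) (toGraph-just N s)

allGraphs-unique : ∀ n → Unique (allGraphs n)
allGraphs-unique n = mapMaybe-unique (proj₁ (toGraph n)) Graph.nbrs toGraph-nbrs (allVecs-unique (allSubsets-unique n) n)

copyList : Graph n → Graph m → List (PartialGraph n)
copyList {n} G H = filter (isCopy? G H) (cartesianProduct (allSubsets n) (allGraphs n))

copyList-unique : (G : Graph n) (H : Graph m) → Unique (copyList G H)
copyList-unique {n} G H = Unique.filter⁺ (isCopy? G H) (Unique.cartesianProduct⁺ (allSubsets-unique n) (allGraphs-unique n))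

∈-copyList : (G : Graph n) (H : Graph m) {S : PartialGraph n} → IsCopy G H S → S ∈ copyList G H
∈-copyList G H {V , E} copy = ∈-filter⁺ (isCopy? G H) (∈-cartesianProduct⁺ (∈-allSubsets V) (∈-allGraphs E)) copy

∈-copyList⁻ : (G : Graph n) (H : Graph m) {S : PartialGraph n} → S ∈ copyList G H → IsCopy G H S
∈-copyList⁻ {n} G H S∈ = proj₂ (∈-filter⁻ (isCopy? G H) {xs = cartesianProduct (allSubsets n) (allGraphs n)} S∈)

Graph-ext : {G H : Graph n} → (∀ u v → Adj G u v → Adj H u v) → (∀ u v → Adj H u v → Adj G u v) → G ≡ H
Graph-ext {G = graph N _} {graph N′ _} G⊆H H⊆G = same (trans (sym (tabulate∘lookup N))
  (trans (tabulate-cong λ u → Subset.⊆-antisym (G⊆H u _) (H⊆G u _)) (tabulate∘lookup N′)))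
  where
  same : ∀ {N N′} .{s : IsSimple N} .{s′ : IsSimple N′} → N ≡ N′ → graph N s ≡ graph N′ s′
  same refl = refl

-- A cycle of length M in G, unrolled to an M-periodic sequence of vertices.
record IsCycle {n : ℕ} (G : Graph n) (M : ℕ) (p : ℕ → Fin n) : Set where
  field
    periodic : ∀ i → p (M + i) ≡ p i
    simple   : ∀ i {d} → 0 < d → d < M → p i ≢ p (d + i)
    edge     : ∀ i → Adj G (p i) (p (suc i))

-- One copy is traced by many sequences: rotations and reversals of `p` all trace the same `S`.
record Traces {n : ℕ} (S : PartialGraph n) (p : ℕ → Fin n) : Set where
  field
    vertex  : ∀ i → p i Subset.∈ proj₁ S
    vertex⁻ : ∀ {v} → v Subset.∈ proj₁ S → ∃ λ i → p i ≡ v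
    edge    : ∀ i → Adj (proj₂ S) (p i) (p (suc i))
    edge⁻   : ∀ {u v} → Adj (proj₂ S) u v → ∃ λ i → (u ≡ p i × v ≡ p (suc i)) ⊎ (v ≡ p i × u ≡ p (suc i))

traces-unique : {S S′ : PartialGraph n} {p p′ : ℕ → Fin n} → Traces S p → Traces S′ p′ → (∀ i → p i ≡ p′ i) → S ≡ S′
traces-unique t t′ p≗p′ = cong₂ _,_
  (Subset.⊆-antisym (V⊆ t t′ p≗p′) (V⊆ t′ t (sym ∘ p≗p′)))
  (Graph-ext (E⊆ t t′ p≗p′) (E⊆ t′ t (sym ∘ p≗p′)))
  where
  V⊆ : ∀ {S S′ : PartialGraph _} {p p′} → Traces S p → Traces S′ p′ → (∀ i → p i ≡ p′ i) →
       ∀ {v} → v Subset.∈ proj₁ S → v Subset.∈ proj₁ S′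
  V⊆ {S′ = S′} t t′ p≗p′ v∈ with i , refl ← Traces.vertex⁻ t v∈ = subst (Subset._∈ proj₁ S′) (sym (p≗p′ i)) (Traces.vertex t′ i)
  E⊆ : ∀ {S S′ : PartialGraph _} {p p′} → Traces S p → Traces S′ p′ → (∀ i → p i ≡ p′ i) →
       ∀ u v → Adj (proj₂ S) u v → Adj (proj₂ S′) u v
  E⊆ {S′ = S′} t t′ p≗p′ u v uv with Traces.edge⁻ t uv
  ... | i , inj₁ (refl , refl) = subst₂ (Adj (proj₂ S′)) (sym (p≗p′ i)) (sym (p≗p′ (suc i))) (Traces.edge t′ i)
  ... | i , inj₂ (refl , refl) = Adj-sym (proj₂ S′) (subst₂ (Adj (proj₂ S′)) (sym (p≗p′ i)) (sym (p≗p′ (suc i))) (Traces.edge t′ i))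

module _ {n : ℕ} {G : Graph n} {M : ℕ} {p : ℕ → Fin n} (cyc : IsCycle G M p) where
  open IsCycle cyc

  periodic-* : ∀ k i → p (k * M + i) ≡ p i
  periodic-* zero    i = refl
  periodic-* (suc k) i = trans (cong p (ℕ.+-assoc M (k * M) i)) (trans (periodic (k * M + i)) (periodic-* k i))

  periodic-% : .{{_ : NonZero M}} → ∀ i → p i ≡ p (i % M)
  periodic-% i = trans (cong p (trans (m≡m%n+[m/n]*n i M) (ℕ.+-comm (i % M) _))) (periodic-* (i / M) (i % M))

  injective-below : ∀ {i j} → i < M → j < M → p i ≡ p j → i ≡ j
  injective-below {i} {j} i<M j<M eq with ℕ.<-cmp i j
  ... | tri≈ _ i≡j _ = i≡j
  ... | tri< i<j _ _ = contradiction
          (trans eq (cong p (sym (ℕ.m∸n+n≡m (ℕ.<⇒≤ i<j))))) (simple i (ℕ.m<n⇒0<n∸m i<j) (ℕ.≤-<-trans (ℕ.m∸n≤m j i) j<M))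
  ... | tri> _ _ j<i = contradiction
          (trans (sym eq) (cong p (sym (ℕ.m∸n+n≡m (ℕ.<⇒≤ j<i))))) (simple j (ℕ.m<n⇒0<n∸m j<i) (ℕ.≤-<-trans (ℕ.m∸n≤m i j) i<M))

shift-cycle : ∀ {G : Graph n} {M p} t → IsCycle G M p → IsCycle G M (λ i → p (i + t))
shift-cycle {M = M} {p} t cyc = record
  { periodic = λ i → trans (cong p (ℕ.+-assoc M i t)) (periodic (i + t))
  ; simple   = λ i {d} 0<d d<M eq → simple (i + t) 0<d d<M (trans eq (cong p (ℕ.+-assoc d i t)))
  ; edge     = λ i → edge (i + t)
  }
  where open IsCycle cyc

shift-traces : ∀ {G : Graph n} {M p S} .{{_ : NonZero M}} → IsCycle G M p → ∀ t → Traces S p → Traces S (λ i → p (i + t))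
shift-traces {M = M@(suc M′)} {p} {S} cyc t tr = record
  { vertex  = λ i → vertex (i + t)
  ; vertex⁻ = λ v∈ → let i , eq = vertex⁻ v∈ in back i , trans (sym (back-eq i)) eq
  ; edge    = λ i → edge (i + t)
  ; edge⁻   = λ uv → let i , eqs = edge⁻ uv in back i , Sum.map (retarget i) (retarget i) eqs
  }
  where
  open Traces tr
  back : ℕ → ℕ
  -- `back i + t` is `i + t * M`: this subtracts `t` modulo `M` within the natural numbers.
  back i = i + t * M′
  arith : ∀ t M′ i → t * suc M′ + i ≡ i + t * M′ + t
  arith = solve-∀
  back-eq : ∀ i → p i ≡ p (back i + t)
  back-eq i = trans (sym (periodic-* cyc t i)) (cong p (arith t M′ i))
  retarget : ∀ i {u v} → u ≡ p i × v ≡ p (suc i) → u ≡ p (back i + t) × v ≡ p (suc (back i) + t)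
  retarget i (u≡ , v≡) = trans u≡ (back-eq i) , trans v≡ (back-eq (suc i))

%-suc : ∀ M .{{_ : NonZero M}} → 1 < M → ∀ i →
        (suc (i % M) ≡ suc i % M) ⊎ (suc (i % M) ≡ M × suc i % M ≡ 0)
%-suc M 1<M i with ℕ.m≤n⇒m<n∨m≡n (m%n<n i M)
... | inj₁ lt = inj₁ (trans (sym (m<n⇒m%n≡m lt)) (sym step-eq))
  where
  step-eq : suc i % M ≡ suc (i % M) % M
  step-eq = trans (%-distribˡ-+ 1 i M) (cong (λ x → (x + i % M) % M) (m<n⇒m%n≡m 1<M))
... | inj₂ eq = inj₂ (eq , trans (%-distribˡ-+ 1 i M) (trans (cong (λ x → (x + i % M) % M) (m<n⇒m%n≡m 1<M)) (trans (cong (_% M) eq) (n%n≡0 M))))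

%-distinct : ∀ M .{{_ : NonZero M}} i {d} → 0 < d → d < M → i % M ≢ (d + i) % M
%-distinct M i {d} 0<d d<M eq = ℕ.<⇒≢ 0<d (sym d≡0)
  where
  b = i % M
  eq% : b ≡ (d + b) % M
  eq% = trans eq (trans (%-distribˡ-+ d i M) (cong (λ x → (x + b) % M) (m<n⇒m%n≡m d<M)))
  d≡0 : d ≡ 0
  d≡0 with ℕ.<-≤-connex (d + b) M
  ... | inj₁ lt = ℕ.+-cancelʳ-≡ b d 0 (sym (trans eq% (m<n⇒m%n≡m lt)))
  ... | inj₂ M≤ = contradiction (ℕ.+-cancelʳ-≡ b d M d+b≡M+b) (ℕ.<⇒≢ d<M)
    where
    rest = d + b ∸ M
    rest<M : rest < M
    rest<M = ℕ.+-cancelˡ-< M rest M (ℕ.≤-<-trans (ℕ.≤-reflexive (ℕ.m+[n∸m]≡n M≤)) (ℕ.+-mono-< d<M (m%n<n i M)))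
    b≡rest : b ≡ rest
    b≡rest = trans eq% (trans (cong (_% M) (sym (trans (ℕ.+-comm rest M) (ℕ.m+[n∸m]≡n M≤))))
               (trans ([m+n]%n≡m%n rest M) (m<n⇒m%n≡m rest<M)))
    d+b≡M+b : d + b ≡ M + b
    d+b≡M+b = trans (sym (ℕ.m+[n∸m]≡n M≤)) (cong (M +_) (sym b≡rest))

module _ {n : ℕ} (G : Graph n) (M : ℕ) .{{_ : NonZero M}} (1<M : 1 < M) where

  unroll : Vec (Fin n) M → ℕ → Fin n
  unroll φ i = lookup φ (fromℕ< (m%n<n i M))

  unroll-at : ∀ φ i (j : Fin M) → i % M ≡ toℕ j → unroll φ i ≡ lookup φ j
  unroll-at φ i j eq = cong (lookup φ) (Fin.toℕ-injective (trans (Fin.toℕ-fromℕ< _) eq))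

  unroll-toℕ : ∀ φ (j : Fin M) → unroll φ (toℕ j) ≡ lookup φ j
  unroll-toℕ φ j = unroll-at φ (toℕ j) j (m<n⇒m%n≡m (Fin.toℕ<n j))

  unroll-next : ∀ φ {i j : Fin M} → Next i j → unroll φ (suc (toℕ i)) ≡ lookup φ j
  unroll-next φ {i} {j} (inj₁ eq)         = unroll-at φ _ j (trans (cong (_% M) eq) (m<n⇒m%n≡m (Fin.toℕ<n j)))
  unroll-next φ {i} {j} (inj₂ (eq , eq₀)) = unroll-at φ _ j (trans (trans (cong (_% M) eq) (n%n≡0 M)) (sym eq₀))

  private
    at : ℕ → Fin M
    at i = fromℕ< (m%n<n i M)

    toℕ-at : ∀ i → toℕ (at i) ≡ i % M
    toℕ-at i = Fin.toℕ-fromℕ< (m%n<n i M)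

    at-next : ∀ i → Next (at i) (at (suc i))
    at-next i rewrite toℕ-at i | toℕ-at (suc i) = %-suc M 1<M i

    at-distinct : ∀ i {d} → 0 < d → d < M → at i ≢ at (d + i)
    at-distinct i 0<d d<M eq = %-distinct M i 0<d d<M (trans (sym (toℕ-at i)) (trans (cong toℕ eq) (toℕ-at _)))

  unroll-cycle : ∀ φ → Injective φ → (∀ i j → Adj (Cycle M) i j → Adj G (lookup φ i) (lookup φ j)) → IsCycle G M (unroll φ)
  unroll-cycle φ inj hom = record
    { periodic = λ i → cong (lookup φ) (Fin.toℕ-injective (trans (toℕ-at (M + i))
                   (trans (trans (cong (_% M) (ℕ.+-comm M i)) ([m+n]%n≡m%n i M)) (sym (toℕ-at i)))))
    ; simple   = λ i 0<d d<M eq → at-distinct i 0<d d<M (inj _ _ eq)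
    ; edge     = λ i → hom _ _ (Equivalence.from (∈-nbrsOf cycleAdj? _ _) (at-distinct i z<s 1<M , inj₁ (at-next i)))
    }

  contains⇒cycle : Contains G (Cycle M) → ∃ (IsCycle G M)
  contains⇒cycle (φ , inj , hom) = unroll φ , unroll-cycle φ inj hom

  copy⇒cycle : ∀ {S} → IsCopy G (Cycle M) S → ∃ λ p → IsCycle G M p × Traces S p
  copy⇒cycle {V , E} (sub , φ , inj , verts , edges) = unroll φ ,
    unroll-cycle φ inj (λ i j ij → proj₂ (sub _ _ (proj₁ (edges i j) ij))) , record
    { vertex  = λ i → proj₂ (verts _) (_ , refl)
    ; vertex⁻ = λ v∈ → let i , eq = proj₁ (verts _) v∈ in toℕ i , trans (unroll-toℕ φ i) eq
    ; edge    = λ i → proj₁ (edges _ _) (Equivalence.from (∈-nbrsOf cycleAdj? _ _) (at-distinct i z<s 1<M , inj₁ (at-next i)))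
    ; edge⁻   = edge⁻
    }
    where
    edge⁻ : ∀ {u v} → Adj E u v → ∃ λ i → (u ≡ unroll φ i × v ≡ unroll φ (suc i)) ⊎ (v ≡ unroll φ i × u ≡ unroll φ (suc i))
    edge⁻ {u} {v} uv with proj₁ (verts u) (proj₁ (proj₁ (sub u v uv))) | proj₁ (verts v) (proj₂ (proj₁ (sub u v uv)))
    ... | i , refl | j , refl with proj₂ (Equivalence.to (∈-nbrsOf cycleAdj? i j) (proj₂ (edges i j) uv))
    ... | inj₁ nx = toℕ i , inj₁ (sym (unroll-toℕ φ i) , sym (unroll-next φ nx))
    ... | inj₂ nx = toℕ j , inj₂ (sym (unroll-toℕ φ j) , sym (unroll-next φ nx))

  module _ {p : ℕ → Fin n} (cyc : IsCycle G M p) where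
    open IsCycle cyc

    private
      Edge : Fin n → Fin n → Set
      Edge u v = ∃ λ (i : Fin M) → (u ≡ p (toℕ i) × v ≡ p (suc (toℕ i))) ⊎ (v ≡ p (toℕ i) × u ≡ p (suc (toℕ i)))

      edge? : ∀ u v → Dec (Edge u v)
      edge? u v = Fin.any? λ i → ((u Fin.≟ _) ×-dec (v Fin.≟ _)) ⊎-dec ((v Fin.≟ _) ×-dec (u Fin.≟ _))

      Edge⇒Adj : ∀ {u v} → Edge u v → Adj G u v
      Edge⇒Adj (i , inj₁ (refl , refl)) = edge (toℕ i)
      Edge⇒Adj (i , inj₂ (refl , refl)) = Adj-sym G (edge (toℕ i))

      hit? : ∀ v → Dec (∃ λ (i : Fin M) → p (toℕ i) ≡ v)
      hit? v = Fin.any? λ i → p (toℕ i) Fin.≟ v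

      V : Subset n
      V = tabulate λ v → does (hit? v)

      E : Graph n
      E = fromRelation edge? (λ u uu → Adj-irrefl G (Edge⇒Adj uu)) λ u v (i , e) → i , Sum.swap e

      V⁺ : ∀ {v} → (∃ λ (i : Fin M) → p (toℕ i) ≡ v) → v Subset.∈ V
      V⁺ {v} h = lookup⇒[]= v V (trans (lookup∘tabulate _ v) (dec-true (hit? v) h))

      V⁻ : ∀ {v} → v Subset.∈ V → ∃ λ (i : Fin M) → p (toℕ i) ≡ v
      V⁻ {v} v∈ with hit? v | trans (sym (lookup∘tabulate (does ∘ hit?) v)) ([]=⇒lookup v∈)
      ... | yes h | _ = h

      p-at : ∀ i → p i ≡ p (toℕ (at i))
      p-at i = trans (periodic-% cyc i) (cong p (sym (toℕ-at i)))

      p-suc-at : ∀ i → p (suc i) ≡ p (suc (toℕ (at i)))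
      p-suc-at i with %-suc M 1<M i
      ... | inj₁ eq         = trans (periodic-% cyc (suc i)) (cong p (sym (trans (cong suc (toℕ-at i)) eq)))
      ... | inj₂ (eq , eq₀) = trans (periodic-% cyc (suc i)) (trans (cong p eq₀) (sym
              (trans (cong p (trans (cong suc (toℕ-at i)) (trans eq (sym (ℕ.+-identityʳ M))))) (periodic 0))))

      p-next : ∀ {i j : Fin M} → Next i j → p (suc (toℕ i)) ≡ p (toℕ j)
      p-next (inj₁ eq)         = cong p eq
      p-next (inj₂ (eq , eq₀)) = trans (cong p (trans eq (sym (ℕ.+-identityʳ M)))) (trans (periodic 0) (cong p (sym eq₀)))

      φ : Vec (Fin n) M
      φ = tabulate (p ∘ toℕ)

      φ-at : ∀ i → lookup φ i ≡ p (toℕ i)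
      φ-at = lookup∘tabulate (p ∘ toℕ)

      p-injective : ∀ {i j : Fin M} → p (toℕ i) ≡ p (toℕ j) → i ≡ j
      p-injective eq = Fin.toℕ-injective (injective-below cyc (Fin.toℕ<n _) (Fin.toℕ<n _) eq)

      next⁻ : ∀ {i j : Fin M} → p (suc (toℕ i)) ≡ p (toℕ j) → Next i j
      next⁻ {i} {j} eq with ℕ.m≤n⇒m<n∨m≡n (Fin.toℕ<n i)
      ... | inj₁ lt = inj₁ (injective-below cyc lt (Fin.toℕ<n j) eq)
      ... | inj₂ i≡M = inj₂ (i≡M , sym (injective-below cyc (ℕ.<-trans z<s 1<M) (Fin.toℕ<n j)
              (trans (sym (trans (cong p (trans i≡M (sym (ℕ.+-identityʳ M)))) (periodic 0))) eq)))

      cycle⇒Edge : ∀ {i j} → CycleAdj i j → Edge (p (toℕ i)) (p (toℕ j))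
      cycle⇒Edge {i} {j} (_ , inj₁ nx) = i , inj₁ (refl , sym (p-next nx))
      cycle⇒Edge {i} {j} (_ , inj₂ nx) = j , inj₂ (refl , sym (p-next nx))

      Edge⇒cycle : ∀ {i j} → Edge (p (toℕ i)) (p (toℕ j)) → CycleAdj i j
      Edge⇒cycle {i} {j} e = (λ { refl → Adj-irrefl G (Edge⇒Adj e) }) , orient e
        where
        orient : Edge (p (toℕ i)) (p (toℕ j)) → Next i j ⊎ Next j i
        orient (t , inj₁ (i≡t , j≡)) with refl ← p-injective {i} {t} i≡t = inj₁ (next⁻ (sym j≡))
        orient (t , inj₂ (j≡t , i≡)) with refl ← p-injective {j} {t} j≡t = inj₂ (next⁻ (sym i≡))

    -- The way back from `copy⇒cycle`: through it, families of periodic sequences bound the number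
    -- of copies from below.
    trace : PartialGraph n
    trace = V , E

    trace-traces : Traces trace p
    trace-traces = record
      { vertex  = λ i → V⁺ (at i , sym (p-at i))
      ; vertex⁻ = λ v∈ → let i , eq = V⁻ v∈ in toℕ i , eq
      ; edge    = λ i → Equivalence.from (∈-nbrsOf edge? _ _) (at i , inj₁ (p-at i , p-suc-at i))
      ; edge⁻   = λ uv → let i , eqs = Equivalence.to (∈-nbrsOf edge? _ _) uv in toℕ i , eqs
      }

    trace-copy : IsCopy G (Cycle M) trace
    trace-copy =
      (λ u v uv → let e = Equivalence.to (∈-nbrsOf edge? u v) uv in ends e , Edge⇒Adj e) ,
      φ , (λ i j eq → p-injective (trans (sym (φ-at i)) (trans eq (φ-at j)))) ,
      (λ v → (λ v∈ → let i , eq = V⁻ v∈ in i , trans (φ-at i) eq) , λ (i , eq) → V⁺ (i , trans (sym (φ-at i)) eq)) ,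
      λ i j → (λ ij → Equivalence.from (∈-nbrsOf edge? _ _) (subst₂ Edge (sym (φ-at i)) (sym (φ-at j))
                        (cycle⇒Edge (Equivalence.to (∈-nbrsOf cycleAdj? i j) ij)))) ,
              (λ e → Equivalence.from (∈-nbrsOf cycleAdj? i j) (Edge⇒cycle (subst₂ Edge (φ-at i) (φ-at j)
                        (Equivalence.to (∈-nbrsOf edge? _ _) e))))
      where
      ends : ∀ {u v} → Edge u v → u Subset.∈ V × v Subset.∈ V
      ends (i , inj₁ (refl , refl)) = V⁺ (i , refl) , V⁺ (at (suc (toℕ i)) , sym (p-at _))
      ends (i , inj₂ (refl , refl)) = V⁺ (at (suc (toℕ i)) , sym (p-at _)) , V⁺ (i , refl)

opaque
  cycleCopies : Graph n → ℕ → ℕ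
  cycleCopies G M = copies G (Cycle M)

  cycleCopies-def : (G : Graph n) (M : ℕ) → cycleCopies G M ≡ copies G (Cycle M)
  cycleCopies-def G M = refl

  cycleCopyList : Graph n → ℕ → List (PartialGraph n)
  cycleCopyList G M = copyList G (Cycle M)

  length-cycleCopyList : (G : Graph n) (M : ℕ) → length (cycleCopyList G M) ≡ cycleCopies G M
  length-cycleCopyList G M = refl

  cycleCopyList-unique : (G : Graph n) (M : ℕ) → Unique (cycleCopyList G M)
  cycleCopyList-unique G M = copyList-unique G (Cycle M)

  cycleCopyList⁻ : (G : Graph n) (M : ℕ) .{{_ : NonZero M}} → 1 < M → ∀ {S} → S ∈ cycleCopyList G M →
                   ∃ λ p → IsCycle G M p × Traces S p
  cycleCopyList⁻ G M 1<M S∈ = copy⇒cycle G M 1<M (∈-copyList⁻ G (Cycle M) S∈)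

  cycleCopyList⁺ : (G : Graph n) (M : ℕ) .{{_ : NonZero M}} (1<M : 1 < M) → ∀ {p} (cyc : IsCycle G M p) →
                   trace G M 1<M cyc ∈ cycleCopyList G M
  cycleCopyList⁺ G M 1<M cyc = ∈-copyList G (Cycle M) (trace-copy G M 1<M cyc)

-- The upper bound

-- Double counting. By `functional`, bundles of different elements are disjoint, so together they
-- form one list of distinct vectors of weight at least `length xs * l`.
bundle-bound : {A : Set} (w : Vec (Fin n) m → ℕ) (ρ : A → Vec (Fin n) m → Set) (l : ℕ) →
  (∀ {a b v} → ρ a v → ρ b v → a ≡ b) → ∀ xs → Unique xs →
  (∀ {x} → x ∈ xs → ∃ λ vs → Unique vs × All (ρ x) vs × l ≤ ListAction.sum (List.map w vs)) →
  length xs * l ≤ sumV m w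
bundle-bound {n} {m} {A} w ρ l functional xs un bundle =
  let vs , un-vs , _ , bound = collect xs un bundle in ≤-trans bound (unique-sum≤sumV m w vs un-vs)
  where
  collect : ∀ xs → Unique xs →
    (∀ {x} → x ∈ xs → ∃ λ vs → Unique vs × All (ρ x) vs × l ≤ ListAction.sum (List.map w vs)) →
    ∃ λ vs → Unique vs × All (λ v → ∃ λ x → x ∈ xs × ρ x v) vs × length xs * l ≤ ListAction.sum (List.map w vs)
  collect []       _         _ = [] , [] , [] , z≤n
  collect (x ∷ xs) (x∉ ∷ un) b with b (here refl) | collect xs un (b ∘ there)
  ... | vs , un-vs , ρ-vs , l≤ | us , un-us , ρ-us , bound = vs ++ us ,
    Unique.++⁺ un-vs un-us (λ (v∈ , v∈′) → let y , y∈ , ρy = All.lookup ρ-us v∈′ in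
      All.lookup x∉ y∈ (functional (All.lookup ρ-vs v∈) ρy)) ,
    All.++⁺ (All.map (λ ρv → x , here refl , ρv) ρ-vs) (All.map (λ (y , y∈ , ρv) → y , there y∈ , ρv) ρ-us) ,
    ≤-trans (ℕ.+-mono-≤ l≤ bound) (ℕ.≤-reflexive (sym (trans (cong ListAction.sum (List.map-++ w vs us)) (ListAction.sum-++ (List.map w vs) _))))

length≤sum : {A : Set} (w : A → ℕ) (vs : List A) → All (λ v → 1 ≤ w v) vs → length vs ≤ ListAction.sum (List.map w vs)
length≤sum w []       []        = z≤n
length≤sum w (v ∷ vs) (1≤ ∷ ws) = ℕ.+-mono-≤ 1≤ (length≤sum w vs ws)

vecFrom : {A : Set} → (ℕ → A) → ∀ m → Vec A m
vecFrom p zero    = []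
vecFrom p (suc m) = p 0 ∷ vecFrom (p ∘ suc) m

vecFrom-injective : {A : Set} {p p′ : ℕ → A} → ∀ m → vecFrom p m ≡ vecFrom p′ m → ∀ {i} → i < m → p i ≡ p′ i
vecFrom-injective (suc m) eq {zero}  _   = cong Vec.head eq
vecFrom-injective (suc m) eq {suc i} i<m = vecFrom-injective m (cong Vec.tail eq) (s<s⁻¹ i<m)

allBig-vecFrom : ∀ (b : Fin n → Bool) p m → (∀ {i} → i < m → b (p i) ≡ true) → 1 ≤ allBig b m (vecFrom p m)
allBig-vecFrom b p zero    _  = ≤-refl
allBig-vecFrom b p (suc m) bp rewrite bp z<s = ≤-trans (allBig-vecFrom b (p ∘ suc) m (bp ∘ s<s)) (ℕ.≤-reflexive (sym (ℕ.+-identityʳ _)))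

Pairs : ∀ {s} → Vec (Kernel n) s → Kernel n → (ℕ → Fin n) → Fin n → Set
Pairs []       χ p z = χ (p 0) z ≡ true
Pairs (κ ∷ κs) χ p z = κ (p 0) (p 2) ≡ true × Pairs κs χ (λ i → p (2 + i)) z

pairs-replicate : ∀ {κ χ : Kernel n} {z} s p → (∀ j → κ (p (j * 2)) (p (2 + j * 2)) ≡ true) →
                  χ (p (s * 2)) z ≡ true → Pairs (Vec.replicate s κ) χ p z
pairs-replicate zero    p κp χp = χp
pairs-replicate (suc s) p κp χp = κp 0 , pairs-replicate s (λ i → p (2 + i)) (κp ∘ suc) χp

opaque
  -- The first summand comes from `closed-thin`; the three in the bracket come from
  -- `closed-fat-thin`, `closed-fat-fat` and `all-big`, times the weight `3 + s` given to rare
  -- sequences.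
  errTotal : ℕ → ℕ → ℕ
  errTotal r s = r * errConst r (2 + s) + (3 + s) * (fatConst r * r * rowConst r ^ (1 + s) + fatConst r * fatConst r * rowConst r ^ (1 + s) + 1)

  errTotal-def : ∀ r s → errTotal r s ≡ r * errConst r (2 + s) + (3 + s) * (fatConst r * r * rowConst r ^ (1 + s) + fatConst r * fatConst r * rowConst r ^ (1 + s) + 1)
  errTotal-def r s = refl

private
  combine : ∀ q c l w {t₁ t₂ t₃ t₄ a e b₂ b₃ p} → w ≡ t₁ + l * (t₂ + t₃ + t₄) → c * l ≤ w →
    q * t₁ ≤ (a + e) * p → q * t₂ ≤ b₂ * p → q * t₃ ≤ b₃ * p → q * t₄ ≤ p →
    q * (c * l) ≤ (a + (e + l * (b₂ + b₃ + 1))) * p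
  combine q c l w {t₁} {t₂} {t₃} {t₄} {a} {e} {b₂} {b₃} {p} refl c≤w t₁≤ t₂≤ t₃≤ t₄≤ = begin
    q * (c * l)                                       ≤⟨ ℕ.*-monoʳ-≤ q c≤w ⟩
    q * (t₁ + l * (t₂ + t₃ + t₄))                     ≡⟨ expand q t₁ l t₂ t₃ t₄ ⟩
    q * t₁ + l * (q * t₂ + q * t₃ + q * t₄)           ≤⟨ ℕ.+-mono-≤ t₁≤ (ℕ.*-monoʳ-≤ l (ℕ.+-mono-≤ (ℕ.+-mono-≤ t₂≤ t₃≤) t₄≤)) ⟩
    (a + e) * p + l * (b₂ * p + b₃ * p + p)           ≡⟨ factor a e p l b₂ b₃ ⟩
    (a + (e + l * (b₂ + b₃ + 1))) * p                 ∎
    where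
    open ≤-Reasoning
    expand : ∀ q a l b c d → q * (a + l * (b + c + d)) ≡ q * a + l * (q * b + q * c + q * d)
    expand = solve-∀
    factor : ∀ a e p l b c → (a + e) * p + l * (b * p + c * p + p) ≡ (a + (e + l * (b + c + 1))) * p
    factor = solve-∀

module _ {n : ℕ} (G : Graph n) where

  chain-positive : ∀ {s} (κs : Vec (Kernel n) s) χ p z → (∀ i → Adj G (p i) (p (suc i))) → p (suc s * 2) ≡ z →
                   Pairs κs χ p z → 1 ≤ chain G κs χ (p 0) z (vecFrom (p ∘ suc) (suc (s * 2)))
  chain-positive []       χ p _ edge refl χp = ℕ.≤-reflexive (sym (link≡1 χp))
    where
    link≡1 : χ (p 0) (p 2) ≡ true → link G χ (p 0) (p 1) (p 2) ≡ 1
    link≡1 χp rewrite χp | Adj⇒adj G (edge 0) | Adj⇒adj G (edge 1) = refl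
  chain-positive (κ ∷ κs) χ p z edge end (κp , rest) = ℕ.*-mono-≤ (ℕ.≤-reflexive (sym (link≡1 κp)))
      (chain-positive κs χ (λ i → p (2 + i)) z (λ i → edge (2 + i)) end rest)
    where
    link≡1 : κ (p 0) (p 2) ≡ true → link G κ (p 0) (p 1) (p 2) ≡ 1
    link≡1 κp rewrite κp | Adj⇒adj G (edge 0) | Adj⇒adj G (edge 1) = refl

  closedChain-positive : ∀ {s} (κs : Vec (Kernel n) s) χ {p} → IsCycle G (suc s * 2) p → Pairs κs χ p (p 0) →
                         1 ≤ closedChain G κs χ (vecFrom p (suc s * 2))
  closedChain-positive {s} κs χ {p} cyc = chain-positive κs χ p (p 0) edge
    (trans (cong p (sym (ℕ.+-identityʳ (suc s * 2)))) (periodic 0))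
    where open IsCycle cyc

  module _ (r : ℕ) (free : ¬ Contains G (Cycle (2 * suc r))) (q s : ℕ) .{{_ : NonZero n}} (large : q * q * rowConst r ≤ n) where

    private
      l = 3 + s
      M = l * 2
      bg = big G r free q

      opaque
        thinChain fatThinChain fatFatChain bigChain : Vec (Fin n) M → ℕ
        thinChain    = closedChain G (Vec.replicate (2 + s) (thin G r)) (thin G r)
        fatThinChain = closedChain G (fat G r ∷ Vec.replicate (1 + s) distinct) (thin G r)
        fatFatChain  = closedChain G (fatSmall G r free q large ∷ fat G r ∷ Vec.replicate s distinct) distinct
        bigChain     = allBig bg M

        thinChain-positive : ∀ {p} → IsCycle G M p → Pairs (Vec.replicate (2 + s) (thin G r)) (thin G r) p (p 0) → 1 ≤ thinChain (vecFrom p M)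
        thinChain-positive = closedChain-positive (Vec.replicate (2 + s) (thin G r)) (thin G r)

        fatThinChain-positive : ∀ {p} → IsCycle G M p → Pairs (fat G r ∷ Vec.replicate (1 + s) distinct) (thin G r) p (p 0) → 1 ≤ fatThinChain (vecFrom p M)
        fatThinChain-positive = closedChain-positive (fat G r ∷ Vec.replicate (1 + s) distinct) (thin G r)

        fatFatChain-positive : ∀ {p} → IsCycle G M p → Pairs (fatSmall G r free q large ∷ fat G r ∷ Vec.replicate s distinct) distinct p (p 0) → 1 ≤ fatFatChain (vecFrom p M)
        fatFatChain-positive = closedChain-positive (fatSmall G r free q large ∷ fat G r ∷ Vec.replicate s distinct) distinct

        bigChain-positive : ∀ p → (∀ {i} → i < M → bg (p i) ≡ true) → 1 ≤ bigChain (vecFrom p M)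
        bigChain-positive p = allBig-vecFrom bg p M

        thinChain-total : q * sumV M thinChain ≤ (q * r ^ l + r * errConst r (2 + s)) * n ^ l
        thinChain-total = ≤-trans (ℕ.≤-reflexive (cong (q *_) (sumV-closedChain G _ _))) (closed-thin G r free q large (2 + s))

        fatThinChain-total : q * sumV M fatThinChain ≤ fatConst r * r * rowConst r ^ (1 + s) * n ^ l
        fatThinChain-total = ≤-trans (ℕ.≤-reflexive (cong (q *_) (sumV-closedChain G _ _))) (closed-fat-thin G r free q large (1 + s))

        fatFatChain-total : q * sumV M fatFatChain ≤ fatConst r * fatConst r * rowConst r ^ (1 + s) * n ^ l
        fatFatChain-total = ≤-trans (ℕ.≤-reflexive (cong (q *_) (sumV-closedChain G _ _))) (closed-fat-fat G r free q large s)

        bigChain-total : q * (q * q * rowConst r) ^ M ≤ n → q * sumV M bigChain ≤ n ^ l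
        bigChain-total = all-big G r free q large (2 + s)

      -- A copy with a thin colour class supplies `l` rotations of weight at least 1. Any other copy
      -- supplies one rare rotation, which is given the weight `l` at once; this enlarges only the
      -- error.
      rare W : Vec (Fin n) M → ℕ
      rare v = fatThinChain v + fatFatChain v + bigChain v
      W v = thinChain v + l * rare v

      Code : PartialGraph n → Vec (Fin n) M → Set
      Code S v = ∃ λ p → IsCycle G M p × Traces S p × v ≡ vecFrom p M

      code-functional : ∀ {S S′ v} → Code S v → Code S′ v → S ≡ S′
      code-functional (p , cyc , tr , refl) (p′ , cyc′ , tr′ , eq) = traces-unique tr tr′ λ i →
        trans (periodic-% cyc i) (trans (vecFrom-injective {p = p} {p′} M eq (m%n<n i M)) (sym (periodic-% cyc′ i)))

      Bundle : PartialGraph n → Set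
      Bundle S = ∃ λ vs → Unique vs × All (Code S) vs × l ≤ ListAction.sum (List.map W vs)

      single : ∀ {S p} → IsCycle G M p → Traces S p → 1 ≤ rare (vecFrom p M) → Bundle S
      single {S} {p} cyc tr 1≤ = vecFrom p M ∷ [] , [] ∷ [] , (p , cyc , tr , refl) ∷ [] , (begin
        l                                  ≡⟨ ℕ.*-identityʳ l ⟨
        l * 1                              ≤⟨ ℕ.*-monoʳ-≤ l 1≤ ⟩
        l * rare (vecFrom p M)             ≤⟨ ℕ.m≤n+m _ (thinChain (vecFrom p M)) ⟩
        W (vecFrom p M)                    ≡⟨ ℕ.+-identityʳ _ ⟨
        W (vecFrom p M) + 0                ∎)
        where open ≤-Reasoning

      module _ {p : ℕ → Fin n} (cyc : IsCycle G M p) where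
        open IsCycle cyc

        -- Thinness of the pair at positions `i` and `2 + i`; the parity of `i` tells the colour
        -- class.
        t : ℕ → Bool
        t i = codegree G (p i) (p (2 + i)) ≤ᵇ r

        distinct-at : ∀ i → distinct (p i) (p (2 + i)) ≡ true
        distinct-at i = cong not (≟ᵇ-false (simple i z<s (s≤s (s≤s (s≤s z≤n)))))

        thin-at : ∀ {i} → t i ≡ true → thin G r (p i) (p (2 + i)) ≡ true
        thin-at {i} ti = cong₂ _∧_ (distinct-at i) ti

        fat-at : ∀ {i} → t i ≡ false → fat G r (p i) (p (2 + i)) ≡ true
        fat-at {i} ti = cong₂ _∧_ (distinct-at i) (cong not ti)

        wrap : ∀ i → t (M + i) ≡ t i
        wrap i = cong₂ (λ u v → codegree G u v ≤ᵇ r) (periodic i)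
          (trans (cong p (swap M i)) (periodic (2 + i)))
          where
          swap : ∀ M i → 2 + (M + i) ≡ M + (2 + i)
          swap = solve-∀

        wrap-* : ∀ k i → t (k * M + i) ≡ t i
        wrap-* zero    i = refl
        wrap-* (suc k) i = trans (cong t (ℕ.+-assoc M (k * M) i)) (trans (wrap (k * M + i)) (wrap-* k i))

        wrap-% : ∀ c i → t (c + i) ≡ t (c + i % M)
        wrap-% c i = trans (cong t (trans (cong (c +_) (m≡m%n+[m/n]*n i M)) (arith c (i % M) (i / M * M)))) (wrap-* (i / M) (c + i % M))
          where
          arith : ∀ c a b → c + (a + b) ≡ b + (c + a)
          arith = solve-∀

      module _ {S : PartialGraph n} where

        -- Rotations by even amounts keep the thin class at the even positions, and there are `l` of
        -- them, told apart by their first vertices.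
        thin-bundle : ∀ {p} (cyc : IsCycle G M p) → Traces S p → (∀ j → t cyc (j * 2) ≡ true) → Bundle S
        thin-bundle {p} cyc tr thin-even = List.applyUpTo rotation l ,
          Unique.applyUpTo⁺₁ rotation l (λ {i} {j} i<j j<l eq → ℕ.<⇒≢ i<j (ℕ.*-cancelʳ-≡ i j 2
            (injective-below cyc (ℕ.*-monoˡ-< 2 (ℕ.<-trans i<j j<l)) (ℕ.*-monoˡ-< 2 j<l) (cong Vec.head eq)))) ,
          All.applyUpTo⁺₂ rotation l (λ j → _ , shift-cycle (j * 2) cyc , shift-traces cyc (j * 2) tr , refl) ,
          subst (_≤ ListAction.sum (List.map W (List.applyUpTo rotation l))) (List.length-applyUpTo rotation l)
            (length≤sum W _ (All.applyUpTo⁺₂ rotation l λ j → ≤-trans (positive j) (ℕ.m≤m+n (thinChain (rotation j)) _)))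
          where
          rotation : ℕ → Vec (Fin n) M
          rotation j = vecFrom (λ i → p (i + j * 2)) M
          positive : ∀ j → 1 ≤ thinChain (rotation j)
          positive j = thinChain-positive cyc′
            (pairs-replicate {κ = thin G r} {thin G r} (2 + s) (λ i → p (i + j * 2)) at-even
              (subst (λ v → thin G r (p ((2 + s) * 2 + j * 2)) v ≡ true) (IsCycle.periodic cyc (j * 2)) (at-even (2 + s))))
            where
            cyc′ = shift-cycle (j * 2) cyc
            at-even : ∀ i → thin G r (p (i * 2 + j * 2)) (p (2 + (i * 2 + j * 2))) ≡ true
            at-even i = thin-at cyc (trans (cong (t cyc) (sym (ℕ.*-distribʳ-+ 2 i j))) (thin-even (i + j)))

        -- Starting at `2 + i` puts the fat pair first and leaves the thin pair at `i` to close the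
        -- walk.
        fat-thin-bundle : ∀ {p} (cyc : IsCycle G M p) → Traces S p → ∀ i → t cyc i ≡ true → t cyc (2 + i) ≡ false → Bundle S
        fat-thin-bundle {p} cyc tr i ti t2i = single cyc′ (shift-traces cyc (2 + i) tr)
          (≤-trans (fatThinChain-positive cyc′
            (fat-at cyc t2i , pairs-replicate {κ = distinct} {χ = thin G r} (1 + s) (λ j → p (2 + j + (2 + i)))
              (λ j → distinct-at cyc (2 + (j * 2) + (2 + i)))
              (subst (λ u → thin G r u (p (2 + i)) ≡ true) (trans (sym (IsCycle.periodic cyc i)) (cong p (arith s i))) (thin-at cyc ti))))
            (≤-trans (ℕ.m≤m+n _ _) (ℕ.m≤m+n _ _)))
          where
          cyc′ = shift-cycle (2 + i) cyc
          arith : ∀ s i → 6 + s * 2 + i ≡ 2 + (2 + s * 2) + (2 + i)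
          arith = solve-∀

        fat-fat-bundle : ∀ {p} (cyc : IsCycle G M p) → Traces S p → (∀ i → t cyc i ≡ false) → ∀ i → bg (p i) ≡ false → Bundle S
        fat-fat-bundle {p} cyc tr all-fat i small = single cyc′ (shift-traces cyc o tr)
          (≤-trans (fatFatChain-positive cyc′
            (cong₂ _∧_ (fat-at cyc (all-fat o)) (cong not (trans (cong bg (IsCycle.periodic cyc i)) small)) ,
             fat-at cyc (all-fat (2 + o)) ,
             pairs-replicate {κ = distinct} {χ = distinct} s (λ j → p (4 + j + o)) (λ j → distinct-at cyc (4 + j * 2 + o))
               (subst (λ v → distinct (p (4 + s * 2 + o)) v ≡ true) (IsCycle.periodic cyc o) (distinct-at cyc (4 + s * 2 + o)))))
            (≤-trans (ℕ.m≤n+m _ (fatThinChain (vecFrom (λ j → p (j + o)) M))) (ℕ.m≤m+n _ _)))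
          where
          -- This is `i - 2` modulo `M`: the walk starts one pair before `p i`, so the small vertex
          -- is the common end of its first two pairs.
          o = 4 + s * 2 + i
          cyc′ = shift-cycle o cyc

        big-bundle : ∀ {p} (cyc : IsCycle G M p) → Traces S p → (∀ {i} → i < M → bg (p i) ≡ true) → Bundle S
        big-bundle {p} cyc tr all-big = single cyc tr
          (≤-trans (bigChain-positive p all-big) (ℕ.m≤n+m _ (fatThinChain (vecFrom p M) + fatFatChain (vecFrom p M))))

        bundle : ∀ {p} (cyc : IsCycle G M p) → Traces S p → Bundle S
        bundle {p} cyc tr with ℕ.anyUpTo? (λ i → (t cyc i Bool.≟ true) ×-dec (t cyc (2 + i) Bool.≟ false)) M
        ... | yes (i , _ , ti , t2i) = fat-thin-bundle cyc tr i ti t2i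
        ... | no none = cases (true-dec (t cyc 0)) (true-dec (t cyc 1))
          where
          -- Thinness that is never followed by fatness spreads over its whole colour class. The
          -- search covered positions below `M` only, hence the reduction modulo `M`.
          persists : ∀ i → t cyc i ≡ true → t cyc (2 + i) ≡ true
          persists i ti with true-dec (t cyc (2 + i))
          ... | inj₁ eq = eq
          ... | inj₂ eq = contradiction (i % M , m%n<n i M , trans (sym (wrap-% cyc 0 i)) ti , trans (sym (wrap-% cyc 2 i)) eq) none
          persists-* : ∀ j i → t cyc i ≡ true → t cyc (j * 2 + i) ≡ true
          persists-* zero    i ti = ti
          persists-* (suc j) i ti = persists (j * 2 + i) (persists-* j i ti)
          cases : (t cyc 0 ≡ true ⊎ t cyc 0 ≡ false) → (t cyc 1 ≡ true ⊎ t cyc 1 ≡ false) → Bundle S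
          cases (inj₁ t0) _ = thin-bundle cyc tr λ j → trans (cong (t cyc) (sym (ℕ.+-identityʳ (j * 2)))) (persists-* j 0 t0)
          -- The thin class occupies the odd positions; starting one vertex later makes them even.
          cases _ (inj₁ t1) = thin-bundle (shift-cycle 1 cyc) (shift-traces cyc 1 tr) λ j → persists-* j 1 t1
          cases (inj₂ t0) (inj₂ t1) with ℕ.anyUpTo? (λ i → bg (p i) Bool.≟ false) M
          ... | yes (i , _ , small) = fat-fat-bundle cyc tr all-fat i small
            where
            all-fat : ∀ i → t cyc i ≡ false
            all-fat i with true-dec (t cyc i)
            ... | inj₂ eq = eq
            -- A full turn consists of `3 + s` pairs. Advancing `2 + s` pairs thus amounts to going
            -- back one pair, and doing so `i / 2` times leads from `i` to `i % 2`.
            ... | inj₁ eq = ⊥-elim (parity (i % 2) (m%n<n i 2) (trans (sym eq′) (persists-* ((i / 2) * (2 + s)) i eq)))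
              where
              arith : ∀ h s ρ → h * (2 + s) * 2 + (ρ + h * 2) ≡ h * ((3 + s) * 2) + ρ
              arith = solve-∀
              eq′ : t cyc ((i / 2) * (2 + s) * 2 + i) ≡ t cyc (i % 2)
              eq′ = trans (cong (t cyc) (trans (cong ((i / 2) * (2 + s) * 2 +_) (m≡m%n+[m/n]*n i 2)) (arith (i / 2) s (i % 2))))
                (wrap-* cyc (i / 2) (i % 2))
              parity : ∀ ρ → ρ < 2 → t cyc ρ ≡ true → ⊥
              parity 0 _ tt = case trans (sym tt) t0 of λ ()
              parity 1 _ tt = case trans (sym tt) t1 of λ ()
              parity (suc (suc _)) (s≤s (s≤s ())) _
          ... | no no-small = big-bundle cyc tr λ {i} i<M → case true-dec (bg (p i)) of λ where
                (inj₁ eq) → eq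
                (inj₂ eq) → contradiction (i , i<M , eq) no-small

    copies-bound : q * (q * q * rowConst r) ^ M ≤ n → q * (cycleCopies G M * l) ≤ (q * r ^ l + errTotal r s) * n ^ l
    copies-bound huge = subst (λ e → q * (cycleCopies G M * l) ≤ (q * r ^ l + e) * n ^ l) (sym (errTotal-def r s))
      (combine q (cycleCopies G M) l (sumV M W) {a = q * r ^ l} {r * errConst r (2 + s)}
        {fatConst r * r * rowConst r ^ (1 + s)} {fatConst r * fatConst r * rowConst r ^ (1 + s)} {n ^ l}
        total counted thinChain-total fatThinChain-total fatFatChain-total (bigChain-total huge))
      where
      total : sumV M W ≡ sumV M thinChain + l * (sumV M fatThinChain + sumV M fatFatChain + sumV M bigChain)
      total = trans (sumV-+ M thinChain (λ v → l * rare v)) (cong (sumV M thinChain +_) (trans (sumV-*ˡ M l rare)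
        (cong (l *_) (trans (sumV-+ M (λ v → fatThinChain v + fatFatChain v) bigChain)
          (cong (_+ sumV M bigChain) (sumV-+ M fatThinChain fatFatChain))))))
      counted : cycleCopies G M * l ≤ sumV M W
      counted = subst (λ c → c * l ≤ sumV M W) (length-cycleCopyList G M) $
        bundle-bound W Code l code-functional (cycleCopyList G M) (cycleCopyList-unique G M)
          λ S∈ → let _ , cyc , tr = cycleCopyList⁻ G M (s≤s (s≤s z≤n)) S∈ in bundle cyc tr

-- Asymptotics

copies≤ex : ∀ {h f} {H : Graph h} {F : Graph f} (G : Graph n) → ¬ Contains G F → copies G H ≤ ex n H F
copies≤ex {n} {H = H} {F} G free = All.lookup (xs≤max 0 (List.map (λ G → copies G H) (filter (λ G → ¬? (contains? G F)) (allGraphs n)))) (∈-map⁺ (λ G → copies G H)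
  (∈-filter⁺ (λ G → ¬? (contains? G F)) (∈-allGraphs G) free))

ex≤ : ∀ {h f} (H : Graph h) (F : Graph f) {b} → (∀ (G : Graph n) → ¬ Contains G F → copies G H ≤ b) → ex n H F ≤ b
ex≤ {n} H F copies≤ = max≤v⁺ z≤n (All.map⁺ (All.tabulate λ {G} G∈ →
  copies≤ G (proj₂ (∈-filter⁻ (λ G → ¬? (contains? G F)) {xs = allGraphs n} G∈))))

private
  -- Reduces the rational inequalities to natural numbers: `y` is the numerator of `1 + i / suc g`,
  -- which has to be nonnegative even where `i` is negative.
  scaled : ∀ i g A b N y → ℤ.+ suc g ℤ.+ i ≡ ℤ.+ y →
    ℚ.toℚᵘ ((ℚ.1ℚ ℚ.+ i ℚ./ suc g) ℚ.* ((ℤ.+ A ℚ./ suc b) ℚ.* (ℤ.+ N ℚ./ 1))) ℚᵘ.≃ mkℚᵘ (ℤ.+ (y * (A * N))) (b + g * suc b)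
  scaled i g A b N y eq = begin-equality
    ℚ.toℚᵘ ((ℚ.1ℚ ℚ.+ i ℚ./ suc g) ℚ.* ((ℤ.+ A ℚ./ suc b) ℚ.* (ℤ.+ N ℚ./ 1)))
      ≃⟨ ℚ.toℚᵘ-homo-* (ℚ.1ℚ ℚ.+ i ℚ./ suc g) ((ℤ.+ A ℚ./ suc b) ℚ.* (ℤ.+ N ℚ./ 1)) ⟩
    ℚ.toℚᵘ (ℚ.1ℚ ℚ.+ i ℚ./ suc g) ℚᵘ.* ℚ.toℚᵘ ((ℤ.+ A ℚ./ suc b) ℚ.* (ℤ.+ N ℚ./ 1))
      ≃⟨ ℚᵘ.*-cong
           (ℚᵘ.≃-trans (ℚ.toℚᵘ-homo-+ ℚ.1ℚ (i ℚ./ suc g)) (ℚᵘ.+-congʳ ℚᵘ.1ℚᵘ (ℚ.toℚᵘ-fromℚᵘ (mkℚᵘ i g))))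
           (ℚᵘ.≃-trans (ℚ.toℚᵘ-homo-* (ℤ.+ A ℚ./ suc b) (ℤ.+ N ℚ./ 1))
             (ℚᵘ.*-cong (ℚ.toℚᵘ-fromℚᵘ (mkℚᵘ (ℤ.+ A) b)) (ℚ.toℚᵘ-fromℚᵘ (mkℚᵘ (ℤ.+ N) 0)))) ⟩
    (ℚᵘ.1ℚᵘ ℚᵘ.+ mkℚᵘ i g) ℚᵘ.* (mkℚᵘ (ℤ.+ A) b ℚᵘ.* mkℚᵘ (ℤ.+ N) 0)
      ≃⟨ ℚᵘ.*≡* (cong₂ ℤ._*_ num (cong ℤ.+_ den)) ⟩
    mkℚᵘ (ℤ.+ (y * (A * N))) (b + g * suc b) ∎
    where
    open ℚᵘ.≤-Reasoning
    num : (ℤ.+ 1 ℤ.* ℤ.+ suc g ℤ.+ i ℤ.* ℤ.+ 1) ℤ.* (ℤ.+ A ℤ.* ℤ.+ N) ≡ ℤ.+ (y * (A * N))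
    num = trans (cong₂ ℤ._*_
        (trans (cong₂ ℤ._+_ (ℤ.*-identityˡ (ℤ.+ suc g)) (ℤ.*-identityʳ i)) eq)
        (sym (ℤ.pos-* A N)))
      (sym (ℤ.pos-* y (A * N)))
    den : suc g * suc b ≡ 1 * suc g * (suc b * 1)
    den = trans (cong₂ _*_ (sym (ℕ.+-identityʳ (suc g))) (sym (ℕ.*-identityʳ (suc b)))) refl

  fraction≤scaled : ∀ F i g A b N y → ℤ.+ suc g ℤ.+ i ≡ ℤ.+ y → F * (suc g * suc b) ≤ y * (A * N) →
    ℤ.+ F ℚ./ 1 ℚ.≤ (ℚ.1ℚ ℚ.+ i ℚ./ suc g) ℚ.* ((ℤ.+ A ℚ./ suc b) ℚ.* (ℤ.+ N ℚ./ 1))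
  fraction≤scaled F i g A b N y eq le = ℚ.toℚᵘ-cancel-≤ (ℚᵘ.≤-respˡ-≃ (ℚᵘ.≃-sym (ℚ.toℚᵘ-fromℚᵘ (mkℚᵘ (ℤ.+ F) 0)))
    (ℚᵘ.≤-respʳ-≃ (ℚᵘ.≃-sym (scaled i g A b N y eq)) (ℚᵘ.*≤* (subst₂ ℤ._≤_
      (ℤ.pos-* F (suc g * suc b)) (sym (ℤ.*-identityʳ _)) (ℤ.+≤+ le)))))

  scaled≤fraction : ∀ F i g A b N y → ℤ.+ suc g ℤ.+ i ≡ ℤ.+ y → y * (A * N) ≤ F * (suc g * suc b) →
    (ℚ.1ℚ ℚ.+ i ℚ./ suc g) ℚ.* ((ℤ.+ A ℚ./ suc b) ℚ.* (ℤ.+ N ℚ./ 1)) ℚ.≤ ℤ.+ F ℚ./ 1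
  scaled≤fraction F i g A b N y eq le = ℚ.toℚᵘ-cancel-≤ (ℚᵘ.≤-respʳ-≃ (ℚᵘ.≃-sym (ℚ.toℚᵘ-fromℚᵘ (mkℚᵘ (ℤ.+ F) 0)))
    (ℚᵘ.≤-respˡ-≃ (ℚᵘ.≃-sym (scaled i g A b N y eq)) (ℚᵘ.*≤* (subst₂ ℤ._≤_
      (sym (ℤ.*-identityʳ _)) (ℤ.pos-* F (suc g * suc b)) (ℤ.+≤+ le)))))

  small-fraction : ∀ ε → ℚ.0ℚ ℚ.< ε → ∃ λ q → ∀ i g → suc q * ℤ.∣ i ∣ ≤ suc g → ℚ.∣ i ℚ./ suc g ∣ ℚ.< ε
  small-fraction (ℚ.mkℚ (ℤ.+ zero)  d co) (ℚ.*<* (ℤ.+<+ ()))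
  small-fraction (ℚ.mkℚ ℤ.-[1+ a ]  d co) (ℚ.*<* ())
  -- Here `ε` is at least `1 / suc d`, while the choice of `q` bounds the fraction by
  -- `1 / suc (suc d)`.
  small-fraction (ℚ.mkℚ ℤ.+[1+ a ]  d co) _ = suc d , λ i g le → ℚ.toℚᵘ-cancel-<
    (ℚᵘ.<-respˡ-≃ (ℚᵘ.≃-sym (ℚᵘ.≃-trans (ℚ.toℚᵘ-homo-∣-∣ (i ℚ./ suc g)) (ℚᵘ.∣-∣-cong (ℚ.toℚᵘ-fromℚᵘ (mkℚᵘ i g)))))
      (ℚᵘ.*<* (subst₂ ℤ._<_ (ℤ.pos-* ℤ.∣ i ∣ (suc d)) (ℤ.pos-* (suc a) (suc g)) (ℤ.+<+ (bound ℤ.∣ i ∣ g le)))))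
    where
    bound : ∀ x g → suc (suc d) * x ≤ suc g → x * suc d < suc a * suc g
    bound zero    g _  = z<s
    bound (suc x) g le = ≤-trans (≤-trans (s≤s (≤-trans (ℕ.≤-reflexive (ℕ.*-comm (suc x) (suc d))) (ℕ.m≤n+m (suc d * suc x) x))) le)
      (ℕ.m≤m+n (suc g) (a * suc g))

-- The error term is the relative excess of `B * F n` over `A * n ^ l`, cut off at 0. It makes the
-- inequality true by construction, and the hypothesis for `q` says that it is eventually at most
-- `1 / suc q`.
≤[1+o1]-from-ℕ : ∀ (F : ℕ → ℕ) A B l .{{_ : NonZero A}} .{{_ : NonZero B}} →
  (∀ q → Eventually λ n → suc q * (B * F n) ≤ suc (suc q) * (A * n ^ l)) →
  (λ n → fromℕ (F n)) ≤[1+o1] (λ n → (A ÷ B) ℚ.* fromℕ (n ^ l))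
≤[1+o1]-from-ℕ F A B@(suc b) l bound = (λ n → excess (B * F n) (A * n ^ l)) , vanishing , 1 , dominated
  where
  excess : ℕ → ℕ → ℚ
  -- A default for `A * n ^ l ≡ 0`, which does not occur for positive `n`.
  excess x zero    = ℚ.0ℚ
  excess x (suc g) = ℤ.+ (x ∸ suc g) ℚ./ suc g
  vanishing : IsO1 λ n → excess (B * F n) (A * n ^ l)
  vanishing ε 0<ε = let q , small = small-fraction ε 0<ε
                        N , eventually = bound q
                    in N , λ n N≤n → go q small n (eventually n N≤n)
    where
    go : ∀ q → (∀ i g → suc q * ℤ.∣ i ∣ ≤ suc g → ℚ.∣ i ℚ./ suc g ∣ ℚ.< ε) →
         ∀ n → suc q * (B * F n) ≤ suc (suc q) * (A * n ^ l) → ℚ.∣ excess (B * F n) (A * n ^ l) ∣ ℚ.< ε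
    go q small n le with A * n ^ l
    ... | zero  = 0<ε
    ... | suc g = small (ℤ.+ (B * F n ∸ suc g)) g (≤-trans
            (ℕ.≤-reflexive (ℕ.*-distribˡ-∸ (suc q) (B * F n) (suc g)))
            (ℕ.m≤n+o⇒m∸n≤o (suc q * (B * F n)) (suc q * suc g) (≤-trans le (ℕ.≤-reflexive (ℕ.+-comm (suc g) (suc q * suc g))))))
  dominated : ∀ n → 1 ≤ n → fromℕ (F n) ℚ.≤ (ℚ.1ℚ ℚ.+ excess (B * F n) (A * n ^ l)) ℚ.* ((A ÷ B) ℚ.* fromℕ (n ^ l))
  dominated n@(suc _) _ with A * n ^ l in eq | ℕ.m*n≢0 A (n ^ l) {{it}} {{ℕ.m^n≢0 n l}}
  ... | suc g | _ = fraction≤scaled (F n) (ℤ.+ (B * F n ∸ suc g)) g A b (n ^ l) (suc g + (B * F n ∸ suc g))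
      (sym (ℤ.pos-+ (suc g) _)) (begin
        F n * (suc g * B)                          ≡⟨ regroup (F n) (suc g) B ⟩
        B * F n * suc g                            ≤⟨ ℕ.*-monoˡ-≤ (suc g) (ℕ.m≤n+m∸n (B * F n) (suc g)) ⟩
        (suc g + (B * F n ∸ suc g)) * suc g        ≡⟨ cong ((suc g + (B * F n ∸ suc g)) *_) eq ⟨
        (suc g + (B * F n ∸ suc g)) * (A * n ^ l)  ∎)
    where
    open ≤-Reasoning
    regroup : ∀ f g b → f * (g * b) ≡ b * f * g
    regroup = solve-∀

-- The error term is the explicit `- c / suc n`. The threshold includes `c` so that `suc n ∸ c` is a
-- true difference.
≥[1+o1]-from-ℕ : ∀ (F : ℕ → ℕ) A B l c .{{_ : NonZero B}} →
  Eventually (λ n → suc n * (A * n ^ l) ≤ suc n * (B * F n) + c * (A * n ^ l)) →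
  (λ n → fromℕ (F n)) ≥[1+o1] (λ n → (A ÷ B) ℚ.* fromℕ (n ^ l))
≥[1+o1]-from-ℕ F A B@(suc b) l c (N , bound) = (λ n → (ℤ.- ℤ.+ c) ℚ./ suc n) , vanishing , N ⊔ c , dominated
  where
  vanishing : IsO1 λ n → (ℤ.- ℤ.+ c) ℚ./ suc n
  vanishing ε 0<ε with q , small ← small-fraction ε 0<ε = suc q * c , λ n N≤n → small (ℤ.- ℤ.+ c) n
    (≤-trans (ℕ.≤-reflexive (cong (suc q *_) (ℤ.∣-i∣≡∣i∣ (ℤ.+ c)))) (ℕ.m≤n⇒m≤1+n N≤n))
  dominated : ∀ n → N ⊔ c ≤ n → (ℚ.1ℚ ℚ.+ (ℤ.- ℤ.+ c) ℚ./ suc n) ℚ.* ((A ÷ B) ℚ.* fromℕ (n ^ l)) ℚ.≤ fromℕ (F n)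
  dominated n le = scaled≤fraction (F n) (ℤ.- ℤ.+ c) n A b (n ^ l) (suc n ∸ c)
    (trans (ℤ.m-n≡m⊖n (suc n) c) (ℤ.⊖-≥ (ℕ.m≤n⇒m≤1+n (ℕ.m⊔n≤o⇒n≤o N c le)))) (begin
      (suc n ∸ c) * (A * n ^ l)                           ≡⟨ ℕ.*-distribʳ-∸ (A * n ^ l) (suc n) c ⟩
      suc n * (A * n ^ l) ∸ c * (A * n ^ l)               ≤⟨ ℕ.m≤n+o⇒m∸n≤o _ (c * (A * n ^ l)) (≤-trans (bound n (ℕ.m⊔n≤o⇒m≤o N c le)) (ℕ.≤-reflexive (ℕ.+-comm (suc n * (B * F n)) _))) ⟩
      suc n * (B * F n)                                   ≡⟨ regroup (suc n) B (F n) ⟩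
      F n * (suc n * B)                                   ∎)
    where
    open ≤-Reasoning
    regroup : ∀ n b f → n * (b * f) ≡ f * (n * b)
    regroup = solve-∀

-- From bounds on copies to bounds on the extremal number

private
  -- With `d` the error coefficient and `suc q * suc d` in the role of the multiplier, division by
  -- `suc d` leaves an error of at most 1 next to `suc q * a`.
  amplify : ∀ q d c a p → (suc q * suc d) * c ≤ ((suc q * suc d) * a + d) * p → suc q * c ≤ (suc q * a + 1) * p
  amplify q d c a p le = ℕ.*-cancelˡ-≤ (suc d) (begin
    suc d * (suc q * c)                ≡⟨ regroup₁ (suc d) (suc q) c ⟩
    suc q * suc d * c                  ≤⟨ le ⟩
    (suc q * suc d * a + d) * p        ≤⟨ ℕ.*-monoˡ-≤ p (ℕ.+-monoʳ-≤ (suc q * suc d * a) (ℕ.n≤1+n d)) ⟩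
    (suc q * suc d * a + suc d) * p    ≡⟨ regroup₂ (suc q) (suc d) a p ⟩
    suc d * ((suc q * a + 1) * p)      ∎)
    where
    open ≤-Reasoning
    regroup₁ : ∀ d q c → d * (q * c) ≡ q * d * c
    regroup₁ = solve-∀
    regroup₂ : ∀ q d p x → (q * d * p + d) * x ≡ d * ((q * p + 1) * x)
    regroup₂ = solve-∀

  -- Applied with `w` equal to `2 ^ s` and `l` to `3 + s`. The counting yields the constant
  -- `r ^ l / l`, and the constant claimed is `2 ^ s` times that; the error 1 is absorbed by
  -- `1 ≤ a`.
  rescale : ∀ q l e a p w → 1 ≤ a → 1 ≤ w → suc q * (e * l) ≤ (suc q * a + 1) * p →
            suc q * (2 * l * e) ≤ suc (suc q) * (2 * w * a * p)
  rescale q l e a p w 1≤a 1≤w le = begin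
    suc q * (2 * l * e)                ≡⟨ regroup₁ (suc q) l e ⟩
    2 * (suc q * (e * l))              ≤⟨ ℕ.*-monoʳ-≤ 2 le ⟩
    2 * ((suc q * a + 1) * p)          ≤⟨ ℕ.*-monoʳ-≤ 2 (ℕ.*-monoˡ-≤ p (ℕ.+-monoʳ-≤ (suc q * a) 1≤a)) ⟩
    2 * ((suc q * a + a) * p)          ≡⟨ regroup₂ (suc q) a p ⟩
    1 * (suc (suc q) * (2 * a * p))    ≤⟨ ℕ.*-monoˡ-≤ (suc (suc q) * (2 * a * p)) 1≤w ⟩
    w * (suc (suc q) * (2 * a * p))    ≡⟨ regroup₃ w (suc (suc q)) a p ⟩
    suc (suc q) * (2 * w * a * p)      ∎
    where
    open ≤-Reasoning
    regroup₁ : ∀ q l e → q * (2 * l * e) ≡ 2 * (q * (e * l))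
    regroup₁ = solve-∀
    regroup₂ : ∀ q a p → 2 * ((q * a + a) * p) ≡ 1 * (suc q * (2 * a * p))
    regroup₂ = solve-∀
    regroup₃ : ∀ w q a p → w * (q * (2 * a * p)) ≡ q * (2 * w * a * p)
    regroup₃ = solve-∀

  -- The factor is divided out before the maximum is taken. Rounding down is harmless because the
  -- numbers of copies are integers.
  ex-times : ∀ {h f} (H : Graph h) (F : Graph f) l t {b} → (∀ (G : Graph n) → ¬ Contains G F → suc t * (copies G H * suc l) ≤ b) →
             suc t * (ex n H F * suc l) ≤ b
  ex-times {n} H F l t {b} copies≤ = ≤-trans (ℕ.≤-reflexive (regroup (suc t) (ex n H F) (suc l)))
    (≤-trans (ℕ.*-monoˡ-≤ u (ex≤ H F λ G free → ≤-trans (ℕ.≤-reflexive (sym (m*n/n≡m (copies G H) u)))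
      (/-monoˡ-≤ u (≤-trans (ℕ.≤-reflexive (sym (regroup (suc t) (copies G H) (suc l)))) (copies≤ G free))))) (m/n*n≤m b u))
    where
    u = suc t * suc l
    regroup : ∀ t c l → t * (c * l) ≡ c * (t * l)
    regroup = solve-∀

  -- The sum of all that is asked of `n`: to be positive, to satisfy `degree-sum`, and to outweigh
  -- the sequences of big vertices.
  threshold : ℕ → ℕ → ℕ → ℕ
  threshold r s Q = 1 + (Q * Q * rowConst r + Q * (Q * Q * rowConst r) ^ ((3 + s) * 2))

  copies-bound′ : ∀ r s Q → threshold r s Q ≤ n → (G : Graph n) → ¬ Contains G (Cycle (2 * suc r)) →
    Q * (cycleCopies G ((3 + s) * 2) * (3 + s)) ≤ (Q * r ^ (3 + s) + errTotal r s) * n ^ (3 + s)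
  copies-bound′ {n} r s Q large G free = copies-bound G r free Q s {{>-nonZero (≤-trans (ℕ.m≤m+n 1 _) large)}} large₁ large₂
    where
    large₁ : Q * Q * rowConst r ≤ n
    large₁ = ≤-trans (ℕ.≤-trans (ℕ.m≤m+n (Q * Q * rowConst r) _) (ℕ.n≤1+n _)) large
    large₂ : Q * (Q * Q * rowConst r) ^ ((3 + s) * 2) ≤ n
    large₂ = ≤-trans (ℕ.≤-trans (ℕ.m≤n+m (Q * (Q * Q * rowConst r) ^ ((3 + s) * 2)) (Q * Q * rowConst r)) (ℕ.n≤1+n _)) large

  2l-copies-bound : ∀ r s Q → threshold r s Q ≤ n → (G : Graph n) → ¬ Contains G (Cycle (2 * suc r)) →
    Q * (cycleCopies G (2 * (3 + s)) * (3 + s)) ≤ (Q * r ^ (3 + s) + errTotal r s) * n ^ (3 + s)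
  2l-copies-bound {n} r s Q large G free =
    subst (λ M → Q * (cycleCopies G M * (3 + s)) ≤ (Q * r ^ (3 + s) + errTotal r s) * n ^ (3 + s)) (ℕ.*-comm (3 + s) 2)
      (copies-bound′ r s Q large G free)

opaque
  cycleEx : ℕ → ℕ → ℕ → ℕ
  cycleEx n M k = ex n (Cycle M) (Cycle k)

  cycleEx-def : ∀ n M k → cycleEx n M k ≡ ex n (Cycle M) (Cycle k)
  cycleEx-def n M k = refl

  cycleEx-times : ∀ M k l t {b} → (∀ (G : Graph n) → ¬ Contains G (Cycle k) → suc t * (cycleCopies G M * suc l) ≤ b) →
                  suc t * (cycleEx n M k * suc l) ≤ b
  cycleEx-times M k l t {b} copies≤ = ex-times (Cycle M) (Cycle k) l t λ G free →
    subst (λ c → suc t * (c * suc l) ≤ b) (cycleCopies-def G M) (copies≤ G free)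

  cycleEx-≥ : ∀ M k (G : Graph n) → ¬ Contains G (Cycle k) → cycleCopies G M ≤ cycleEx n M k
  cycleEx-≥ {n} M k G free = subst (_≤ ex n (Cycle M) (Cycle k)) (sym (cycleCopies-def G M)) (copies≤ex {H = Cycle M} {F = Cycle k} G free)

exCycles-≤ : ∀ {k l} {g : ℕ → ℚ} → (λ n → fromℕ (cycleEx n (2 * l) (2 * k))) ≤[1+o1] g → exCycles k l ≤[1+o1] g
exCycles-≤ {k} {l} {g} (e , small , N , bound) = e , small , N , λ n N≤n →
  subst (λ x → fromℕ x ℚ.≤ (ℚ.1ℚ ℚ.+ e n) ℚ.* g n) (cycleEx-def n (2 * l) (2 * k)) (bound n N≤n)

exCycles-≥ : ∀ {k l} {g : ℕ → ℚ} → (λ n → fromℕ (cycleEx n (2 * l) (2 * k))) ≥[1+o1] g → exCycles k l ≥[1+o1] g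
exCycles-≥ {k} {l} {g} (e , small , N , bound) = e , small , N , λ n N≤n →
  subst (λ x → (ℚ.1ℚ ℚ.+ e n) ℚ.* g n ℚ.≤ fromℕ x) (cycleEx-def n (2 * l) (2 * k)) (bound n N≤n)

private
  2l-copies-eventually : ∀ r s q n → 1 ≤ r → threshold r s (suc q * suc (errTotal r s)) ≤ n →
    suc q * (2 * (3 + s) * cycleEx n (2 * (3 + s)) (2 * suc r)) ≤ suc (suc q) * (2 ^ suc s * r ^ (3 + s) * n ^ (3 + s))
  2l-copies-eventually r@(suc _) s q n _ large =
    rescale q (3 + s) (cycleEx n (2 * (3 + s)) (2 * suc r)) (r ^ (3 + s)) (n ^ (3 + s)) (2 ^ s) (ℕ.m^n>0 r (3 + s)) (ℕ.m^n>0 2 s)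
      (cycleEx-times (2 * (3 + s)) (2 * suc r) (2 + s) q λ G free →
        amplify q (errTotal r s) (cycleCopies G (2 * (3 + s)) * (3 + s)) (r ^ (3 + s)) (n ^ (3 + s))
          (2l-copies-bound r s (suc q * suc (errTotal r s)) large G free))

upper-bound : ∀ r s l .{{_ : NonZero l}} → 3 + s ≡ l → 1 ≤ r → exCycles (suc r) l ≤[1+o1] bound₁ (suc r) l
upper-bound r s l eq 1≤r = exCycles-≤ {suc r} {l} {bound₁ (suc r) l}
  (≤[1+o1]-from-ℕ (λ n → cycleEx n (2 * l) (2 * suc r)) (2 ^ (l ∸ 2) * r ^ l) (2 * l) l
    {{ℕ.m*n≢0 (2 ^ (l ∸ 2)) (r ^ l) {{ℕ.m^n≢0 2 (l ∸ 2)}} {{ℕ.m^n≢0 r l {{>-nonZero 1≤r}}}}}} {{ℕ.m*n≢0 2 l}}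
    λ q → threshold r s (suc q * suc (errTotal r s)) , λ n large →
      subst (λ l → suc q * (2 * l * cycleEx n (2 * l) (2 * suc r)) ≤ suc (suc q) * (2 ^ (l ∸ 2) * r ^ l * n ^ l)) eq
        (2l-copies-eventually r s q n 1≤r large))

-- Lower bounds from families of labelled cycles

length-filter-split : {A : Set} {P : A → Set} (P? : ∀ x → Dec (P x)) (xs : List A) →
                      length xs ≡ length (filter P? xs) + length (filter (¬? ∘ P?) xs)
length-filter-split P? []       = refl
length-filter-split P? (x ∷ xs) with P? x
... | yes _ = cong suc (length-filter-split P? xs)
... | no  _ = trans (cong suc (length-filter-split P? xs)) (sym (ℕ.+-suc _ _))

fibre-bound : {A B : Set} (F : A → B) (_≟_ : (x y : B) → Dec (x ≡ y)) (R : ℕ) →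
  (∀ y zs → Unique zs → (∀ {z} → z ∈ zs → F z ≡ y) → length zs ≤ R) →
  ∀ ys xs → Unique xs → (∀ {x} → x ∈ xs → F x ∈ ys) → length xs ≤ R * length ys
fibre-bound F _≟_ R fibre []       []      _  _   = z≤n
fibre-bound F _≟_ R fibre []       (x ∷ _) _  F∈  = contradiction (F∈ (here refl)) λ ()
fibre-bound F _≟_ R fibre (y ∷ ys) xs      un F∈  = begin
  length xs                                                   ≡⟨ length-filter-split P? xs ⟩
  length (filter P? xs) + length (filter (¬? ∘ P?) xs)        ≤⟨ ℕ.+-mono-≤
    (fibre y (filter P? xs) (Unique.filter⁺ P? un) (λ z∈ → proj₂ (∈-filter⁻ P? {xs = xs} z∈)))
    (fibre-bound F _≟_ R fibre ys (filter (¬? ∘ P?) xs) (Unique.filter⁺ (¬? ∘ P?) un) others) ⟩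
  R + R * length ys                                           ≡⟨ ℕ.*-suc R (length ys) ⟨
  R * length (y ∷ ys)                                         ∎
  where
  open ≤-Reasoning
  P? = λ x → F x ≟ y
  others : ∀ {x} → x ∈ filter (¬? ∘ P?) xs → F x ∈ ys
  others x∈ with ∈-filter⁻ (¬? ∘ P?) {xs = xs} x∈
  ... | x∈xs , F≢y with F∈ x∈xs
  ... | here F≡y  = contradiction F≡y F≢y
  ... | there F∈ys = F∈ys

unique-map : {A B : Set} {f : A → B} {xs : List A} → (∀ {x y} → x ∈ xs → y ∈ xs → f x ≡ f y → x ≡ y) →
             Unique xs → Unique (List.map f xs)
unique-map inj []        = []
unique-map inj (x∉ ∷ un) = All.map⁺ (All.tabulate λ y∈ eq → All.lookup x∉ y∈ (inj (here refl) (there y∈) eq)) ∷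
  unique-map (λ x∈ y∈ → inj (there x∈) (there y∈)) un

_≟ˢ_ : (S S′ : PartialGraph n) → Dec (S ≡ S′)
(V , graph N s) ≟ˢ (V′ , graph N′ s′) with Vec.≡-dec Bool._≟_ V V′ | Vec.≡-dec (Vec.≡-dec Bool._≟_) N N′
... | yes refl | yes refl = yes refl
... | no V≢V′  | _        = no λ eq → V≢V′ (cong proj₁ eq)
... | yes _    | no N≢N′  = no λ eq → N≢N′ (cong (Graph.nbrs ∘ proj₂) eq)

-- `R` bounds the number of labels of one copy: `2 * l` in complete bipartite graphs, 1 in
-- necklaces.
lower-count : ∀ {A : Set} (G : Graph n) M .{{_ : NonZero M}} → 1 < M → (p : A → ℕ → Fin n) → (∀ a → IsCycle G M (p a)) →
  ∀ R → (∀ S zs → Unique zs → (∀ {z} → z ∈ zs → Traces S (p z)) → length zs ≤ R) →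
  ∀ xs → Unique xs → length xs ≤ R * cycleCopies G M
lower-count G M 1<M p cyc R fibre xs un = subst (λ c → length xs ≤ R * c) (length-cycleCopyList G M)
  (fibre-bound (λ a → trace G M 1<M (cyc a)) _≟ˢ_ R
    (λ S zs un-zs F≡ → fibre S zs un-zs λ {z} z∈ → subst (λ S → Traces S (p z)) (F≡ z∈) (trace-traces G M 1<M (cyc z)))
    (cycleCopyList G M) xs un λ {a} _ → cycleCopyList⁺ G M 1<M (cyc a))

interleave : {A : Set} → (ℕ → A) → (ℕ → A) → ℕ → A
interleave f g zero          = f 0
interleave f g (suc zero)    = g 0
interleave f g (suc (suc i)) = interleave (f ∘ suc) (g ∘ suc) i

interleave-even : {A : Set} (f g : ℕ → A) → ∀ h → interleave f g (h * 2) ≡ f h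
interleave-even f g zero    = refl
interleave-even f g (suc h) = interleave-even (f ∘ suc) (g ∘ suc) h

interleave-odd : {A : Set} (f g : ℕ → A) → ∀ h → interleave f g (1 + h * 2) ≡ g h
interleave-odd f g zero    = refl
interleave-odd f g (suc h) = interleave-odd (f ∘ suc) (g ∘ suc) h

halve : ∀ i → ∃ λ h → i ≡ h * 2 ⊎ i ≡ 1 + h * 2
halve zero          = 0 , inj₁ refl
halve (suc zero)    = 0 , inj₂ refl
halve (suc (suc i)) with halve i
... | h , inj₁ eq = suc h , inj₁ (cong (2 +_) eq)
... | h , inj₂ eq = suc h , inj₂ (cong (2 +_) eq)

module _ {n : ℕ} {G : Graph n} (l : ℕ) (f g : ℕ → Fin n)
  (f-periodic : ∀ i → f (l + i) ≡ f i) (g-periodic : ∀ i → g (l + i) ≡ g i)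
  (f-simple : ∀ i {d} → 0 < d → d < l → f i ≢ f (d + i)) (g-simple : ∀ i {d} → 0 < d → d < l → g i ≢ g (d + i))
  (f≢g : ∀ i j → f i ≢ g j) (fg-edge : ∀ i → Adj G (f i) (g i)) (gf-edge : ∀ i → Adj G (g i) (f (suc i))) where

  private
    p = interleave f g

    even : ∀ {i} h → i ≡ h * 2 → p i ≡ f h
    even h eq = trans (cong p eq) (interleave-even f g h)

    odd : ∀ {i} h → i ≡ 1 + h * 2 → p i ≡ g h
    odd h eq = trans (cong p eq) (interleave-odd f g h)

    -- Positions of equal parity `ρ` at distance `d` are `d / 2` apart on their own side, which is
    -- the distance that `f-simple` and `g-simple` need.
    gap : ∀ ρ h h′ {i d} → i ≡ ρ + h * 2 → d + i ≡ ρ + h′ * 2 → 0 < d → d < l * 2 → ∃ λ e → (0 < e × e < l) × h′ ≡ e + h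
    gap ρ h h′ {d = d} refl eq 0<d d<l*2 with ℕ.<-≤-connex h h′
    ... | inj₂ h′≤h = contradiction (ℕ.≤-<-trans (ℕ.≤-reflexive eq) (ℕ.≤-<-trans (ℕ.+-monoʳ-≤ ρ (ℕ.*-monoˡ-≤ 2 h′≤h)) (ℕ.m<n+m (ρ + h * 2) 0<d))) (ℕ.<-irrefl refl)
    ... | inj₁ h<h′ with e , refl ← ℕ.m≤n⇒∃[o]m+o≡n (ℕ.<⇒≤ h<h′) = e , (0<e , e<l) , ℕ.+-comm h e
      where
      d≡ : d ≡ e * 2
      d≡ = ℕ.+-cancelʳ-≡ (ρ + h * 2) d (e * 2) (trans eq (arith ρ h e))
        where
        arith : ∀ ρ h e → ρ + (h + e) * 2 ≡ e * 2 + (ρ + h * 2)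
        arith = solve-∀
      0<e : 0 < e
      0<e = ℕ.*-cancelʳ-< 2 0 e (subst (0 <_) d≡ 0<d)
      e<l : e < l
      e<l = ℕ.*-cancelʳ-< 2 e l (subst (_< l * 2) d≡ d<l*2)

  interleave-cycle : IsCycle G (l * 2) (interleave f g)
  interleave-cycle = record { periodic = periodic ; simple = simple ; edge = edge }
    where
    periodic : ∀ i → p (l * 2 + i) ≡ p i
    periodic i with halve i
    ... | h , inj₁ eq = trans (even (l + h) (trans (cong (l * 2 +_) eq) (sym (ℕ.*-distribʳ-+ 2 l h)))) (trans (f-periodic h) (sym (even h eq)))
    ... | h , inj₂ eq = trans (odd (l + h) (trans (cong (l * 2 +_) eq) (arith l h))) (trans (g-periodic h) (sym (odd h eq)))
      where
      arith : ∀ l h → l * 2 + (1 + h * 2) ≡ 1 + (l + h) * 2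
      arith = solve-∀
    simple : ∀ i {d} → 0 < d → d < l * 2 → p i ≢ p (d + i)
    simple i {d} 0<d d<l*2 eq with halve i | halve (d + i)
    ... | h , inj₁ e | h′ , inj₂ e′ = f≢g h h′ (trans (sym (even h e)) (trans eq (odd h′ e′)))
    ... | h , inj₂ e | h′ , inj₁ e′ = f≢g h′ h (trans (sym (even h′ e′)) (trans (sym eq) (odd h e)))
    ... | h , inj₁ e | h′ , inj₁ e′ with k , (0<k , k<l) , refl ← gap 0 h h′ e e′ 0<d d<l*2 =
          f-simple h 0<k k<l (trans (sym (even h e)) (trans eq (even h′ e′)))
    ... | h , inj₂ e | h′ , inj₂ e′ with k , (0<k , k<l) , refl ← gap 1 h h′ e e′ 0<d d<l*2 =
          g-simple h 0<k k<l (trans (sym (odd h e)) (trans eq (odd h′ e′)))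
    edge : ∀ i → Adj G (p i) (p (suc i))
    edge i with halve i
    ... | h , inj₁ e = subst₂ (Adj G) (sym (even h e)) (sym (odd h (cong suc e))) (fg-edge h)
    ... | h , inj₂ e = subst₂ (Adj G) (sym (odd h e)) (sym (even (suc h) (cong suc e))) (gf-edge h)

cyclic : {A : Set} {l : ℕ} .{{_ : NonZero l}} → Vec A l → ℕ → A
cyclic {l = l} v i = lookup v (fromℕ< (m%n<n i l))

module _ {A : Set} {l : ℕ} .{{_ : NonZero l}} (v : Vec A l) where

  cyclic-cong : ∀ {i j} → i % l ≡ j % l → cyclic v i ≡ cyclic v j
  cyclic-cong eq = cong (lookup v) (Fin.toℕ-injective (trans (Fin.toℕ-fromℕ< _) (trans eq (sym (Fin.toℕ-fromℕ< _)))))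

  cyclic-periodic : ∀ i → cyclic v (l + i) ≡ cyclic v i
  cyclic-periodic i = cyclic-cong (trans (cong (_% l) (ℕ.+-comm l i)) ([m+n]%n≡m%n i l))

  cyclic-toℕ : ∀ i → cyclic v (toℕ i) ≡ lookup v i
  cyclic-toℕ i = cong (lookup v) (Fin.toℕ-injective (trans (Fin.toℕ-fromℕ< _) (m<n⇒m%n≡m (Fin.toℕ<n i))))

cyclic-simple : ∀ {l} .{{_ : NonZero l}} (v : Vec (Fin n) l) → .(Injective v) →
                ∀ i {d} → 0 < d → d < l → cyclic v i ≢ cyclic v (d + i)
cyclic-simple {l = l} v inj i {d} 0<d d<l eq = ⊥-elim-irr (%-distinct l i 0<d d<l
  (trans (sym (Fin.toℕ-fromℕ< _)) (trans (cong toℕ (inj (fromℕ< (m%n<n i l)) (fromℕ< (m%n<n (d + i) l)) eq)) (Fin.toℕ-fromℕ< _))))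

-- Enumeration of injective vectors

record InjVec (n l : ℕ) : Set where
  constructor injVec
  field
    vec        : Vec (Fin n) l
    .injective : Injective vec

InjVec-ext : ∀ {l} {v w : InjVec n l} → InjVec.vec v ≡ InjVec.vec w → v ≡ w
InjVec-ext refl = refl

private
  avoid? : ∀ {l} (v : Vec (Fin n) l) (x : Fin n) → Dec (¬ (∃ λ i → lookup v i ≡ x))
  avoid? v x = ¬? (Fin.any? λ i → lookup v i Fin.≟ x)

  avoiding : ∀ {l} → Vec (Fin n) l → List (Fin n)
  avoiding v = filter (avoid? v) (allFin _)

  length-avoiding : ∀ {l} (v : Vec (Fin n) l) → n ∸ l ≤ length (avoiding v)
  length-avoiding {n} {l} v = ℕ.m≤n+o⇒m∸n≤o n l (begin
    n                                                              ≡⟨ List.length-tabulate id ⟨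
    length (allFin n)                                              ≤⟨ unique⊆⇒length≤ (Unique.allFin⁺ n) covered ⟩
    length (List.map (lookup v) (allFin l) ++ avoiding v)          ≡⟨ List.length-++ (List.map (lookup v) (allFin l)) ⟩
    length (List.map (lookup v) (allFin l)) + length (avoiding v)  ≡⟨ cong (_+ length (avoiding v)) (trans (List.length-map (lookup v) (allFin l)) (List.length-tabulate id)) ⟩
    l + length (avoiding v)                                        ∎)
    where
    open ≤-Reasoning
    covered : ∀ {x} → x ∈ allFin n → x ∈ List.map (lookup v) (allFin l) ++ avoiding v
    covered {x} x∈ with Fin.any? (λ i → lookup v i Fin.≟ x)
    ... | yes (i , refl) = ∈-++⁺ˡ (∈-map⁺ (lookup v) (∈-allFin i))
    ... | no  none       = ∈-++⁺ʳ (List.map (lookup v) (allFin l)) (∈-filter⁺ (avoid? v) x∈ none)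

  injective-∷ : ∀ {l} (v : Vec (Fin n) l) x → Injective v → ¬ (∃ λ i → lookup v i ≡ x) → Injective (x ∷ v)
  injective-∷ v x inj x∉ zero    zero    _  = refl
  injective-∷ v x inj x∉ zero    (suc j) eq = contradiction (j , sym eq) x∉
  injective-∷ v x inj x∉ (suc i) zero    eq = contradiction (i , eq) x∉
  injective-∷ v x inj x∉ (suc i) (suc j) eq = cong suc (inj i j eq)

  extend : ∀ {l} → (w : InjVec n l) → ∀ xs → All (λ x → ¬ ∃ λ i → lookup (InjVec.vec w) i ≡ x) xs → List (InjVec n (suc l))
  extend w []       []        = []
  extend (injVec v inj) (x ∷ xs) (x∉ ∷ ps) = injVec (x ∷ v) (injective-∷ v x inj x∉) ∷ extend (injVec v inj) xs ps

  length-extend : ∀ {l} (w : InjVec n l) xs ps → length (extend w xs ps) ≡ length xs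
  length-extend w []       []       = refl
  length-extend w (x ∷ xs) (p ∷ ps) = cong suc (length-extend w xs ps)

  ∈-extend : ∀ {l} (w : InjVec n l) xs ps {u} → u ∈ extend w xs ps → Vec.head (InjVec.vec u) ∈ xs × Vec.tail (InjVec.vec u) ≡ InjVec.vec w
  ∈-extend w (x ∷ xs) (p ∷ ps) (here refl) = here refl , refl
  ∈-extend w (x ∷ xs) (p ∷ ps) (there u∈)  = let h , t = ∈-extend w xs ps u∈ in there h , t

  extend-unique : ∀ {l} (w : InjVec n l) xs ps → Unique xs → Unique (extend w xs ps)
  extend-unique w []       []       _         = []
  extend-unique w (x ∷ xs) (p ∷ ps) (x∉ ∷ un) =
    All.tabulate (λ u∈ eq → All.lookup x∉ (proj₁ (∈-extend w xs ps u∈)) (cong (Vec.head ∘ InjVec.vec) eq)) ∷ extend-unique w xs ps un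

  extendFresh : ∀ {l} → InjVec n l → List (InjVec n (suc l))
  extendFresh w = extend w (avoiding (InjVec.vec w)) (All.all-filter (avoid? (InjVec.vec w)) (allFin _))

  length-extendFresh : ∀ {l} (w : InjVec n l) → n ∸ l ≤ length (extendFresh w)
  length-extendFresh w = ≤-trans (length-avoiding (InjVec.vec w)) (ℕ.≤-reflexive (sym
    (length-extend w (avoiding (InjVec.vec w)) (All.all-filter (avoid? (InjVec.vec w)) (allFin _)))))

injVecs : ∀ n l → List (InjVec n l)
injVecs n zero    = injVec [] (λ ()) ∷ []
injVecs n (suc l) = concatMap extendFresh (injVecs n l)

injVecs-unique : ∀ n l → Unique (injVecs n l)
injVecs-unique n zero    = [] ∷ []
injVecs-unique n (suc l) = go (injVecs n l) (injVecs-unique n l)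
  where
  tails : ∀ ws {u} → u ∈ concatMap extendFresh ws → ∃ λ w → w ∈ ws × Vec.tail (InjVec.vec u) ≡ InjVec.vec w
  tails (w ∷ ws) u∈ with ∈-++⁻ (extendFresh w) u∈
  ... | inj₁ u∈w = w , here refl , proj₂ (∈-extend w _ _ u∈w)
  ... | inj₂ u∈ws = let w′ , w′∈ , eq = tails ws u∈ws in w′ , there w′∈ , eq
  go : ∀ ws → Unique ws → Unique (concatMap extendFresh ws)
  go []       _         = []
  go (w ∷ ws) (w∉ ∷ un) = Unique.++⁺ (extend-unique w _ _ (Unique.filter⁺ (avoid? (InjVec.vec w)) (Unique.allFin⁺ n))) (go ws un)
    λ (u∈ , u∈′) → let w′ , w′∈ , eq = tails ws u∈′ in
      All.lookup w∉ w′∈ (InjVec-ext (trans (sym (proj₂ (∈-extend w _ _ u∈))) eq))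

-- A vector with `l` entries leaves at least `n ∸ l` vertices to put in front of it, the factor by
-- which `_P′_` grows.
length-injVecs : ∀ n l → n P′ l ≤ length (injVecs n l)
length-injVecs n zero    = ≤-refl
length-injVecs n (suc l) = begin
  (n ∸ l) * (n P′ l)                               ≤⟨ ℕ.*-monoʳ-≤ (n ∸ l) (length-injVecs n l) ⟩
  (n ∸ l) * length (injVecs n l)                   ≡⟨ ℕ.*-comm (n ∸ l) _ ⟩
  length (injVecs n l) * (n ∸ l)                   ≤⟨ go (injVecs n l) ⟩
  length (concatMap extendFresh (injVecs n l))     ∎
  where
  open ≤-Reasoning
  go : ∀ ws → length ws * (n ∸ l) ≤ length (concatMap extendFresh ws)
  go []       = z≤n
  go (w ∷ ws) = ≤-trans (ℕ.+-mono-≤ (length-extendFresh w) (go ws))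
    (ℕ.≤-reflexive (sym (List.length-++ (extendFresh w))))

-- Falling factorials and shifted powers

power≤P′ : ∀ m l → (m ∸ l) ^ l ≤ m P′ l
power≤P′ m zero    = ≤-refl
power≤P′ m (suc l) = ℕ.*-mono-≤ (ℕ.∸-monoʳ-≤ m (ℕ.n≤1+n l))
  (≤-trans (ℕ.^-monoˡ-≤ l (ℕ.∸-monoʳ-≤ m (ℕ.n≤1+n l))) (power≤P′ m l))

-- Bernoulli's inequality, multiplied by n to avoid the exponent l − 1.
bernoulli : ∀ n d l → n * n ^ l ≤ n * (n ∸ d) ^ l + l * d * n ^ l
bernoulli n d zero    = ℕ.≤-reflexive (sym (ℕ.+-identityʳ _))
bernoulli n d (suc l) = begin
  n * (n * n ^ l)                                    ≤⟨ ℕ.*-monoʳ-≤ n (bernoulli n d l) ⟩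
  n * (n * a ^ l + l * d * n ^ l)                    ≤⟨ ℕ.*-monoʳ-≤ n (ℕ.+-monoˡ-≤ (l * d * n ^ l) (ℕ.*-monoˡ-≤ (a ^ l) (≤-trans (ℕ.m≤n+m∸n n d) (ℕ.≤-reflexive (ℕ.+-comm d a))))) ⟩
  n * ((a + d) * a ^ l + l * d * n ^ l)              ≤⟨ ℕ.*-monoʳ-≤ n (ℕ.+-monoˡ-≤ (l * d * n ^ l) (ℕ.≤-reflexive (ℕ.*-distribʳ-+ (a ^ l) a d))) ⟩
  n * ((a * a ^ l + d * a ^ l) + l * d * n ^ l)      ≤⟨ ℕ.*-monoʳ-≤ n (ℕ.+-monoˡ-≤ (l * d * n ^ l) (ℕ.+-monoʳ-≤ (a * a ^ l) (ℕ.*-monoʳ-≤ d (ℕ.^-monoˡ-≤ l (ℕ.m∸n≤m n d))))) ⟩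
  n * ((a * a ^ l + d * n ^ l) + l * d * n ^ l)      ≡⟨ regroup n (a * a ^ l) d (n ^ l) l ⟩
  n * (a * a ^ l) + suc l * d * (n * n ^ l)          ∎
  where
  open ≤-Reasoning
  a = n ∸ d
  regroup : ∀ n x d p l → n * ((x + d * p) + l * d * p) ≡ n * x + suc l * d * (n * p)
  regroup = solve-∀

-- In the constant `suc (l * d)`, the part `l * d` is the loss in `bernoulli` and the 1 is the price
-- of writing `suc n` for `n`.
≥[1+o1]-from-power : ∀ (F : ℕ → ℕ) A B l d .{{_ : NonZero B}} → Eventually (λ n → A * (n ∸ d) ^ l ≤ B * F n) →
  (λ n → fromℕ (F n)) ≥[1+o1] (λ n → (A ÷ B) ℚ.* fromℕ (n ^ l))
≥[1+o1]-from-power F A B l d (N , bound) = ≥[1+o1]-from-ℕ F A B l (suc (l * d)) (N , λ n N≤n → begin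
  suc n * (A * n ^ l)                                  ≡⟨ regroup₁ n A (n ^ l) ⟩
  A * (n * n ^ l) + A * n ^ l                          ≤⟨ ℕ.+-monoˡ-≤ (A * n ^ l) (ℕ.*-monoʳ-≤ A (bernoulli n d l)) ⟩
  A * (n * (n ∸ d) ^ l + l * d * n ^ l) + A * n ^ l    ≡⟨ regroup₂ A n ((n ∸ d) ^ l) (l * d) (n ^ l) ⟩
  n * (A * (n ∸ d) ^ l) + suc (l * d) * (A * n ^ l)    ≤⟨ ℕ.+-monoˡ-≤ _ (ℕ.*-mono-≤ (ℕ.n≤1+n n) (bound n N≤n)) ⟩
  suc n * (B * F n) + suc (l * d) * (A * n ^ l)        ∎)
  where
  open ≤-Reasoning
  regroup₁ : ∀ n a p → suc n * (a * p) ≡ a * (n * p) + a * p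
  regroup₁ = solve-∀
  regroup₂ : ∀ a n x c p → a * (n * x + c * p) + a * p ≡ n * (a * x) + suc c * (a * p)
  regroup₂ = solve-∀

-- Complete bipartite graphs

length-cartesianProductWith : {A B C : Set} (f : A → B → C) (xs : List A) (ys : List B) →
                              length (cartesianProductWith f xs ys) ≡ length xs * length ys
length-cartesianProductWith f []       ys = refl
length-cartesianProductWith f (x ∷ xs) ys = trans (List.length-++ (List.map (f x) ys))
  (cong₂ _+_ (List.length-map (f x) ys) (length-cartesianProductWith f xs ys))

%-congˡ-+ : ∀ l .{{_ : NonZero l}} c {i j} → i % l ≡ j % l → (c + i) % l ≡ (c + j) % l
%-congˡ-+ l c {i} {j} eq = trans (%-distribˡ-+ c i l) (trans (cong (λ x → (c % l + x) % l) eq) (sym (%-distribˡ-+ c j l)))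

module _ {n : ℕ} {G : Graph n} {M : ℕ} .{{_ : NonZero M}} {p : ℕ → Fin n} (cyc : IsCycle G M p) where
  open IsCycle cyc

  -- A value of `p` fixes its position modulo `M`, and congruence survives `c` further steps.
  cycle-step : ∀ c {s t} → p s ≡ p t → p (c + s) ≡ p (c + t)
  cycle-step c {s} {t} eq = trans (periodic-% cyc (c + s)) (trans (cong p (%-congˡ-+ M c s≡t)) (sym (periodic-% cyc (c + t))))
    where
    s≡t : s % M ≡ t % M
    s≡t = injective-below cyc (m%n<n s M) (m%n<n t M) (trans (sym (periodic-% cyc s)) (trans eq (periodic-% cyc t)))

  -- Up to a period, a step back is `pred M` steps forward.
  cycle-back : ∀ {s t} → p (suc s) ≡ p (suc t) → p s ≡ p t
  cycle-back {s} {t} eq = trans (sym (periodic s)) (trans (trans (cong p (shift s)) (trans (cycle-step (pred M) eq) (cong p (sym (shift t))))) (periodic t))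
    where
    shift : ∀ s → M + s ≡ pred M + suc s
    shift s = trans (cong (_+ s) (sym (ℕ.suc-pred M))) (sym (ℕ.+-suc (pred M) s))

-- Every vertex of a cycle has only two neighbours on it, so the first two entries determine the rest.
traces-determined : ∀ {G : Graph n} {M p p′ S} .{{_ : NonZero M}} → 2 < M → IsCycle G M p → IsCycle G M p′ →
                    Traces S p → Traces S p′ → p 0 ≡ p′ 0 → p 1 ≡ p′ 1 → ∀ i → p i ≡ p′ i
traces-determined {p = p} {p′} 2<M cyc cyc′ tr tr′ eq₀ eq₁ i = proj₁ (go i)
  where
  next : ∀ i → p i ≡ p′ i → p (suc i) ≡ p′ (suc i) → p (suc (suc i)) ≡ p′ (suc (suc i))
  next i eqᵢ eqₛ with Traces.edge⁻ tr (Traces.edge tr′ (suc i))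
  ... | t , inj₁ (at-t , at-t⁺) = trans (cycle-step cyc 1 (trans eqₛ at-t)) (sym at-t⁺)
  -- Were the edge run through backwards, `p′` would be at `p′ i` again after two steps, against
  -- `2 < M`.
  ... | t , inj₂ (at-t , at-t⁺) = contradiction (trans (sym eqᵢ) (trans (cycle-back cyc (trans eqₛ at-t⁺)) (sym at-t)))
          (IsCycle.simple cyc′ i z<s 2<M)
  go : ∀ i → p i ≡ p′ i × p (suc i) ≡ p′ (suc i)
  go zero    = eq₀ , eq₁
  go (suc i) = let eqᵢ , eqₛ = go i in eqₛ , next i eqᵢ eqₛ

not-equal : ∀ {a b} → a ≢ b → b ≡ not a
not-equal {true}  {true}  a≢b = contradiction refl a≢b
not-equal {true}  {false} _   = refl
not-equal {false} {true}  _   = refl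
not-equal {false} {false} a≢b = contradiction refl a≢b

module _ (r m : ℕ) where

  side : Fin (r + m) → Bool
  side v = [ (λ _ → true) , (λ _ → false) ]′ (splitAt r v)

  side-left : ∀ i → side (i ↑ˡ m) ≡ true
  side-left i = cong [ (λ _ → true) , (λ _ → false) ]′ (Fin.splitAt-↑ˡ r i m)

  side-right : ∀ j → side (r ↑ʳ j) ≡ false
  side-right j = cong [ (λ _ → true) , (λ _ → false) ]′ (Fin.splitAt-↑ʳ r m j)

  left-of : ∀ v → side v ≡ true → ∃ λ i → i ↑ˡ m ≡ v
  left-of v sv with splitAt r v in eq
  ... | inj₁ i = i , Fin.splitAt⁻¹-↑ˡ eq

  left≢right : ∀ i j → i ↑ˡ m ≢ r ↑ʳ j
  left≢right i j eq = case trans (sym (side-left i)) (trans (cong side eq) (side-right j)) of λ ()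

  CompleteBipartite : Graph (r + m)
  CompleteBipartite = fromRelation (λ u v → ¬? (side u Bool.≟ side v)) (λ u ne → ne refl) λ u v ne eq → ne (sym eq)

  sides⇒adj : ∀ {u v} → side u ≢ side v → Adj CompleteBipartite u v
  sides⇒adj = Equivalence.from (∈-nbrsOf (λ u v → ¬? (side u Bool.≟ side v)) _ _)

  adj⇒sides : ∀ {u v} → Adj CompleteBipartite u v → side u ≢ side v
  adj⇒sides = Equivalence.to (∈-nbrsOf (λ u v → ¬? (side u Bool.≟ side v)) _ _)

  -- The sides alternate, so positions of one parity put `suc r` distinct vertices on the left side,
  -- which has only `r`.
  no-long-cycle : ∀ {p} → IsCycle CompleteBipartite (2 * suc r) p → ⊥
  no-long-cycle {p} cyc = [ from-left 0 , (λ s₀ → from-left 1 (trans (alternate 0) (cong not s₀))) ]′ (true-dec (side (p 0)))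
    where
    alternate : ∀ i → side (p (suc i)) ≡ not (side (p i))
    alternate i = not-equal (adj⇒sides (IsCycle.edge cyc i))
    same-side : ∀ o → side (p o) ≡ true → ∀ j → side (p (j * 2 + o)) ≡ true
    same-side o so zero    = so
    same-side o so (suc j) = trans (alternate (suc (j * 2 + o))) (cong not (trans (alternate (j * 2 + o)) (cong not (same-side o so j))))
    from-left : ∀ o → side (p o) ≡ true → ⊥
    from-left o so = ℕ.<-irrefl refl (Fin.injective⇒≤ {f = f} injective)
      where
      f : Fin (suc r) → Fin r
      f j = proj₁ (left-of _ (same-side o so (toℕ j)))
      below : ∀ (j : Fin (suc r)) → toℕ j * 2 < 2 * suc r
      below j = ≤-trans (ℕ.*-monoˡ-< 2 (Fin.toℕ<n j)) (ℕ.≤-reflexive (ℕ.*-comm (suc r) 2))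
      injective : ∀ {i j} → f i ≡ f j → i ≡ j
      injective {i} {j} eq = Fin.toℕ-injective (ℕ.*-cancelʳ-≡ (toℕ i) (toℕ j) 2
        (injective-below (shift-cycle o cyc) (below i) (below j)
          (trans (sym (proj₂ (left-of _ (same-side o so (toℕ i))))) (trans (cong (_↑ˡ m) eq) (proj₂ (left-of _ (same-side o so (toℕ j))))))))

  module _ (l : ℕ) .{{_ : NonZero l}} where

    private
      instance
        l*2≢0 : NonZero (l * 2)
        l*2≢0 = ℕ.m*n≢0 l 2

      Choice : Set
      Choice = InjVec r l × InjVec m l

      f g : Choice → ℕ → Fin (r + m)
      f (injVec a _ , _) i = cyclic a i ↑ˡ m
      g (_ , injVec b _) i = r ↑ʳ cyclic b i

      p : Choice → ℕ → Fin (r + m)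
      p z = interleave (f z) (g z)

      cyc : ∀ z → IsCycle CompleteBipartite (l * 2) (p z)
      cyc z@(injVec a a-inj , injVec b b-inj) = interleave-cycle l (f z) (g z)
        (λ i → cong (_↑ˡ m) (cyclic-periodic a i)) (λ i → cong (r ↑ʳ_) (cyclic-periodic b i))
        (λ i 0<d d<l eq → cyclic-simple a a-inj i 0<d d<l (Fin.↑ˡ-injective m _ _ eq))
        (λ i 0<d d<l eq → cyclic-simple b b-inj i 0<d d<l (Fin.↑ʳ-injective r _ _ eq))
        (λ i j → left≢right _ _)
        (λ i → sides⇒adj λ eq → case trans (sym (side-left _)) (trans eq (side-right _)) of λ ())
        (λ i → sides⇒adj λ eq → case trans (sym (side-right _)) (trans eq (side-left _)) of λ ())

      f-cong : ∀ z {i j} → i % l ≡ j % l → f z i ≡ f z j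
      f-cong (injVec a _ , _) eq = cong (_↑ˡ m) (cyclic-cong a eq)

      g-cong : ∀ z {i j} → i % l ≡ j % l → g z i ≡ g z j
      g-cong (_ , injVec b _) eq = cong (r ↑ʳ_) (cyclic-cong b eq)

      f≢g : ∀ z z′ i j → f z i ≢ g z′ j
      f≢g z z′ i j = left≢right _ _

      p-injective : ∀ {z z′} → (∀ i → p z i ≡ p z′ i) → z ≡ z′
      p-injective {z@(injVec a _ , injVec b _)} {z′@(injVec a′ _ , injVec b′ _)} eq = cong₂ _,_ (InjVec-ext (ext a a′ λ i → Fin.↑ˡ-injective m _ _
          (trans (sym (interleave-even (f z) (g z) i)) (trans (eq (i * 2)) (interleave-even (f z′) (g z′) i)))))
        (InjVec-ext (ext b b′ λ i → Fin.↑ʳ-injective r _ _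
          (trans (sym (interleave-odd (f z) (g z) i)) (trans (eq (1 + i * 2)) (interleave-odd (f z′) (g z′) i)))))
        where
        ext : ∀ {k} (v w : Vec (Fin k) l) → (∀ i → cyclic v i ≡ cyclic w i) → v ≡ w
        ext v w eq = trans (sym (tabulate∘lookup v)) (trans
          (tabulate-cong λ i → trans (sym (cyclic-toℕ v i)) (trans (eq (toℕ i)) (cyclic-toℕ w i))) (tabulate∘lookup w))

      key : Choice → Fin (r + m) × Fin (r + m)
      key z = p z 0 , p z 1

      -- The edges of the cycle, each written with its left end first; the two lists are the two
      -- directions of travel. Labellings always start on the left, so the key of any labelling of
      -- the same copy is among them.
      keys : Choice → List (Fin (r + m) × Fin (r + m))
      keys z = List.map (λ i → f z i , g z i) (upTo l) ++ List.map (λ i → f z (suc i) , g z i) (upTo l)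

      length-keys : ∀ z → length (keys z) ≡ 2 * l
      length-keys z = trans (List.length-++ (List.map (λ i → f z i , g z i) (upTo l))) (cong₂ _+_
        (trans (List.length-map _ (upTo l)) (List.length-upTo l))
        (trans (trans (List.length-map _ (upTo l)) (List.length-upTo l)) (sym (ℕ.+-identityʳ l))))

      forward∈ : ∀ z h → (f z h , g z h) ∈ keys z
      forward∈ z h = ∈-++⁺ˡ (subst (_∈ List.map (λ i → f z i , g z i) (upTo l))
        (cong₂ _,_ (f-cong z (m%n%n≡m%n h l)) (g-cong z (m%n%n≡m%n h l)))
        (∈-map⁺ (λ i → f z i , g z i) (∈-upTo⁺ (m%n<n h l))))

      backward∈ : ∀ z h → (f z (suc h) , g z h) ∈ keys z
      backward∈ z h = ∈-++⁺ʳ (List.map (λ i → f z i , g z i) (upTo l)) (subst (_∈ List.map (λ i → f z (suc i) , g z i) (upTo l))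
        (cong₂ _,_ (f-cong z (%-congˡ-+ l 1 (m%n%n≡m%n h l))) (g-cong z (m%n%n≡m%n h l)))
        (∈-map⁺ (λ i → f z (suc i) , g z i) (∈-upTo⁺ (m%n<n h l))))

      key∈keys : ∀ {S} z z′ → Traces S (p z) → Traces S (p z′) → key z′ ∈ keys z
      key∈keys z z′ tr tr′ with Traces.edge⁻ tr (Traces.edge tr′ 0)
      ... | t , inj₁ (at-t , at-t⁺) with halve t
      ... | h , inj₁ refl = subst (_∈ keys z) (sym (cong₂ _,_
              (trans at-t (interleave-even (f z) (g z) h)) (trans at-t⁺ (interleave-odd (f z) (g z) h)))) (forward∈ z h)
      ... | h , inj₂ refl = contradiction (trans at-t (interleave-odd (f z) (g z) h)) (f≢g z′ z 0 h)
      key∈keys z z′ tr tr′ | t , inj₂ (at-t , at-t⁺) with halve t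
      ... | h , inj₂ refl = subst (_∈ keys z) (sym (cong₂ _,_
              (trans at-t⁺ (interleave-even (f z) (g z) (suc h))) (trans at-t (interleave-odd (f z) (g z) h)))) (backward∈ z h)
      ... | h , inj₁ refl = contradiction (trans at-t⁺ (interleave-odd (f z) (g z) h)) (f≢g z′ z 0 h)

      -- By `traces-determined` a labelling of a given copy is determined by its key, and the
      -- `2 * l` keys stand for `l` starting points and two directions.
      fibre : 2 < l * 2 → ∀ S zs → Unique zs → (∀ {z} → z ∈ zs → Traces S (p z)) → length zs ≤ 2 * l
      fibre 2<M S []         _  _  = z≤n
      fibre 2<M S zs@(z ∷ _) un tr = subst₂ _≤_ (List.length-map key zs) (length-keys z)
        (unique⊆⇒length≤ (unique-map (λ {x} {y} x∈ y∈ eq → p-injective (traces-determined 2<M (cyc x) (cyc y) (tr x∈) (tr y∈) (cong proj₁ eq) (cong proj₂ eq))) un)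
          λ k∈ → let y , y∈ , eq = ∈-map⁻ key k∈ in subst (_∈ keys z) (sym eq) (key∈keys z y (tr {z} (here refl)) (tr {y} y∈)))

    bipartite-count : 2 ≤ l → (r P′ l) * (m ∸ l) ^ l ≤ 2 * l * cycleCopies CompleteBipartite (2 * l)
    bipartite-count 2≤l = begin
      (r P′ l) * (m ∸ l) ^ l                                   ≤⟨ ℕ.*-mono-≤ (length-injVecs r l) (≤-trans (power≤P′ m l) (length-injVecs m l)) ⟩
      length (injVecs r l) * length (injVecs m l)              ≡⟨ length-cartesianProductWith _,_ (injVecs r l) (injVecs m l) ⟨
      length (cartesianProduct (injVecs r l) (injVecs m l))
        ≤⟨ lower-count CompleteBipartite (l * 2) (ℕ.<-trans ≤-refl 2<M) p cyc (2 * l) (fibre 2<M) (cartesianProduct (injVecs r l) (injVecs m l))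
             (Unique.cartesianProduct⁺ (injVecs-unique r l) (injVecs-unique m l)) ⟩
      2 * l * cycleCopies CompleteBipartite (l * 2)            ≡⟨ cong (λ M → 2 * l * cycleCopies CompleteBipartite M) (ℕ.*-comm l 2) ⟩
      2 * l * cycleCopies CompleteBipartite (2 * l)            ∎
      where
      open ≤-Reasoning
      2<M : 2 < l * 2
      2<M = ≤-trans (ℕ.n≤1+n 3) (ℕ.*-monoˡ-≤ 2 2≤l)

bipartite-bound : ∀ r l .{{_ : NonZero l}} → 2 ≤ l → exCycles (suc r) l ≥[1+o1] bound₂ (suc r) l
bipartite-bound r l 2≤l = exCycles-≥ {suc r} {l} {bound₂ (suc r) l} (≥[1+o1]-from-power (λ n → cycleEx n (2 * l) (2 * suc r)) (r P′ l) (2 * l) l (r + l) {{ℕ.m*n≢0 2 l}}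
  (r , λ n r≤n → bound n (ℕ.m≤n⇒∃[o]m+o≡n r≤n)))
  where
  bound : ∀ n → (∃ λ m → r + m ≡ n) → (r P′ l) * (n ∸ (r + l)) ^ l ≤ 2 * l * cycleEx n (2 * l) (2 * suc r)
  bound _ (m , refl) = begin
    (r P′ l) * (r + m ∸ (r + l)) ^ l                                ≡⟨ cong (λ x → (r P′ l) * x ^ l) (ℕ.[m+n]∸[m+o]≡n∸o r m l) ⟩
    (r P′ l) * (m ∸ l) ^ l                                          ≤⟨ bipartite-count r m l 2≤l ⟩
    2 * l * cycleCopies (CompleteBipartite r m) (2 * l)
      ≤⟨ ℕ.*-monoʳ-≤ (2 * l) (cycleEx-≥ (2 * l) (2 * suc r) (CompleteBipartite r m)
           λ contains → no-long-cycle r m (proj₂ (contains⇒cycle (CompleteBipartite r m) (2 * suc r) (s≤s (ℕ.m≤n⇒m≤o+n r (s≤s z≤n))) contains))) ⟩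
    2 * l * cycleEx (r + m) (2 * l) (2 * suc r)                     ∎
    where open ≤-Reasoning

-- Blown-up cycles

module _ (l n : ℕ) .{{_ : NonZero l}} where

  Link : Fin n → Fin n → Set
  Link h v = toℕ h < l × l ≤ toℕ v × (toℕ v % l ≡ toℕ h ⊎ suc (toℕ v) % l ≡ toℕ h)

  link? : ∀ h v → Dec (Link h v)
  link? h v = (toℕ h ℕ.<? l) ×-dec ((l ℕ.≤? toℕ v) ×-dec ((toℕ v % l ℕ.≟ toℕ h) ⊎-dec (suc (toℕ v) % l ℕ.≟ toℕ h)))

  -- The cycle of length 2l with every second vertex blown up: the vertices below l are the hubs,
  -- and any other vertex v is joined to the hubs v and v + 1 modulo l.
  Necklace : Graph n
  Necklace = fromRelation (λ u v → link? u v ⊎-dec link? v u)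
    (λ { u (inj₁ (u<l , l≤u , _)) → ℕ.<⇒≱ u<l l≤u ; u (inj₂ (u<l , l≤u , _)) → ℕ.<⇒≱ u<l l≤u })
    (λ u v → Sum.swap)

  links⇒adj : ∀ {u v} → Link u v ⊎ Link v u → Adj Necklace u v
  links⇒adj = Equivalence.from (∈-nbrsOf (λ u v → link? u v ⊎-dec link? v u) _ _)

  adj⇒links : ∀ {u v} → Adj Necklace u v → Link u v ⊎ Link v u
  adj⇒links = Equivalence.to (∈-nbrsOf (λ u v → link? u v ⊎-dec link? v u) _ _)

  suc-%-injective : ∀ {a b} → a < l → b < l → suc a % l ≡ suc b % l → a ≡ b
  suc-%-injective {a} {b} a<l b<l eq = trans (sym (m<n⇒m%n≡m a<l)) (trans
    (trans (sym (unshift a)) (trans (%-congˡ-+ l (pred l) eq) (unshift b))) (m<n⇒m%n≡m b<l))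
    where
    unshift : ∀ x → (pred l + suc x) % l ≡ x % l
    unshift x = trans (cong (_% l) (trans (ℕ.+-suc (pred l) x) (trans (cong (_+ x) (ℕ.suc-pred l)) (ℕ.+-comm l x)))) ([m+n]%n≡m%n x l)

  -- Along a cycle whose length is not 4, the hubs must move round the necklace in one direction.
  no-cycle-from-hub : ∀ k → 3 ≤ k → k < l → ∀ {q} → IsCycle Necklace (k * 2) q → toℕ (q 0) < l → ⊥
  no-cycle-from-hub k 3≤k k<l {q} cyc q₀<l = [ round-up , round-down ]′ (move 0)
    where
    open IsCycle cyc
    6≤2k : 6 ≤ k * 2
    6≤2k = ℕ.*-monoˡ-≤ 2 3≤k
    2<2k : 2 < k * 2
    2<2k = ≤-trans (s≤s (s≤s (s≤s z≤n))) 6≤2k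
    4<2k : 4 < k * 2
    4<2k = ≤-trans (s≤s (s≤s (s≤s (s≤s (s≤s z≤n))))) 6≤2k
    from-hub-edge : ∀ {u v} → Adj Necklace u v → toℕ u < l → Link u v
    from-hub-edge uv u<l with adj⇒links uv
    ... | inj₁ link            = link
    ... | inj₂ (_ , l≤u , _)   = contradiction u<l (ℕ.≤⇒≯ l≤u)
    from-rim-edge : ∀ {u v} → Adj Necklace u v → l ≤ toℕ u → Link v u
    from-rim-edge uv l≤u with adj⇒links uv
    ... | inj₁ (u<l , _)       = contradiction u<l (ℕ.≤⇒≯ l≤u)
    ... | inj₂ link            = link
    hub-at : ∀ j → toℕ (q (j * 2)) < l
    hub-at zero    = q₀<l
    hub-at (suc j) = proj₁ (from-rim-edge (edge (suc (j * 2))) (proj₁ (proj₂ (from-hub-edge (edge (j * 2)) (hub-at j)))))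
    H : ℕ → ℕ
    H j = toℕ (q (j * 2))
    hubs-differ : ∀ j → H j ≢ H (suc j)
    hubs-differ j eq = simple (j * 2) z<s 2<2k (Fin.toℕ-injective eq)
    -- This excludes length 4, where a cycle can go to a neighbouring hub and return through another
    -- copy of the same rim vertex.
    hubs-differ₂ : ∀ j → H j ≢ H (suc (suc j))
    hubs-differ₂ j eq = simple (j * 2) z<s 4<2k (Fin.toℕ-injective eq)
    Up Down : ℕ → Set
    Up j   = H (suc j) ≡ suc (H j) % l
    Down j = H j ≡ suc (H (suc j)) % l
    suc-rim : ∀ v {a} → v % l ≡ a → suc v % l ≡ suc a % l
    suc-rim v refl = %-congˡ-+ l 1 (sym (m%n%n≡m%n v l))
    -- A rim vertex has only two hubs as neighbours, consecutive modulo `l`. The cycle enters and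
    -- leaves it by different hubs, hence moves by one.
    move : ∀ j → Up j ⊎ Down j
    move j with from-hub-edge (edge (j * 2)) (hub-at j)
    ... | _ , rim , near with from-rim-edge (edge (suc (j * 2))) rim
    ... | _ , _ , near′ with near | near′
    ... | inj₁ a | inj₂ b = inj₁ (trans (sym b) (suc-rim (toℕ (q (suc (j * 2)))) a))
    ... | inj₂ a | inj₁ b = inj₂ (trans (sym a) (suc-rim (toℕ (q (suc (j * 2)))) b))
    ... | inj₁ a | inj₁ b = contradiction (trans (sym a) b) (hubs-differ j)
    ... | inj₂ a | inj₂ b = contradiction (trans (sym a) b) (hubs-differ j)
    up-suc : ∀ j → Up j → Up (suc j)
    up-suc j up with move (suc j)
    ... | inj₁ up′  = up′
    ... | inj₂ down = contradiction (suc-%-injective (hub-at j) (hub-at (suc (suc j))) (trans (sym up) down)) (hubs-differ₂ j)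
    down-suc : ∀ j → Down j → Down (suc j)
    down-suc j down with move (suc j)
    ... | inj₂ down′ = down′
    ... | inj₁ up    = contradiction (trans down (sym up)) (hubs-differ₂ j)
    closes : H k ≡ H 0
    closes = cong toℕ (trans (cong q (sym (ℕ.+-identityʳ (k * 2)))) (periodic 0))
    -- `k` moves in one direction change the hub by `k` modulo `l`, and `0 < k < l`.
    impossible : H 0 % l ≢ (k + H 0) % l
    impossible = %-distinct l (H 0) (≤-trans (s≤s z≤n) 3≤k) k<l
    H-reduced : ∀ j → H j % l ≡ H j
    H-reduced j = m<n⇒m%n≡m (hub-at j)
    round-up : Up 0 → ⊥
    round-up up₀ = impossible (trans (cong (_% l) (sym closes)) (trans (H-reduced k) (climb k)))
      where
      ups : ∀ j → Up j
      ups zero    = up₀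
      ups (suc j) = up-suc j (ups j)
      climb : ∀ j → H j ≡ (j + H 0) % l
      climb zero    = sym (H-reduced 0)
      climb (suc j) = trans (ups j) (trans (cong (λ x → suc x % l) (climb j)) (%-congˡ-+ l 1 (m%n%n≡m%n (j + H 0) l)))
    round-down : Down 0 → ⊥
    round-down down₀ = impossible (trans (H-reduced 0) (trans (descend k) (cong (λ x → (k + x) % l) closes)))
      where
      downs : ∀ j → Down j
      downs zero    = down₀
      downs (suc j) = down-suc j (downs j)
      -- Expresses `H 0` through `H j` rather than conversely, so that going down needs no
      -- subtraction.
      descend : ∀ j → H 0 ≡ (j + H j) % l
      descend zero    = sym (H-reduced 0)
      descend (suc j) = trans (descend j) (trans (%-congˡ-+ l j (trans (cong (_% l) (downs j)) (m%n%n≡m%n (suc (H (suc j))) l)))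
        (cong (_% l) (ℕ.+-suc j (H (suc j)))))

  no-short-cycle : ∀ k → 3 ≤ k → k < l → ∀ {p} → IsCycle Necklace (k * 2) p → ⊥
  no-short-cycle k 3≤k k<l cyc with adj⇒links (IsCycle.edge cyc 0)
  ... | inj₁ (hub , _) = no-cycle-from-hub k 3≤k k<l cyc hub
  ... | inj₂ (hub , _) = no-cycle-from-hub k 3≤k k<l (shift-cycle 1 cyc) hub

  module _ (t : ℕ) (room : l + t * l ≤ n) where

    private
      instance
        l*2≢0 : NonZero (l * 2)
        l*2≢0 = ℕ.m*n≢0 l 2

      hub<n : ∀ i → i % l < n
      hub<n i = ℕ.<-≤-trans (m%n<n i l) (≤-trans (ℕ.m≤m+n l (t * l)) room)

      f : ℕ → Fin n
      f i = fromℕ< (hub<n i)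

      -- In the residue class of `i` modulo `l` the smallest vertex is the hub, which `suc` skips;
      -- `c` selects one of the next `t`.
      rim : Vec (Fin t) l → ℕ → ℕ
      rim c i = i % l + suc (toℕ (cyclic c i)) * l

      rim<n : ∀ c i → rim c i < n
      rim<n c i = ℕ.<-≤-trans (ℕ.+-mono-<-≤ (m%n<n i l) (ℕ.*-monoˡ-≤ l (Fin.toℕ<n (cyclic c i)))) room

      g : Vec (Fin t) l → ℕ → Fin n
      g c i = fromℕ< (rim<n c i)

      f-cong : ∀ {i j} → i % l ≡ j % l → f i ≡ f j
      f-cong {i} {j} eq = Fin.toℕ-injective (trans (Fin.toℕ-fromℕ< (hub<n i)) (trans eq (sym (Fin.toℕ-fromℕ< (hub<n j)))))

      g-cong : ∀ c {i j} → i % l ≡ j % l → g c i ≡ g c j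
      g-cong c {i} {j} eq = Fin.toℕ-injective (trans (Fin.toℕ-fromℕ< (rim<n c i))
        (trans (cong₂ (λ b v → b + suc (toℕ v) * l) eq (cyclic-cong c eq)) (sym (Fin.toℕ-fromℕ< (rim<n c j)))))

      toℕ-f : ∀ i → toℕ (f i) ≡ i % l
      toℕ-f i = Fin.toℕ-fromℕ< (hub<n i)

      toℕ-g : ∀ c i → toℕ (g c i) ≡ rim c i
      toℕ-g c i = Fin.toℕ-fromℕ< (rim<n c i)

      g-mod : ∀ c i → toℕ (g c i) % l ≡ i % l
      g-mod c i = trans (cong (_% l) (toℕ-g c i)) (trans ([m+kn]%n≡m%n (i % l) (suc (toℕ (cyclic c i))) l) (m%n%n≡m%n i l))

      f<l : ∀ i → toℕ (f i) < l
      f<l i = subst (_< l) (sym (toℕ-f i)) (m%n<n i l)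

      l≤g : ∀ c i → l ≤ toℕ (g c i)
      l≤g c i = subst (l ≤_) (sym (toℕ-g c i)) (≤-trans (ℕ.m≤m+n l (toℕ (cyclic c i) * l)) (ℕ.m≤n+m _ (i % l)))

      f≢g : ∀ c i j → f i ≢ g c j
      f≢g c i j eq = ℕ.<⇒≱ (f<l i) (subst (l ≤_) (cong toℕ (sym eq)) (l≤g c j))

      p : Vec (Fin t) l → ℕ → Fin n
      p c = interleave f (g c)

      wrap : ∀ i → (l + i) % l ≡ i % l
      wrap i = trans (cong (_% l) (ℕ.+-comm l i)) ([m+n]%n≡m%n i l)

      cyc : ∀ c → IsCycle Necklace (l * 2) (p c)
      cyc c = interleave-cycle l f (g c) (λ i → f-cong (wrap i)) (λ i → g-cong c (wrap i))
        (λ i {d} 0<d d<l eq → %-distinct l i 0<d d<l (trans (sym (toℕ-f i)) (trans (cong toℕ eq) (toℕ-f (d + i)))))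
        (λ i {d} 0<d d<l eq → %-distinct l i 0<d d<l (trans (sym (g-mod c i)) (trans (cong (λ v → toℕ v % l) eq) (g-mod c (d + i)))))
        (f≢g c)
        (λ i → links⇒adj (inj₁ (f<l i , l≤g c i , inj₁ (trans (g-mod c i) (sym (toℕ-f i))))))
        (λ i → links⇒adj (inj₂ (f<l (suc i) , l≤g c i , inj₂ (trans (%-congˡ-+ l 1 (g-mod c i)) (sym (toℕ-f (suc i)))))))

      g-injective : ∀ c c′ i → g c i ≡ g c′ i → cyclic c i ≡ cyclic c′ i
      g-injective c c′ i eq = Fin.toℕ-injective (ℕ.suc-injective (ℕ.*-cancelʳ-≡ _ _ l (ℕ.+-cancelˡ-≡ (i % l) _ _
        (trans (sym (toℕ-g c i)) (trans (cong toℕ eq) (toℕ-g c′ i))))))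

      -- Each of the two cycles has exactly one rim vertex in every residue class modulo `l`, so the
      -- vertex set of a copy alone reveals the choice. No symmetry has to be divided out.
      same-rim : ∀ {S} c c′ → Traces S (p c) → Traces S (p c′) → ∀ i → g c i ≡ g c′ i
      same-rim {S} c c′ tr tr′ i with Traces.vertex⁻ tr′ (subst (Subset._∈ proj₁ S) (interleave-odd f (g c) i) (Traces.vertex tr (1 + i * 2)))
      ... | j , eq with halve j
      ... | h , inj₁ refl = contradiction (trans (sym (interleave-even f (g c′) h)) eq) (f≢g c h i)
      ... | h , inj₂ refl = trans (sym g≡) (g-cong c′ (trans (sym (g-mod c′ h)) (trans (cong (λ v → toℕ v % l) g≡) (g-mod c i))))
        where
        g≡ : g c′ h ≡ g c i
        g≡ = trans (sym (interleave-odd f (g c′) h)) eq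

      same-choice : ∀ {S} c c′ → Traces S (p c) → Traces S (p c′) → c ≡ c′
      same-choice c c′ tr tr′ = trans (sym (tabulate∘lookup c)) (trans (tabulate-cong λ i →
        trans (sym (cyclic-toℕ c i)) (trans (g-injective c c′ (toℕ i) (same-rim c c′ tr tr′ (toℕ i))) (cyclic-toℕ c′ i))) (tabulate∘lookup c′))

      fibre : ∀ S zs → Unique zs → (∀ {z} → z ∈ zs → Traces S (p z)) → length zs ≤ 1
      fibre S []           _               _  = z≤n
      fibre S (_ ∷ [])     _               _  = ≤-refl
      fibre S (c ∷ c′ ∷ _) ((c≢c′ ∷ _) ∷ _) tr = contradiction (same-choice c c′ (tr {c} (here refl)) (tr {c′} (there (here refl)))) c≢c′

      length-allVecs : ∀ s → length (allVecs (allFin t) s) ≡ t ^ s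
      length-allVecs zero    = refl
      length-allVecs (suc s) = trans (length-cartesianProductWith _∷_ (allFin t) (allVecs (allFin t) s))
        (cong₂ _*_ (List.length-tabulate {n = t} id) (length-allVecs s))

    necklace-count : 2 ≤ l → t ^ l ≤ cycleCopies Necklace (2 * l)
    necklace-count 2≤l = begin
      t ^ l                                  ≡⟨ length-allVecs l ⟨
      length (allVecs (allFin t) l)
        ≤⟨ lower-count Necklace (l * 2) (≤-trans (s≤s (s≤s z≤n)) (ℕ.*-monoˡ-≤ 2 2≤l)) p cyc 1 fibre (allVecs (allFin t) l) (allVecs-unique (Unique.allFin⁺ t) l) ⟩
      1 * cycleCopies Necklace (l * 2)       ≡⟨ ℕ.*-identityˡ _ ⟩
      cycleCopies Necklace (l * 2)           ≡⟨ cong (cycleCopies Necklace) (ℕ.*-comm l 2) ⟩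
      cycleCopies Necklace (2 * l)           ∎
      where open ≤-Reasoning

necklace-bound : ∀ k l .{{_ : NonZero l}} → 3 ≤ k → k < l → exCycles k l ≥[1+o1] bound₃ k l
necklace-bound k l 3≤k k<l = exCycles-≥ {k} {l} {bound₃ k l} (≥[1+o1]-from-power (λ n → cycleEx n (2 * l) (2 * k)) 1 (l ^ l) l (l + l) {{ℕ.m^n≢0 l l}}
  (l , bound))
  where
  2≤l : 2 ≤ l
  2≤l = ≤-trans (s≤s (s≤s z≤n)) (ℕ.≤-trans 3≤k (ℕ.<⇒≤ k<l))
  bound : ∀ n → l ≤ n → 1 * (n ∸ (l + l)) ^ l ≤ l ^ l * cycleEx n (2 * l) (2 * k)
  bound n l≤n = begin
    1 * (n ∸ (l + l)) ^ l                    ≡⟨ ℕ.*-identityˡ _ ⟩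
    (n ∸ (l + l)) ^ l                        ≤⟨ ℕ.^-monoˡ-≤ l (ℕ.m≤n+o⇒m∸n≤o n (l + l) n≤) ⟩
    (l * t) ^ l                              ≡⟨ ^-distribʳ-* l l t ⟩
    l ^ l * t ^ l                            ≤⟨ ℕ.*-monoʳ-≤ (l ^ l) (necklace-count l n t room 2≤l) ⟩
    l ^ l * cycleCopies (Necklace l n) (2 * l)
      ≤⟨ ℕ.*-monoʳ-≤ (l ^ l) (cycleEx-≥ (2 * l) (2 * k) (Necklace l n) free) ⟩
    l ^ l * cycleEx n (2 * l) (2 * k)        ∎
    where
    open ≤-Reasoning
    -- The number of full rows of `l` rim vertices above the hubs. The hubs and the incomplete row
    -- lose at most `l` vertices each, whence the shift `l + l`.
    t = (n ∸ l) / l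
    room : l + t * l ≤ n
    room = ≤-trans (ℕ.+-monoʳ-≤ l (m/n*n≤m (n ∸ l) l)) (ℕ.≤-reflexive (ℕ.m+[n∸m]≡n l≤n))
    n≤ : n ≤ l + l + l * t
    n≤ = begin
      n                                      ≡⟨ ℕ.m+[n∸m]≡n l≤n ⟨
      l + (n ∸ l)                            ≡⟨ cong (l +_) (m≡m%n+[m/n]*n (n ∸ l) l) ⟩
      l + ((n ∸ l) % l + t * l)              ≤⟨ ℕ.+-monoʳ-≤ l (ℕ.+-mono-≤ (ℕ.<⇒≤ (m%n<n (n ∸ l) l)) (ℕ.≤-reflexive (ℕ.*-comm t l))) ⟩
      l + (l + l * t)                        ≡⟨ ℕ.+-assoc l l (l * t) ⟨
      l + l + l * t                          ∎
    instance
      k*2≢0 : NonZero (2 * k)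
      k*2≢0 = >-nonZero (≤-trans (s≤s z≤n) (ℕ.*-monoʳ-≤ 2 3≤k))
    free : ¬ Contains (Necklace l n) (Cycle (2 * k))
    free contains = let p , cyc = contains⇒cycle (Necklace l n) (2 * k) (≤-trans (s≤s (s≤s z≤n)) (ℕ.*-monoʳ-≤ 2 3≤k)) contains in
      no-short-cycle l n k 3≤k k<l (subst (λ M → IsCycle (Necklace l n) M p) (ℕ.*-comm 2 k) cyc)

theorem8 : (k l : ℕ) .{{_ : NonZero l}} →
    (3 ≤ l → 2 ≤ k → exCycles k l ≤[1+o1] bound₁ k l) ×
    (2 ≤ l → l < k → exCycles k l ≥[1+o1] bound₂ k l) ×
    (3 ≤ k → k < l → exCycles k l ≥[1+o1] bound₃ k l)
theorem8 k l = upper k l , lower k l , necklace-bound k l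
  where
  upper : ∀ k l .{{_ : NonZero l}} → 3 ≤ l → 2 ≤ k → exCycles k l ≤[1+o1] bound₁ k l
  upper (suc r) l 3≤l (s≤s 1≤r) = let s , eq = ℕ.m≤n⇒∃[o]m+o≡n 3≤l in upper-bound r s l eq 1≤r
  lower : ∀ k l .{{_ : NonZero l}} → 2 ≤ l → l < k → exCycles k l ≥[1+o1] bound₂ k l
  lower (suc r) l 2≤l _ = bipartite-bound r l 2≤l
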